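{- Let $r\ge1$ and let $\underline{a}=0,a_1,\ldots,a_r$ be an $(n,r)$-composition with $a_0=0$. Then $$\bar\gamma(0,a_1,\ldots,a_r;x,y)=f_r(\underline{a})\,T(U_{r,n};x,y)+(xy-x-y)\sum_{k=1}^{r-1}(x-1)^{r-k-1}\left(\sum_{h=0}^{k-1}(-1)^h f_{k,k-h}(\underline{a})\,\tau(k+1,\xi_{k-h}-k-1;y)\right).$$
   Context: An $(n,r)$-composition is an integer sequence $\underline{a}=a_0,a_1,\ldots,a_r$ with $a_0\ge 0$, $a_i\ge 1$ for $1\le i\le r$, and $a_0+\cdots+a_r=n$. It is identified with the bit sequence $0^{a_0}10^{a_1-1}\cdots 10^{a_r-1}$ of length $n$ with exactly $r$ ones (an $(n,r)$-sequence). $\underline{b}\trianglerighteq\underline{a}$ means that every initial segment of $\underline{b}$ contains at least as many $1$'s as the initial segment of $\underline{a}$ of the same length. Partial sums: $\xi_i=a_0+a_1+\cdots+a_i$. $\mathcal{G}(n,r)$ is the vector space, over a field of characteristic zero, with basis the formal symbols $[\underline{b}]$, one for each $(n,r)$-sequence. The linear map $\mathsf{Sp}$ from $\mathcal{G}(n,r)$ to polynomials in $x,y$ is given by $$[r_1\cdots r_n]\mapsto\frac1{n!}\sum_{m=0}^n\binom nm (x-1)^{r-w_m}(y-1)^{m-w_m},\qquad w_m=r_1+\cdots+r_m .$$ With $(t)_k=t(t-1)\cdots(t-k+1)$, $$\gamma(\underline{a})=\sum_{\underline{b}\trianglerighteq\underline{a}}(a_0)_{b_0}\prod_{j=1}^r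 a_j\Big(a_j-1+\sum_{i=0}^{j-1}(a_i-b_i)\Big)_{b_j-1}[0^{b_0}10^{b_1-1}\cdots10^{b_r-1}],$$ and $\bar\gamma(\underline{a};x,y)=\mathsf{Sp}(\gamma(\underline{a}))$. $U_{r,n}$ is the uniform matroid of rank $r$ on $n$ elements, and $T$ denotes the Tutte polynomial: $T(M;x,y)=\sum_{A\subseteq S}(x-1)^{r-\mathrm{rk}(A)}(y-1)^{|A|-\mathrm{rk}(A)}$. For $d\ge1$, $\alpha\ge0$: $\tau(d,\alpha;y)=\sum_{i=0}^{\alpha}\binom{\alpha+d-1-i}{\alpha-i}y^i$; and $\tau(d,\alpha;y)=0$ if $d\le 0$ or $\alpha<0$. Write $a_{i:j}=a_{j:i}=a_i+a_{i+1}+\cdots+a_j$ for $i\le j$. Define $$\nu(0,c_1,\ldots,c_s)=\frac{(c_1+\cdots+c_s)(c_2+\cdots+c_s)\cdots(c_{s-1}+c_s)}{c_1c_2\cdots c_{s-1}}$$ (equal to $1$ when $s\le 1$) and $$f_k(\underline{a})=\frac1{\nu(0,a_1,\ldots,a_k)\,\nu(0,a_{k+1},\ldots,a_r)}$$ (so $f_r(\underline{a})=1/\nu(0,a_1,\ldots,a_r)$). Set $f_{k,k}(\underline{a})=f_k(\underline{a})$ and, for $1\le h\le k-1$, $f_{k,k-h}(\underline{a})=m_{k,k-h}(\underline{a})f_{k-h}(\underline{a})$ with $$m_{k,k-h}(\underline{a})=\frac{a_{r:k+1}\,a_{r:k}\cdots a_{r:k-h+2}}{a_{k:k-h+1}\,a_{k-1:k-h+1}\cdots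 a_{k-h+1:k-h+1}}$$ ($h$ factors in the numerator and $h$ in the denominator). -}

module Defs where

open import Algebra.Apartness.Bundles using (HeytingField; HeytingCommutativeRing)
open import Algebra.Bundles using (CommutativeRing)
open import Algebra.Bundles.Raw using (RawRing)
import Algebra.Definitions.RawMonoid as RawMonoidDefs
import Algebra.Definitions.RawSemiring as RawSemiringDefs
open import Data.Bool.Base using (if_then_else_)
open import Data.Fin.Subset using (Subset; inside; outside; _∪_; _∩_; _⊆_; ∣_∣; ⊤)
import Data.Fin.Subset.Properties as Subset
open import Data.Integer.Base as ℤ using (ℤ; +_; -[1+_])
open import Data.List.Base as List using (List; []; _∷_; _++_; map; foldr; upTo; take; drop; replicate; concatMap)
open import Data.List.Membership.Propositional using (_∈_)
open import Data.List.Membership.Propositional.Properties using (∈-map⁺; ∈-map⁻; ∈-++⁺ˡ; ∈-++⁺ʳ)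
open import Data.List.Relation.Unary.All using ([])
open import Data.List.Relation.Unary.AllPairs using ([]; _∷_)
open import Data.List.Relation.Unary.Any using (here)
open import Data.List.Relation.Unary.Unique.Propositional using (Unique)
open import Data.List.Relation.Unary.Unique.Propositional.Properties using (map⁺; ++⁺)
open import Data.Nat.Base using (ℕ; zero; suc; _+_; _*_; _∸_; _⊓_; _⊔_; _≤_; _<_; z≤n; s≤s; _!)
open import Data.Nat.Combinatorics using (_C_)
import Data.Nat.ListAction as ListAction
import Data.Nat.Properties as ℕ
open import Data.Product.Base using (_×_; _,_; proj₁)
open import Data.Rational.Base as ℚ using (ℚ; mkℚ; 0ℚ; 1ℚ; 1/_)
import Data.Rational.Properties as ℚ
open import Data.Sum.Base using (inj₁; inj₂)
open import Data.Vec.Base as Vec using (Vec; []; _∷_; toList)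
open import Data.Vec.Relation.Unary.All as All using (All; []; _∷_)
open import Function.Base using (_∘_)
open import Relation.Binary.PropositionalEquality
open import Relation.Nullary.Decidable using (Dec; yes; no; does)

private
  variable
    n r : ℕ

[_⋯_] : ℕ → ℕ → List ℕ
[ i ⋯ j ] = map (λ t → i + t) (upTo (suc j ∸ i))

sumℕ prodℕ : List ℕ → (ℕ → ℕ) → ℕ
sumℕ  is f = ListAction.sum (map f is)
prodℕ is f = ListAction.product (map f is)

syntax sumℕ  is (λ i → e) = Σℕ[ i ∈ is ] e
syntax prodℕ is (λ i → e) = Πℕ[ i ∈ is ] e

module BigOperators {c ℓ} (R : RawRing c ℓ) where
  open RawRing R renaming (_+_ to _⊕_; _*_ to _⊗_)

  ∑ ∏ : ∀ {a} {A : Set a} → List A → (A → Carrier) → Carrier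
  ∑ is f = foldr _⊕_ 0# (map f is)
  ∏ is f = foldr _⊗_ 1# (map f is)

  syntax ∑ is (λ i → e) = ∑[ i ∈ is ] e
  syntax ∏ is (λ i → e) = ∏[ i ∈ is ] e

record Composition (n r : ℕ) : Set where
  constructor composition
  field
    first    : ℕ
    rest     : Vec ℕ r
    positive : All (λ c → 1 ≤ c) rest
    total    : first + Vec.sum rest ≡ n

open Composition public

nth : List ℕ → ℕ → ℕ
nth []       _       = 0
nth (c ∷ _)  zero    = c
nth (_ ∷ cs) (suc i) = nth cs i

infix 25 _‼_
-- The i-th term aᵢ; the value 0 for i > r is never used.
_‼_ : Composition n r → ℕ → ℕ
a ‼ zero  = first a
a ‼ suc i = nth (toList (rest a)) i

ξ : Composition n r → ℕ → ℕ
ξ a i = Σℕ[ j ∈ upTo (suc i) ] a ‼ j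

infix 25 _⟨_∶_⟩
-- a_{i:j} = a_{j:i}
_⟨_∶_⟩ : Composition n r → ℕ → ℕ → ℕ
a ⟨ i ∶ j ⟩ = Σℕ[ l ∈ [ i ⊓ j ⋯ i ⊔ j ] ] a ‼ l

bits : Composition n r → List ℕ
bits a = replicate (first a) 0 ++ concatMap (λ c → 1 ∷ replicate (c ∸ 1) 0) (toList (rest a))

-- w_m, the number of ones among the first m bits.
ones : Composition n r → ℕ → ℕ
ones a m = ListAction.sum (take m (bits a))

infix 4 _⊵_ _⊵?_

_⊵_ : Composition n r → Composition n r → Set
_⊵_ {n} b a = ∀ {m} → m < suc n → ones a m ≤ ones b m

_⊵?_ : (b a : Composition n r) → Dec (b ⊵ a)
_⊵?_ {n} b a = ℕ.allUpTo? (λ m → ones a m ℕ.≤? ones b m) (suc n)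

-- The effect on compositions of putting a 0, respectively a 1, in front of the
-- bit sequence.

0∷_ : Composition n r → Composition (suc n) r
0∷ composition b bs pos tot = composition (suc b) bs pos (cong suc tot)

1∷_ : Composition n r → Composition (suc n) (suc r)
1∷ composition b bs pos tot = composition 0 (suc b ∷ bs) (s≤s z≤n ∷ pos) (cong suc tot)

compositions : ∀ n r → List (Composition n r)
compositions zero    zero    = composition 0 [] [] refl ∷ []
compositions zero    (suc r) = []
compositions (suc n) zero    = map 0∷_ (compositions n zero)
compositions (suc n) (suc r) = map 0∷_ (compositions n (suc r)) ++ map 1∷_ (compositions n r)

Composition-≡ : {a b : Composition n r} → first a ≡ first b → rest a ≡ rest b → a ≡ b
Composition-≡ {a = composition _ _ p s} {composition _ _ q t} refl refl
  with refl ← All.irrelevant ℕ.≤-irrelevant p q | refl ← ℕ.≡-irrelevant s t = refl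

compositions-complete : (a : Composition n r) → a ∈ compositions n r
compositions-complete {zero} {zero} (composition zero [] [] refl) = here refl
compositions-complete {suc n} {zero} (composition (suc b) [] [] refl) =
  ∈-map⁺ 0∷_ (compositions-complete (composition b [] [] refl))
compositions-complete {suc n} {suc r} (composition (suc b) bs pos refl) =
  ∈-++⁺ˡ (∈-map⁺ 0∷_ (compositions-complete (composition b bs pos refl)))
compositions-complete {suc n} {suc r} (composition zero (suc c ∷ bs) (s≤s z≤n ∷ pos) refl) =
  ∈-++⁺ʳ (map 0∷_ (compositions n (suc r)))
         (∈-map⁺ 1∷_ (compositions-complete (composition c bs pos refl)))
compositions-complete {zero} {suc r} (composition zero (zero ∷ _) (() ∷ _) _)

compositions-unique : ∀ n r → Unique (compositions n r)
compositions-unique zero    zero    = [] ∷ []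
compositions-unique zero    (suc r) = []
compositions-unique (suc n) zero    = map⁺ 0∷-injective (compositions-unique n zero)
  where
  0∷-injective : {a b : Composition n zero} → 0∷ a ≡ 0∷ b → a ≡ b
  0∷-injective e = Composition-≡ (ℕ.suc-injective (cong first e)) (cong rest e)
compositions-unique (suc n) (suc r) =
  ++⁺ (map⁺ 0∷-injective (compositions-unique n (suc r)))
      (map⁺ 1∷-injective (compositions-unique n r))
      disjoint
  where
  0∷-injective : {a b : Composition n (suc r)} → 0∷ a ≡ 0∷ b → a ≡ b
  0∷-injective e = Composition-≡ (ℕ.suc-injective (cong first e)) (cong rest e)
  1∷-injective : {a b : Composition n r} → 1∷ a ≡ 1∷ b → a ≡ b
  1∷-injective e =
    Composition-≡ (ℕ.suc-injective (cong (Vec.head ∘ rest) e)) (cong (Vec.tail ∘ rest) e)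
  disjoint : ∀ {b} → b ∈ map 0∷_ (compositions n (suc r)) × b ∈ map 1∷_ (compositions n r) → _
  disjoint (p , q) with ∈-map⁻ 0∷_ p | ∈-map⁻ 1∷_ q
  ... | _ , _ , refl | _ , _ , ()

infixl 7 _÷₀_
-- Division made total by p ÷₀ 0 = 0.  For a composition all divisors below are
-- non-zero, since a₁, …, a_r ≥ 1.
_÷₀_ : ℚ → ℚ → ℚ
p ÷₀ q with q ℚ.≟ 0ℚ
... | yes _  = 0ℚ
... | no q≢0 = p ℚ.* 1/_ q {{ℚ.≢-nonZero q≢0}}

ℕ→ℚ : ℕ → ℚ
ℕ→ℚ m = (+ m) ℚ./ 1

ν-numerator ν-denominator : List ℕ → ℕ
ν-numerator []            = 1
ν-numerator (_ ∷ [])      = 1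
ν-numerator (c ∷ d ∷ cs)  = ListAction.sum (c ∷ d ∷ cs) * ν-numerator (d ∷ cs)
ν-denominator []           = 1
ν-denominator (_ ∷ [])     = 1
ν-denominator (c ∷ d ∷ cs) = c * ν-denominator (d ∷ cs)

-- ν (c₁ ∷ … ∷ c_s) is ν(0,c₁,…,c_s).
ν : List ℕ → ℚ
ν cs = ℕ→ℚ (ν-numerator cs) ÷₀ ℕ→ℚ (ν-denominator cs)

f : Composition n r → ℕ → ℚ
f a k = 1ℚ ÷₀ (ν (take k (toList (rest a))) ℚ.* ν (drop k (toList (rest a))))

-- mᵃ a k h is m_{k,k-h}(a) and f₂ a k h is f_{k,k-h}(a).

mᵃ : Composition n r → ℕ → ℕ → ℚ
mᵃ {r = r} a k h =
  ℕ→ℚ (Πℕ[ i ∈ upTo h ] a ⟨ r ∶ (k + 1) ∸ i ⟩)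
    ÷₀ ℕ→ℚ (Πℕ[ i ∈ upTo h ] a ⟨ k ∸ i ∶ (k ∸ h) + 1 ⟩)

f₂ : Composition n r → ℕ → ℕ → ℚ
f₂ a k zero      = f a k
f₂ a k h@(suc _) = mᵃ a k h ℚ.* f a (k ∸ h)

-- A matroid on the ground set Fin n, given by its rank function.
record Matroid (n : ℕ) : Set where
  field
    rk          : Subset n → ℕ
    bounded     : ∀ A → rk A ≤ ∣ A ∣
    monotone    : ∀ {A B} → A ⊆ B → rk A ≤ rk B
    submodular  : ∀ A B → rk (A ∪ B) + rk (A ∩ B) ≤ rk A + rk B

  rank : ℕ
  rank = rk ⊤

subsets : ∀ n → List (Subset n)
subsets zero    = [] ∷ []
subsets (suc n) = map (outside ∷_) (subsets n) ++ map (inside ∷_) (subsets n)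

∣∪∣+∣∩∣ : (A B : Subset n) → ∣ A ∪ B ∣ + ∣ A ∩ B ∣ ≡ ∣ A ∣ + ∣ B ∣
∣∪∣+∣∩∣ []            []            = refl
∣∪∣+∣∩∣ (outside ∷ A) (outside ∷ B) = ∣∪∣+∣∩∣ A B
∣∪∣+∣∩∣ (inside ∷ A)  (outside ∷ B) = cong suc (∣∪∣+∣∩∣ A B)
∣∪∣+∣∩∣ (outside ∷ A) (inside ∷ B)  =
  trans (cong suc (∣∪∣+∣∩∣ A B)) (sym (ℕ.+-suc ∣ A ∣ ∣ B ∣))
∣∪∣+∣∩∣ (inside ∷ A)  (inside ∷ B)  = cong suc
  (trans (ℕ.+-suc _ _) (trans (cong suc (∣∪∣+∣∩∣ A B)) (sym (ℕ.+-suc ∣ A ∣ ∣ B ∣))))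

⊓-submodular : ∀ r (A B : Subset n) →
               (r ⊓ ∣ A ∪ B ∣) + (r ⊓ ∣ A ∩ B ∣) ≤ (r ⊓ ∣ A ∣) + (r ⊓ ∣ B ∣)
⊓-submodular r A B with ℕ.≤-total r ∣ A ∣ | ℕ.≤-total r ∣ B ∣
... | inj₁ r≤A | _ rewrite ℕ.m≤n⇒m⊓n≡m r≤A =
  ℕ.+-mono-≤ (ℕ.m⊓n≤m r _) (ℕ.⊓-monoʳ-≤ r (Subset.∣p∩q∣≤∣q∣ A B))
... | inj₂ _ | inj₁ r≤B rewrite ℕ.m≤n⇒m⊓n≡m r≤B | ℕ.+-comm (r ⊓ ∣ A ∣) r =
  ℕ.+-mono-≤ (ℕ.m⊓n≤m r _) (ℕ.⊓-monoʳ-≤ r (Subset.∣p∩q∣≤∣p∣ A B))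
... | inj₂ A≤r | inj₂ B≤r rewrite ℕ.m≥n⇒m⊓n≡n A≤r | ℕ.m≥n⇒m⊓n≡n B≤r =
  ℕ.≤-trans (ℕ.+-mono-≤ (ℕ.m⊓n≤n r _) (ℕ.m⊓n≤n r _)) (ℕ.≤-reflexive (∣∪∣+∣∩∣ A B))

-- U_{r,n}; its rank is r ⊓ n, hence r whenever an (n,r)-composition exists.
U : ∀ r n → Matroid n
U r n = record
  { rk         = λ A → r ⊓ ∣ A ∣
  ; bounded    = λ A → ℕ.m⊓n≤n r ∣ A ∣
  ; monotone   = λ A⊆B → ℕ.⊓-monoʳ-≤ r (Subset.p⊆q⇒∣p∣≤∣q∣ A⊆B)
  ; submodular = ⊓-submodular r
  }

-- R[X]: coefficient lists, constant coefficient first, compared coefficientwise,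
-- so trailing zeros do not matter.
module _ {c ℓ} (R : RawRing c ℓ) where
  open RawRing R renaming
    (_+_ to _⊕_; _*_ to _⊗_; -_ to ⊖_)

  coefficient : List Carrier → ℕ → Carrier
  coefficient []      _       = 0#
  coefficient (a ∷ _) zero    = a
  coefficient (_ ∷ p) (suc i) = coefficient p i

  add : List Carrier → List Carrier → List Carrier
  add []      q       = q
  add (a ∷ p) []      = a ∷ p
  add (a ∷ p) (b ∷ q) = (a ⊕ b) ∷ add p q

  mul : List Carrier → List Carrier → List Carrier
  mul []      q = []
  mul (a ∷ p) q = add (map (λ b → a ⊗ b) q) (0# ∷ mul p q)

  polynomialRing : RawRing c ℓ
  polynomialRing = record
    { Carrier = List Carrier
    ; _≈_     = λ p q → ∀ i → coefficient p i ≈ coefficient q i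
    ; _+_     = add
    ; _*_     = mul
    ; -_      = map ⊖_
    ; 0#      = []
    ; 1#      = 1# ∷ []
    }

  constant : Carrier → List Carrier
  constant a = a ∷ []

  indeterminate : List Carrier
  indeterminate = 0# ∷ 1# ∷ []

module _ {c ℓ₁ ℓ₂} (K : HeytingField c ℓ₁ ℓ₂) where
  open HeytingField K
  open RawMonoidDefs (RawRing.+-rawMonoid (CommutativeRing.rawRing
    (HeytingCommutativeRing.commutativeRing heytingCommutativeRing)))
    renaming (_×_ to _·_)

  -- On a discrete field (_#_ being _≉_) this is the usual m ≉ 0 for all m ≥ 1.
  CharacteristicZero : Set ℓ₂
  CharacteristicZero = ∀ m → (suc m · 1#) # 0#

module OverField {c ℓ₁ ℓ₂} (K : HeytingField c ℓ₁ ℓ₂) (char0 : CharacteristicZero K) where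

  rawRing : RawRing c ℓ₁
  rawRing = CommutativeRing.rawRing
    (HeytingCommutativeRing.commutativeRing (HeytingField.heytingCommutativeRing K))

  module Scalar where
    open RawRing rawRing public renaming (_+_ to _⊕_; _*_ to _⊗_; -_ to ⊖_)
    open BigOperators rawRing public

    fromℕ : ℕ → Carrier
    fromℕ m = RawMonoidDefs._×_ +-rawMonoid m 1#

    fromℤ : ℤ → Carrier
    fromℤ (+ m)    = fromℕ m
    fromℤ -[1+ m ] = ⊖ fromℕ (suc m)

    -- The inverse of a natural number in K, with 1/ℕ 0 = 0.
    1/ℕ : ℕ → Carrier
    1/ℕ zero    = 0#
    1/ℕ (suc m) = proj₁ (HeytingField.#⇒invertible K (char0 m))

    fromℚ : ℚ → Carrier
    fromℚ p = fromℤ (ℚ.numerator p) ⊗ 1/ℕ (ℚ.denominatorℕ p)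

    falling : Carrier → ℕ → Carrier
    falling t k = ∏[ i ∈ upTo k ] (t ⊕ (⊖ fromℕ i))

  -- K[x][y]: the inner lists are polynomials in x.
  K[x,y] : RawRing c ℓ₁
  K[x,y] = polynomialRing (polynomialRing rawRing)

  open RawRing K[x,y] public
    using (_≈_) renaming (Carrier to Polynomial; _+_ to _⊞_; _*_ to _⊠_; -_ to ⊝_; 1# to 𝟙; 0# to 𝟘)
  open RawSemiringDefs (RawRing.rawSemiring K[x,y]) public
    using (_^_) renaming (_×_ to _·_)
  open BigOperators K[x,y] public

  infixl 6 _⊟_
  _⊟_ : Polynomial → Polynomial → Polynomial
  p ⊟ q = p ⊞ (⊝ q)

  x y : Polynomial
  x = constant (polynomialRing rawRing) (indeterminate rawRing)
  y = indeterminate (polynomialRing rawRing)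

  scalar : Scalar.Carrier → Polynomial
  scalar s = constant (polynomialRing rawRing) (constant rawRing s)

  -- The vector space 𝒢(n,r): g stands for the vector ∑ g(b)[b], the
  -- (n,r)-sequence b being given by its composition.
  𝒢 : ℕ → ℕ → Set c
  𝒢 n r = Composition n r → Scalar.Carrier

  Sp-basis : Composition n r → Polynomial
  Sp-basis {n} {r} b = scalar (Scalar.1/ℕ (n !)) ⊠
    (∑[ m ∈ upTo (suc n) ]
      ((n C m) · ((x ⊟ 𝟙) ^ (r ∸ ones b m) ⊠ (y ⊟ 𝟙) ^ (m ∸ ones b m))))

  Sp : 𝒢 n r → Polynomial
  Sp {n} {r} g = ∑[ b ∈ compositions n r ] (scalar (g b) ⊠ Sp-basis b)

  γ-coefficient : Composition n r → Composition n r → Scalar.Carrier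
  γ-coefficient {n} {r} a b =
    falling (fromℕ (a ‼ 0)) (b ‼ 0) ⊗
    (S.∏[ j ∈ [ 1 ⋯ r ] ]
      (fromℕ (a ‼ j) ⊗
        falling ((fromℕ (a ‼ j) ⊕ (⊖ 1#)) ⊕
                 (S.∑[ i ∈ upTo j ] (fromℕ (a ‼ i) ⊕ (⊖ fromℕ (b ‼ i)))))
                (b ‼ j ∸ 1)))
    where
    open Scalar using (_⊕_; _⊗_; ⊖_; 1#; fromℕ; falling)
    module S = Scalar

  γ : Composition n r → 𝒢 n r
  γ a b = if does (b ⊵? a) then γ-coefficient a b else Scalar.0#

  γ̄ : Composition n r → Polynomial
  γ̄ a = Sp (γ a)

  T : Matroid n → Polynomial
  T {n} M = ∑[ A ∈ subsets n ]
    ((x ⊟ 𝟙) ^ (rank ∸ rk A) ⊠ (y ⊟ 𝟙) ^ (∣ A ∣ ∸ rk A))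
    where open Matroid M

  τ : ℤ → ℤ → Polynomial
  τ (+ suc d) (+ α) = ∑[ i ∈ upTo (suc α) ] (((α + suc d ∸ 1 ∸ i) C (α ∸ i)) · y ^ i)
  τ _         _     = 𝟘

{-# OPTIONS --safe #-}

-- The weight of [b] in γ(a) is a product over the bits of b: when t bits have been
-- read, k of them equal to 1, a bit 0 contributes ξ_k − t and a bit 1 contributes
-- a_{k+1}.  Hence, by induction on n, the sequences b with at most k < r ones among
-- their first m bits have total weight
--   m! (n−m)! Σ_h (−1)^h f_{k,k-h} C(ξ_{k-h}, m),
-- the base case m = 0 being a partial fraction identity with nodes ξ_0 < ⋯ < ξ_k.
-- Abel summation in k of the monomials (x−1)^{r−k} (y−1)^{m−k} produces the factor
-- (x−1)(y−1) − 1 = xy − x − y, and summing over m gives τ, because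
--   τ(k+1, s−k−1; y) = Σ_{m>k} C(s,m) (y−1)^{m−k−1}.
module Submission where

open import Defs
open import Algebra.Apartness.Bundles using (HeytingField; HeytingCommutativeRing)
open import Algebra.Bundles using (CommutativeRing; RawRing; Semiring)
import Algebra.Definitions.RawSemiring as RawSemiringDefs
open import Algebra.Morphism.Construct.Composition using (isRingHomomorphism)
open import Algebra.Morphism.Structures using (IsRingHomomorphism)
import Algebra.Properties.AbelianGroup
import Algebra.Properties.CommutativeSemigroup
import Algebra.Properties.Ring
import Algebra.Properties.Semiring.Mult
import Algebra.Properties.Semiring.Mult.TCOptimised
import Algebra.Solver.Ring
open import Algebra.Solver.Ring.AlmostCommutativeRing using (fromCommutativeRing; _-Raw-AlmostCommutative⟶_)
open import Data.Fin.Subset using (inside; outside; ∣_∣; ⊤)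
open import Data.Fin.Subset.Properties using (∣⊤∣≡n)
open import Data.Integer.Base as ℤ using (ℤ; +_; -[1+_])
import Data.Integer.Properties as ℤ
open import Data.List.Base using (List; []; _∷_; _++_; map; upTo; take; drop; length; replicate; concatMap; foldr)
open import Data.List.Properties using (map-∘; map-applyUpTo; map-upTo; take-all; drop-all)
open import Data.List.Relation.Unary.All using (All; []; _∷_)
import Data.List.Relation.Unary.All.Properties as All
open import Data.Maybe.Base as Maybe using (Maybe)
open import Data.Nat.Base as ℕ using (ℕ; zero; suc; pred; _∸_; _⊓_; _≤_; _<_; z≤n; s≤s; z<s; s<s; _!)
open import Data.Nat.Combinatorics using
  (_C_; nC1≡n; nCn≡1; nCk≡nC[n∸k]; nCk+nC[k+1]≡[n+1]C[k+1]; k>n⇒nCk≡0; nCk≡n!/k![n-k]!; k![n∸k]!∣n!)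
open import Data.Nat.DivMod using (m/n*n≡m)
open import Data.Nat.ListAction using (sum; product)
import Data.Nat.Properties as ℕ
open import Data.Product.Base using (_×_; _,_; proj₁; proj₂)
open import Data.Rational.Base as ℚ using (ℚ; 0ℚ; 1ℚ; 1/_)
import Data.Rational.Literals as ℚ
import Data.Rational.Properties as ℚ
open import Data.Rational.Unnormalised.Base as ℚᵘ using (ℚᵘ; mkℚᵘ; *≡*)
import Data.Sign.Base as Sign
open import Data.Sum.Base using (_⊎_; inj₁; inj₂)
open import Data.Vec.Base as Vec using (Vec; []; _∷_; toList)
open import Data.Vec.Properties using (length-toList)
open import Data.Vec.Relation.Unary.All using ([]; _∷_)
import Data.Vec.Relation.Unary.All.Properties as Vec
open import Function.Base using (_∘_)
open import Relation.Binary.Consequences using (dec⇒weaklyDec)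
open import Relation.Binary.PropositionalEquality as ≡ using (_≡_; _≢_; cong; cong₂)
open import Relation.Nullary.Decidable using (yes; no)
open import Relation.Nullary.Negation using (¬_; contradiction)

-- Finite sums and products

-- For k < r put N = ξ_r. Up to a factor independent of h, (-1)^h f_{k,k-h} is the Lagrange factor ∏
-- 1/(ξ_{k-h} - ξ_i), over i ≤ k with i ≠ k-h, times 1/(N - ξ_{k-h}). The alternating sum over h is
-- thus a divided difference of g(s)/(N - s). For g = 1 it equals 1/ν(0,a_1,...,a_r) whatever k is,
-- as it must at m = 0: an empty prefix has no ones, so every sequence counts. The induction carries
-- a surplus e of zeros ahead of the first block, the nodes becoming e + ξ_j; deleting the first
-- bit, 0 or 1, then stays within the family. The condition b ⊵ a is absorbed by the weights: a
-- sequence violating it reads a 0 at a moment when ξ_k = t. Abel summation leaves a boundary term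
-- at k = r, with exponents r - min(r,m) and m - min(r,m). This is the summand of T(U_{r,n}) for a
-- set of size m, whence the first term of the formula. Equality in a Heyting field is not
-- decidable. All divisions are by positive integers, so the argument runs over a nontrivial
-- commutative ring with reciprocals of these, and case distinctions are made in ℕ or ℚ.

map-upTo-suc : ∀ {a} {A : Set a} (g : ℕ → A) n → map g (upTo (suc n)) ≡ g 0 ∷ map (g ∘ suc) (upTo n)
map-upTo-suc g n = cong (g 0 ∷_)
  (≡.trans (map-applyUpTo suc g n) (≡.sym (map-upTo (g ∘ suc) n)))

module BigOperatorProperties {c ℓ} (R : CommutativeRing c ℓ) where
  open CommutativeRing R
  open BigOperators rawRing
  open import Algebra.Properties.CommutativeSemigroup +-commutativeSemigroup using (interchange)
  open import Relation.Binary.Reasoning.Setoid setoid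

  ∑-cong : ∀ {a} {A : Set a} (is : List A) {g h : A → Carrier} → (∀ i → g i ≈ h i) → ∑ is g ≈ ∑ is h
  ∑-cong []       e = refl
  ∑-cong (i ∷ is) e = +-cong (e i) (∑-cong is e)

  ∑-++ : ∀ {a} {A : Set a} (is js : List A) g → ∑ (is ++ js) g ≈ ∑ is g + ∑ js g
  ∑-++ []       js g = sym (+-identityˡ _)
  ∑-++ (i ∷ is) js g = trans (+-congˡ (∑-++ is js g)) (sym (+-assoc _ _ _))

  ∑-map : ∀ {a b} {A : Set a} {B : Set b} (t : A → B) is g → ∑ (map t is) g ≡ ∑ is (g ∘ t)
  ∑-map t is g = cong (foldr _+_ 0#) (≡.sym (map-∘ is))

  ∑-+ : ∀ {a} {A : Set a} (is : List A) g h → ∑ is (λ i → g i + h i) ≈ ∑ is g + ∑ is h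
  ∑-+ []       g h = sym (+-identityˡ _)
  ∑-+ (i ∷ is) g h = trans (+-congˡ (∑-+ is g h)) (interchange _ _ _ _)

  ∑-*ˡ : ∀ {a} {A : Set a} (is : List A) z g → ∑ is (λ i → z * g i) ≈ z * ∑ is g
  ∑-*ˡ []       z g = sym (zeroʳ z)
  ∑-*ˡ (i ∷ is) z g = trans (+-congˡ (∑-*ˡ is z g)) (sym (distribˡ z _ _))

  ∑-*ʳ : ∀ {a} {A : Set a} (is : List A) z g → ∑ is (λ i → g i * z) ≈ ∑ is g * z
  ∑-*ʳ is z g = trans (∑-cong is (λ _ → *-comm _ z)) (trans (∑-*ˡ is z g) (*-comm z _))

  ∑-0 : ∀ {a} {A : Set a} (is : List A) → ∑ is (λ _ → 0#) ≈ 0#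
  ∑-0 []       = refl
  ∑-0 (i ∷ is) = trans (+-identityˡ _) (∑-0 is)

  ∑-swap : ∀ {a b} {A : Set a} {B : Set b} (is : List A) (js : List B) (g : A → B → Carrier) →
           ∑ is (λ i → ∑ js (g i)) ≈ ∑ js (λ j → ∑ is (λ i → g i j))
  ∑-swap []       js g = sym (∑-0 js)
  ∑-swap (i ∷ is) js g = trans (+-congˡ (∑-swap is js g)) (sym (∑-+ js _ _))

  ∑-upTo-suc : ∀ n g → ∑ (upTo (suc n)) g ≡ g 0 + ∑ (upTo n) (g ∘ suc)
  ∑-upTo-suc n g = cong (foldr _+_ 0#) (map-upTo-suc g n)

  ∑-upTo-last : ∀ n g → ∑ (upTo (suc n)) g ≈ ∑ (upTo n) g + g n
  ∑-upTo-last zero    g = +-comm _ _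
  ∑-upTo-last (suc n) g = begin
    ∑ (upTo (suc (suc n))) g                   ≡⟨ ∑-upTo-suc (suc n) g ⟩
    g 0 + ∑ (upTo (suc n)) (g ∘ suc)           ≈⟨ +-congˡ (∑-upTo-last n (g ∘ suc)) ⟩
    g 0 + (∑ (upTo n) (g ∘ suc) + g (suc n))   ≈⟨ +-assoc _ _ _ ⟨
    (g 0 + ∑ (upTo n) (g ∘ suc)) + g (suc n)   ≡⟨ cong (_+ g (suc n)) (∑-upTo-suc n g) ⟨
    ∑ (upTo (suc n)) g + g (suc n)             ∎

  ∑-upTo-cong : ∀ n {g h} → (∀ i → i < n → g i ≈ h i) → ∑ (upTo n) g ≈ ∑ (upTo n) h
  ∑-upTo-cong zero    e = refl
  ∑-upTo-cong (suc n) {g} {h} e = begin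
    ∑ (upTo (suc n)) g         ≡⟨ ∑-upTo-suc n g ⟩
    g 0 + ∑ (upTo n) (g ∘ suc) ≈⟨ +-cong (e 0 z<s) (∑-upTo-cong n (λ i i<n → e (suc i) (s<s i<n))) ⟩
    h 0 + ∑ (upTo n) (h ∘ suc) ≡⟨ ∑-upTo-suc n h ⟨
    ∑ (upTo (suc n)) h         ∎

  ∏-upTo-suc : ∀ n g → ∏ (upTo (suc n)) g ≡ g 0 * ∏ (upTo n) (g ∘ suc)
  ∏-upTo-suc n g = cong (foldr _*_ 1#) (map-upTo-suc g n)

  ∏-cong : ∀ {a} {A : Set a} (is : List A) {g h : A → Carrier} → (∀ i → g i ≈ h i) → ∏ is g ≈ ∏ is h
  ∏-cong []       e = refl
  ∏-cong (i ∷ is) e = *-cong (e i) (∏-cong is e)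

  ∏-upTo-cong : ∀ n {g h} → (∀ i → i < n → g i ≈ h i) → ∏ (upTo n) g ≈ ∏ (upTo n) h
  ∏-upTo-cong zero    e = refl
  ∏-upTo-cong (suc n) {g} {h} e = begin
    ∏ (upTo (suc n)) g         ≡⟨ ∏-upTo-suc n g ⟩
    g 0 * ∏ (upTo n) (g ∘ suc) ≈⟨ *-cong (e 0 z<s) (∏-upTo-cong n (λ i i<n → e (suc i) (s<s i<n))) ⟩
    h 0 * ∏ (upTo n) (h ∘ suc) ≡⟨ ∏-upTo-suc n h ⟨
    ∏ (upTo (suc n)) h         ∎

  ∏-upTo-last : ∀ n g → ∏ (upTo (suc n)) g ≈ ∏ (upTo n) g * g n
  ∏-upTo-last zero    g = *-comm _ _
  ∏-upTo-last (suc n) g = begin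
    ∏ (upTo (suc (suc n))) g                   ≡⟨ ∏-upTo-suc (suc n) g ⟩
    g 0 * ∏ (upTo (suc n)) (g ∘ suc)           ≈⟨ *-congˡ (∏-upTo-last n (g ∘ suc)) ⟩
    g 0 * (∏ (upTo n) (g ∘ suc) * g (suc n))   ≈⟨ *-assoc _ _ _ ⟨
    (g 0 * ∏ (upTo n) (g ∘ suc)) * g (suc n)   ≡⟨ cong (_* g (suc n)) (∏-upTo-suc n g) ⟨
    ∏ (upTo (suc n)) g * g (suc n)             ∎

  ∏-upTo-reverse : ∀ n g → ∏ (upTo (suc n)) (λ i → g (n ∸ i)) ≈ ∏ (upTo (suc n)) g
  ∏-upTo-reverse zero    g = refl
  ∏-upTo-reverse (suc n) g = begin
    ∏ (upTo (suc (suc n))) (λ i → g (suc n ∸ i)) ≡⟨ ∏-upTo-suc (suc n) (λ i → g (suc n ∸ i)) ⟩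
    g (suc n) * ∏ (upTo (suc n)) (λ i → g (n ∸ i)) ≈⟨ *-congˡ (∏-upTo-reverse n g) ⟩
    g (suc n) * ∏ (upTo (suc n)) g               ≈⟨ *-comm _ _ ⟩
    ∏ (upTo (suc n)) g * g (suc n)               ≈⟨ ∏-upTo-last (suc n) g ⟨
    ∏ (upTo (suc (suc n))) g                     ∎

-- Integer and rational multiples of 1

module IntegerMultiples {c ℓ} (R : CommutativeRing c ℓ) where
  open CommutativeRing R
  open Algebra.Properties.Ring ring
  open Algebra.Properties.AbelianGroup +-abelianGroup using (⁻¹-∙-comm)
  open Algebra.Properties.CommutativeSemigroup +-commutativeSemigroup using (interchange)
  open Algebra.Properties.Semiring.Mult semiring using (×-homo-+; ×1-homo-*) renaming (_×_ to _·_)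
  open Algebra.Properties.Semiring.Mult.TCOptimised semiring using () renaming (_×_ to _·′_; ×ᵤ≈× to ·≈·′)
  open import Relation.Binary.Reasoning.Setoid setoid

  fromℕ : ℕ → Carrier
  fromℕ m = m · 1#

  fromℤ : ℤ → Carrier
  fromℤ (+ m)    = fromℕ m
  fromℤ -[1+ m ] = - fromℕ (suc m)

  fromℕ-1 : fromℕ 1 ≈ 1#
  fromℕ-1 = +-identityʳ 1#

  fromℕ-+ : ∀ m n → fromℕ (m ℕ.+ n) ≈ fromℕ m + fromℕ n
  fromℕ-+ = ×-homo-+ 1#

  fromℕ-* : ∀ m n → fromℕ (m ℕ.* n) ≈ fromℕ m * fromℕ n
  fromℕ-* = ×1-homo-*

  fromℕ-cong : ∀ {m n} → m ≡ n → fromℕ m ≈ fromℕ n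
  fromℕ-cong ≡.refl = refl

  x-0≈x : ∀ x → x - 0# ≈ x
  x-0≈x x = trans (+-congˡ -0#≈0#) (+-identityʳ x)

  fromℤ-⊖ : ∀ m n → fromℤ (m ℤ.⊖ n) ≈ fromℕ m - fromℕ n
  fromℤ-⊖ zero    zero    = sym (x-0≈x 0#)
  fromℤ-⊖ zero    (suc n) = sym (+-identityˡ _)
  fromℤ-⊖ (suc m) zero    = sym (x-0≈x _)
  fromℤ-⊖ (suc m) (suc n) = begin
    fromℤ (suc m ℤ.⊖ suc n)               ≡⟨ ≡.cong fromℤ (ℤ.[1+m]⊖[1+n]≡m⊖n m n) ⟩
    fromℤ (m ℤ.⊖ n)                       ≈⟨ fromℤ-⊖ m n ⟩
    fromℕ m - fromℕ n                     ≈⟨ +-identityˡ _ ⟨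
    0# + (fromℕ m - fromℕ n)              ≈⟨ +-congʳ (-‿inverseʳ 1#) ⟨
    (1# - 1#) + (fromℕ m - fromℕ n)       ≈⟨ interchange _ _ _ _ ⟩
    (1# + fromℕ m) + (- 1# - fromℕ n)     ≈⟨ +-congˡ (⁻¹-∙-comm _ _) ⟩
    fromℕ (suc m) - fromℕ (suc n)         ∎

  fromℤ-+ : ∀ i j → fromℤ (i ℤ.+ j) ≈ fromℤ i + fromℤ j
  fromℤ-+ (+ m)    (+ n)    = fromℕ-+ m n
  fromℤ-+ (+ m)    -[1+ n ] = fromℤ-⊖ m (suc n)
  fromℤ-+ -[1+ m ] (+ n)    = trans (fromℤ-⊖ n (suc m)) (+-comm _ _)
  fromℤ-+ -[1+ m ] -[1+ n ] = begin
    - fromℕ (suc (suc (m ℕ.+ n)))         ≡⟨ ≡.cong (λ k → - fromℕ (suc k)) (ℕ.+-suc m n) ⟨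
    - fromℕ (suc m ℕ.+ suc n)             ≈⟨ -‿cong (fromℕ-+ (suc m) (suc n)) ⟩
    - (fromℕ (suc m) + fromℕ (suc n))     ≈⟨ ⁻¹-∙-comm _ _ ⟨
    - fromℕ (suc m) - fromℕ (suc n)       ∎

  fromℤ-neg : ∀ i → fromℤ (ℤ.- i) ≈ - fromℤ i
  fromℤ-neg (+ zero)  = sym -0#≈0#
  fromℤ-neg (+ suc m) = refl
  fromℤ-neg -[1+ m ]  = sym (-‿involutive _)

  fromℤ--◃ : ∀ n → fromℤ (Sign.- ℤ.◃ n) ≈ - fromℕ n
  fromℤ--◃ zero    = sym -0#≈0#
  fromℤ--◃ (suc n) = refl

  fromℤ-* : ∀ i j → fromℤ (i ℤ.* j) ≈ fromℤ i * fromℤ j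
  fromℤ-* (+ m)    (+ n)    = begin
    fromℤ (Sign.+ ℤ.◃ m ℕ.* n)            ≡⟨ ≡.cong fromℤ (ℤ.+◃n≡+n (m ℕ.* n)) ⟩
    fromℕ (m ℕ.* n)                       ≈⟨ fromℕ-* m n ⟩
    fromℕ m * fromℕ n                     ∎
  fromℤ-* (+ m)    -[1+ n ] = begin
    fromℤ (Sign.- ℤ.◃ m ℕ.* suc n)        ≈⟨ fromℤ--◃ (m ℕ.* suc n) ⟩
    - fromℕ (m ℕ.* suc n)                 ≈⟨ -‿cong (fromℕ-* m (suc n)) ⟩
    - (fromℕ m * fromℕ (suc n))           ≈⟨ -‿distribʳ-* _ _ ⟩
    fromℕ m * - fromℕ (suc n)             ∎
  fromℤ-* -[1+ m ] (+ n)    = begin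
    fromℤ (Sign.- ℤ.◃ suc m ℕ.* n)        ≈⟨ fromℤ--◃ (suc m ℕ.* n) ⟩
    - fromℕ (suc m ℕ.* n)                 ≈⟨ -‿cong (fromℕ-* (suc m) n) ⟩
    - (fromℕ (suc m) * fromℕ n)           ≈⟨ -‿distribˡ-* _ _ ⟩
    - fromℕ (suc m) * fromℕ n             ∎
  fromℤ-* -[1+ m ] -[1+ n ] = begin
    fromℕ (suc m ℕ.* suc n)               ≈⟨ fromℕ-* (suc m) (suc n) ⟩
    fromℕ (suc m) * fromℕ (suc n)         ≈⟨ -‿involutive _ ⟨
    - - (fromℕ (suc m) * fromℕ (suc n))   ≈⟨ -‿cong (-‿distribˡ-* _ _) ⟩
    - (- fromℕ (suc m) * fromℕ (suc n))   ≈⟨ -‿distribʳ-* _ _ ⟩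
    - fromℕ (suc m) * - fromℕ (suc n)     ∎

  -- Unlike fromℤ, sends 0 and 1 to 0# and 1# definitionally, so that the
  -- constants of the solver are the constants of the ring.
  private
    ⟦_⟧ᶻ : ℤ → Carrier
    ⟦ + m ⟧ᶻ      = m ·′ 1#
    ⟦ -[1+ m ] ⟧ᶻ = - (suc m ·′ 1#)

    fromℤ≈⟦⟧ᶻ : ∀ i → fromℤ i ≈ ⟦ i ⟧ᶻ
    fromℤ≈⟦⟧ᶻ (+ m)    = ·≈·′ m 1#
    fromℤ≈⟦⟧ᶻ -[1+ m ] = -‿cong (·≈·′ (suc m) 1#)

    morphism : ℤ.+-*-rawRing -Raw-AlmostCommutative⟶ fromCommutativeRing R
    morphism = record
      { ⟦_⟧    = ⟦_⟧ᶻ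
      ; +-homo = λ i j → trans (sym (fromℤ≈⟦⟧ᶻ (i ℤ.+ j))) (trans (fromℤ-+ i j) (+-cong (fromℤ≈⟦⟧ᶻ i) (fromℤ≈⟦⟧ᶻ j)))
      ; *-homo = λ i j → trans (sym (fromℤ≈⟦⟧ᶻ (i ℤ.* j))) (trans (fromℤ-* i j) (*-cong (fromℤ≈⟦⟧ᶻ i) (fromℤ≈⟦⟧ᶻ j)))
      ; -‿homo = λ i → trans (sym (fromℤ≈⟦⟧ᶻ (ℤ.- i))) (trans (fromℤ-neg i) (-‿cong (fromℤ≈⟦⟧ᶻ i)))
      ; 0-homo = refl
      ; 1-homo = refl
      }

    _≟_ : ∀ i j → Maybe (⟦ i ⟧ᶻ ≈ ⟦ j ⟧ᶻ)
    i ≟ j = Maybe.map (λ { ≡.refl → refl }) (dec⇒weaklyDec ℤ._≟_ i j)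

  module Solver = Algebra.Solver.Ring ℤ.+-*-rawRing (fromCommutativeRing R) morphism _≟_

  IsReciprocal : (ℕ → Carrier) → Set ℓ
  IsReciprocal 1/ℕ = ∀ m → 1/ℕ (suc m) * fromℕ (suc m) ≈ 1#

  Nontrivial : Set ℓ
  Nontrivial = ¬ 1# ≈ 0#

  -- The indicator of w ≤ k. By its recursion a leading bit 1 lowers the number of ones and the
  -- bound together, definitionally.
  χ : ℕ → ℕ → Carrier
  χ zero    k       = 1#
  χ (suc w) zero    = 0#
  χ (suc w) (suc k) = χ w k

  x≈[x-1]+1 : ∀ x → x ≈ x - 1# + 1#
  x≈[x-1]+1 = Solver.solve 1 (λ x → x := x :- con (+ 1) :+ con (+ 1)) refl
    where open Solver

ℕ→ℚ-literal : ∀ m → ℕ→ℚ m ≡ ℚ.fromℤ (+ m)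
ℕ→ℚ-literal m = ℚ.↥p/↧p≡p (ℚ.fromℤ (+ m))

÷₀-cancel : ∀ p q → q ≢ 0ℚ → (p ÷₀ q) ℚ.* q ≡ p
÷₀-cancel p q q≢0 with q ℚ.≟ 0ℚ
... | yes q≡0 = contradiction q≡0 q≢0
... | no  q≢0 = ≡.trans (ℚ.*-assoc p (1/_ q {{ℚ.≢-nonZero q≢0}}) q)
                 (≡.trans (cong (p ℚ.*_) (ℚ.*-inverseˡ q {{ℚ.≢-nonZero q≢0}})) (ℚ.*-identityʳ p))

-- Partial sums and intervals of a composition

private
  variable
    n r : ℕ

Positive : List ℕ → Set
Positive = All (1 ≤_)

σ : List ℕ → ℕ → ℕ
σ as j = sum (take j as)

σ≤sum : ∀ as j → σ as j ≤ sum as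
σ≤sum as       zero    = z≤n
σ≤sum []       (suc j) = z≤n
σ≤sum (a ∷ as) (suc j) = ℕ.+-monoʳ-≤ a (σ≤sum as j)

positive-head : ∀ {a as} → Positive (a ∷ as) → ∀ m → 1 ≤ a ℕ.+ m
positive-head (p ∷ _) m = ℕ.≤-trans p (ℕ.m≤m+n _ m)

Σ-zero : ∀ k → sumℕ (upTo k) (λ _ → 0) ≡ 0
Σ-zero zero    = ≡.refl
Σ-zero (suc k) = ≡.trans (cong sum (map-upTo-suc (λ _ → 0) k)) (Σ-zero k)

Σ-nth : ∀ as l u → sumℕ (upTo (u ∸ l)) (λ t → nth as (l ℕ.+ t)) ≡ σ as u ∸ σ as l
Σ-nth as       zero    zero    = ≡.refl
Σ-nth []       zero    (suc u) = Σ-zero (suc u)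
Σ-nth (a ∷ as) zero    (suc u) = ≡.trans (cong sum (map-upTo-suc (nth (a ∷ as)) u)) (cong (a ℕ.+_) (Σ-nth as zero u))
Σ-nth as       (suc l) zero    = ≡.sym (ℕ.0∸n≡0 (σ as (suc l)))
Σ-nth []       (suc l) (suc u) = Σ-zero (u ∸ l)
Σ-nth (a ∷ as) (suc l) (suc u) = ≡.trans (Σ-nth as l u) (≡.sym (ℕ.[m+n]∸[m+o]≡n∸o a _ _))

ξ-σ : (a : Composition n r) → ∀ i → ξ a i ≡ first a ℕ.+ σ (toList (rest a)) i
ξ-σ a i = ≡.trans (cong sum (map-upTo-suc (a ‼_) i)) (cong (first a ℕ.+_) (Σ-nth (toList (rest a)) 0 i))

Σ-interval : (a : Composition n r) → ∀ l u → sumℕ [ suc l ⋯ u ] (a ‼_) ≡ σ (toList (rest a)) u ∸ σ (toList (rest a)) l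
Σ-interval a l u = ≡.trans (cong sum (≡.sym (map-∘ (upTo (u ∸ l))))) (Σ-nth (toList (rest a)) l u)

⟨∶⟩-σ : (a : Composition n r) → ∀ {l u} → l < u → a ⟨ u ∶ suc l ⟩ ≡ σ (toList (rest a)) u ∸ σ (toList (rest a)) l
⟨∶⟩-σ a {l} {u} l<u = ≡.trans
  (cong₂ (λ i j → sumℕ [ i ⋯ j ] (a ‼_)) (ℕ.m≥n⇒m⊓n≡n l<u) (ℕ.m≥n⇒m⊔n≡m l<u))
  (Σ-interval a l u)

σ-length : ∀ as {k} → length as ≤ k → σ as k ≡ sum as
σ-length as p = cong sum (take-all _ as p)

σ-strict : ∀ {as} → Positive as → ∀ {i j} → i < j → j ≤ length as → σ as i < σ as j
σ-strict (1≤a ∷ pos) {zero}  (s≤s z≤n) (s≤s q) = ℕ.≤-trans 1≤a (ℕ.m≤m+n _ _)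
σ-strict {a ∷ as} (1≤a ∷ pos) {suc i} (s≤s p) (s≤s q)   = ℕ.+-monoʳ-< a (σ-strict pos p q)

-- Binomial coefficients and prefixes of bit sequences

nC0≡1 : ∀ n → n C 0 ≡ 1
nC0≡1 n = ≡.trans (nCk≡nC[n∸k] {0} {n} z≤n) (nCn≡1 n)

[1+k]*[1+n]C[1+k]≡[1+n]*nCk : ∀ n k → suc k ℕ.* (suc n C suc k) ≡ suc n ℕ.* (n C k)
[1+k]*[1+n]C[1+k]≡[1+n]*nCk zero    zero    = ≡.refl
[1+k]*[1+n]C[1+k]≡[1+n]*nCk zero    (suc k) = ≡.trans
  (≡.trans (cong (suc (suc k) ℕ.*_) (k>n⇒nCk≡0 {1} {suc (suc k)} (s<s z<s))) (ℕ.*-zeroʳ k))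
  (≡.sym (cong (1 ℕ.*_) (k>n⇒nCk≡0 {0} {suc k} z<s)))
[1+k]*[1+n]C[1+k]≡[1+n]*nCk (suc n) zero    = begin
  1 ℕ.* (suc (suc n) C 1)              ≡⟨ ℕ.*-identityˡ _ ⟩
  suc (suc n) C 1                      ≡⟨ nC1≡n (suc (suc n)) ⟩
  suc (suc n)                          ≡⟨ ℕ.*-identityʳ _ ⟨
  suc (suc n) ℕ.* 1                    ≡⟨ cong (suc (suc n) ℕ.*_) (nC0≡1 (suc n)) ⟨
  suc (suc n) ℕ.* (suc n C 0)          ∎
  where open ≡.≡-Reasoning
[1+k]*[1+n]C[1+k]≡[1+n]*nCk (suc n) (suc k) = begin
  suc (suc k) ℕ.* (suc (suc n) C suc (suc k))
    ≡⟨ cong (suc (suc k) ℕ.*_) (nCk+nC[k+1]≡[n+1]C[k+1] (suc n) (suc k)) ⟨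
  suc (suc k) ℕ.* (c ℕ.+ (suc n C suc (suc k)))
    ≡⟨ ℕ.*-distribˡ-+ (suc (suc k)) c _ ⟩
  (c ℕ.+ suc k ℕ.* c) ℕ.+ suc (suc k) ℕ.* (suc n C suc (suc k))
    ≡⟨ cong₂ (λ u v → (c ℕ.+ u) ℕ.+ v) ([1+k]*[1+n]C[1+k]≡[1+n]*nCk n k) ([1+k]*[1+n]C[1+k]≡[1+n]*nCk n (suc k)) ⟩
  (c ℕ.+ suc n ℕ.* (n C k)) ℕ.+ suc n ℕ.* (n C suc k)
    ≡⟨ ℕ.+-assoc c _ _ ⟩
  c ℕ.+ (suc n ℕ.* (n C k) ℕ.+ suc n ℕ.* (n C suc k))
    ≡⟨ cong (c ℕ.+_) (ℕ.*-distribˡ-+ (suc n) (n C k) (n C suc k)) ⟨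
  c ℕ.+ suc n ℕ.* ((n C k) ℕ.+ (n C suc k))
    ≡⟨ cong (λ u → c ℕ.+ suc n ℕ.* u) (nCk+nC[k+1]≡[n+1]C[k+1] n k) ⟩
  suc (suc n) ℕ.* c ∎
  where
  open ≡.≡-Reasoning
  c = suc n C suc k

blockBits : List ℕ → List ℕ
blockBits = concatMap (λ c → 1 ∷ replicate (c ∸ 1) 0)

prefixOnes : ℕ → List ℕ → ℕ → ℕ
prefixOnes e as m = sum (take m (replicate e 0 ++ blockBits as))

-- Moving the 1 of 0^e 1 0^(a-1) in front of its zeros can only raise the number of ones in a
-- prefix. The result is a 1 followed by the sequence with surplus e + (a-1).
prefixOnes-∷ : ∀ e a as m → prefixOnes e (a ∷ as) (suc m) ≤ suc (prefixOnes (e ℕ.+ (a ∸ 1)) as m)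
prefixOnes-∷ zero    a as m       = ℕ.≤-refl
prefixOnes-∷ (suc e) a as zero    = z≤n
prefixOnes-∷ (suc e) a as (suc m) = prefixOnes-∷ e a as m

sum-toList : ∀ {r} (as : Vec ℕ r) → Vec.sum as ≡ sum (toList as)
sum-toList []       = ≡.refl
sum-toList (a ∷ as) = cong (a ℕ.+_) (sum-toList as)

-- The bound r is the range of the Abel summation; the bound m ensures that truncating indices at m
-- leaves the monomials of `Sp-basis` unchanged.
ones-bound : (b : Composition n r) → ∀ m → ones b m ≤ r × ones b m ≤ m
ones-bound b zero = z≤n , z≤n
ones-bound (composition (suc b) bs ps ≡.refl) (suc m) with ones-bound (composition b bs ps ≡.refl) m
... | ≤r , ≤m = ≤r , ℕ.m≤n⇒m≤1+n ≤m
ones-bound (composition zero (suc b ∷ bs) (s≤s z≤n ∷ ps) ≡.refl) (suc m) with ones-bound (composition b bs ps ≡.refl) m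
... | ≤r , ≤m = s≤s ≤r , s≤s ≤m
ones-bound (composition zero [] [] ≡.refl) (suc m) = z≤n , z≤n

nCk*k![n∸k]!≡n! : ∀ {n k} → k ≤ n → (n C k) ℕ.* (k ! ℕ.* (n ∸ k) !) ≡ n !
nCk*k![n∸k]!≡n! {n} {k} k≤n = ≡.trans (cong (ℕ._* (k ! ℕ.* (n ∸ k) !)) (nCk≡n!/k![n-k]! k≤n))
  (m/n*n≡m {{k ℕ.!* (n ∸ k) !≢0}} (k![n∸k]!∣n! k≤n))

length≤sum : ∀ {r} (as : Vec ℕ r) → Positive (toList as) → r ≤ sum (toList as)
length≤sum []       _           = z≤n
length≤sum (a ∷ as) (1≤a ∷ pos) = ℕ.+-mono-≤ 1≤a (length≤sum as pos)

-- The coefficients f_{k,k-h} and the weights of γ(a)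

module RationalScalars {c ℓ} (R : CommutativeRing c ℓ) (1/ℕ : ℕ → CommutativeRing.Carrier R)
  (1/ℕ-inverse : IntegerMultiples.IsReciprocal R 1/ℕ) (1≉0 : IntegerMultiples.Nontrivial R) where

  open CommutativeRing R hiding (zero)
  open IntegerMultiples R
  open Solver using (solve; _:=_; _:*_; _:+_; _:-_; :-_; con)
  open BigOperators rawRing
  open BigOperatorProperties R
  open RawSemiringDefs (Semiring.rawSemiring semiring) using (_^_)
  open import Relation.Binary.Reasoning.Setoid setoid

  1/ℕ-inverse′ : ∀ {m} → 1 ≤ m → 1/ℕ m * fromℕ m ≈ 1#
  1/ℕ-inverse′ {suc m} _ = 1/ℕ-inverse m

  fromℕ-cancelʳ : ∀ {x y m} → 1 ≤ m → x * fromℕ m ≈ y * fromℕ m → x ≈ y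
  fromℕ-cancelʳ {x} {y} {m} 1≤m e = begin
    x                        ≈⟨ lemma x ⟨
    x * fromℕ m * 1/ℕ m      ≈⟨ *-congʳ e ⟩
    y * fromℕ m * 1/ℕ m      ≈⟨ lemma y ⟩
    y                        ∎
    where
    lemma : ∀ z → z * fromℕ m * 1/ℕ m ≈ z
    lemma z = begin
      z * fromℕ m * 1/ℕ m    ≈⟨ solve 3 (λ z m i → z :* m :* i := z :* (i :* m)) refl z (fromℕ m) (1/ℕ m) ⟩
      z * (1/ℕ m * fromℕ m)  ≈⟨ *-congˡ (1/ℕ-inverse′ 1≤m) ⟩
      z * 1#                 ≈⟨ *-identityʳ z ⟩
      z                      ∎

  1/ℕ-* : ∀ {m n} → 1 ≤ m → 1 ≤ n → 1/ℕ (m ℕ.* n) ≈ 1/ℕ m * 1/ℕ n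
  1/ℕ-* {m} {n} 1≤m 1≤n = fromℕ-cancelʳ (ℕ.*-mono-≤ 1≤m 1≤n) (begin
    1/ℕ (m ℕ.* n) * fromℕ (m ℕ.* n)       ≈⟨ 1/ℕ-inverse′ (ℕ.*-mono-≤ 1≤m 1≤n) ⟩
    1#                                    ≈⟨ *-identityˡ 1# ⟨
    1# * 1#                               ≈⟨ *-cong (1/ℕ-inverse′ 1≤m) (1/ℕ-inverse′ 1≤n) ⟨
    1/ℕ m * fromℕ m * (1/ℕ n * fromℕ n)   ≈⟨ solve 4 (λ a b c d → a :* b :* (c :* d) := a :* c :* (b :* d)) refl (1/ℕ m) (fromℕ m) (1/ℕ n) (fromℕ n) ⟩
    1/ℕ m * 1/ℕ n * (fromℕ m * fromℕ n)   ≈⟨ *-congˡ (fromℕ-* m n) ⟨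
    1/ℕ m * 1/ℕ n * fromℕ (m ℕ.* n)       ∎)

  1/ℕ-1 : 1/ℕ 1 ≈ 1#
  1/ℕ-1 = begin
    1/ℕ 1             ≈⟨ *-identityʳ _ ⟨
    1/ℕ 1 * 1#        ≈⟨ *-congˡ fromℕ-1 ⟨
    1/ℕ 1 * fromℕ 1   ≈⟨ 1/ℕ-inverse 0 ⟩
    1#                ∎

  private
    fromℚᵘ : ℚᵘ → Carrier
    fromℚᵘ (mkℚᵘ i d) = fromℤ i * 1/ℕ (suc d)

    fromℚᵘ-denominator : ∀ p → fromℚᵘ p * fromℕ (ℚᵘ.denominatorℕ p) ≈ fromℤ (ℚᵘ.numerator p)
    fromℚᵘ-denominator (mkℚᵘ i d) = trans (*-assoc _ _ _) (trans (*-congˡ (1/ℕ-inverse d)) (*-identityʳ _))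

    -- Products in ℚ are reduced to lowest terms, so the value has to be independent of the
    -- representative. The cross-multiplied integer equation is mapped into the ring, where the
    -- positive denominators cancel.
    fromℚᵘ-cong : ∀ {p q} → p ℚᵘ.≃ q → fromℚᵘ p ≈ fromℚᵘ q
    fromℚᵘ-cong {p@(mkℚᵘ i d)} {q@(mkℚᵘ j e)} (*≡* eq) =
      fromℕ-cancelʳ {m = suc d} ℕ.z<s (fromℕ-cancelʳ {m = suc e} ℕ.z<s (begin
        fromℚᵘ p * fromℕ (suc d) * fromℕ (suc e)     ≈⟨ *-congʳ (fromℚᵘ-denominator p) ⟩
        fromℤ i * fromℕ (suc e)                      ≈⟨ fromℤ-* i (+ suc e) ⟨
        fromℤ (i ℤ.* + suc e)                        ≡⟨ cong fromℤ eq ⟩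
        fromℤ (j ℤ.* + suc d)                        ≈⟨ fromℤ-* j (+ suc d) ⟩
        fromℤ j * fromℕ (suc d)                      ≈⟨ *-congʳ (fromℚᵘ-denominator q) ⟨
        fromℚᵘ q * fromℕ (suc e) * fromℕ (suc d)     ≈⟨ solve 3 (λ a b c → a :* b :* c := a :* c :* b) refl (fromℚᵘ q) (fromℕ (suc e)) (fromℕ (suc d)) ⟩
        fromℚᵘ q * fromℕ (suc d) * fromℕ (suc e)     ∎))

    fromℚᵘ-* : ∀ p q → fromℚᵘ (p ℚᵘ.* q) ≈ fromℚᵘ p * fromℚᵘ q
    fromℚᵘ-* (mkℚᵘ i d) (mkℚᵘ j e) = begin
      fromℤ (i ℤ.* j) * 1/ℕ (suc d ℕ.* suc e)            ≈⟨ *-cong (fromℤ-* i j) (1/ℕ-* {suc d} {suc e} ℕ.z<s ℕ.z<s) ⟩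
      fromℤ i * fromℤ j * (1/ℕ (suc d) * 1/ℕ (suc e))    ≈⟨ solve 4 (λ a b c d → a :* b :* (c :* d) := a :* c :* (b :* d)) refl (fromℤ i) (fromℤ j) (1/ℕ (suc d)) (1/ℕ (suc e)) ⟩
      fromℤ i * 1/ℕ (suc d) * (fromℤ j * 1/ℕ (suc e))    ∎

  fromℚ : ℚ → Carrier
  fromℚ p = fromℤ (ℚ.numerator p) * 1/ℕ (ℚ.denominatorℕ p)

  fromℚ-toℚᵘ : ∀ p → fromℚ p ≡ fromℚᵘ (ℚ.toℚᵘ p)
  fromℚ-toℚᵘ record{} = ≡.refl

  fromℚ-* : ∀ p q → fromℚ (p ℚ.* q) ≈ fromℚ p * fromℚ q
  fromℚ-* p q = begin
    fromℚ (p ℚ.* q)                               ≡⟨ fromℚ-toℚᵘ (p ℚ.* q) ⟩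
    fromℚᵘ (ℚ.toℚᵘ (p ℚ.* q))                     ≈⟨ fromℚᵘ-cong (ℚ.toℚᵘ-homo-* p q) ⟩
    fromℚᵘ (ℚ.toℚᵘ p ℚᵘ.* ℚ.toℚᵘ q)               ≈⟨ fromℚᵘ-* (ℚ.toℚᵘ p) (ℚ.toℚᵘ q) ⟩
    fromℚᵘ (ℚ.toℚᵘ p) * fromℚᵘ (ℚ.toℚᵘ q)         ≡⟨ ≡.cong₂ _*_ (fromℚ-toℚᵘ p) (fromℚ-toℚᵘ q) ⟨
    fromℚ p * fromℚ q                             ∎

  fromℚ-ℕ→ℚ : ∀ m → fromℚ (ℕ→ℚ m) ≈ fromℕ m
  fromℚ-ℕ→ℚ m = begin
    fromℚ (ℕ→ℚ m)          ≡⟨ cong fromℚ (ℕ→ℚ-literal m) ⟩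
    fromℕ m * 1/ℕ 1        ≈⟨ *-congˡ 1/ℕ-1 ⟩
    fromℕ m * 1#           ≈⟨ *-identityʳ _ ⟩
    fromℕ m                ∎

  -- The equation (p ÷₀ q) · q = p determines the image of the quotient once the image of q has an
  -- inverse u. Such a u also rules out q = 0, the default branch of `_÷₀_`, because the ring is
  -- nontrivial.
  fromℚ-÷₀ : ∀ p q {u} → u * fromℚ q ≈ 1# → fromℚ (p ÷₀ q) ≈ fromℚ p * u
  fromℚ-÷₀ p q {u} uq≈1 = begin
    fromℚ (p ÷₀ q)                  ≈⟨ *-identityʳ _ ⟨
    fromℚ (p ÷₀ q) * 1#             ≈⟨ *-congˡ uq≈1 ⟨
    fromℚ (p ÷₀ q) * (u * fromℚ q)  ≈⟨ solve 3 (λ a b c → a :* (b :* c) := a :* c :* b) refl (fromℚ (p ÷₀ q)) u (fromℚ q) ⟩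
    fromℚ (p ÷₀ q) * fromℚ q * u    ≈⟨ *-congʳ (fromℚ-* (p ÷₀ q) q) ⟨
    fromℚ ((p ÷₀ q) ℚ.* q) * u      ≡⟨ cong (λ z → fromℚ z * u) (÷₀-cancel p q q≢0) ⟩
    fromℚ p * u                     ∎
    where
    q≢0 : q ≢ 0ℚ
    q≢0 ≡.refl = 1≉0 (begin
      1#                  ≈⟨ uq≈1 ⟨
      u * (0# * 1/ℕ 1)    ≈⟨ *-congˡ (zeroˡ _) ⟩
      u * 0#              ≈⟨ zeroʳ u ⟩
      0#                  ∎)

  fromℕ-∸ : ∀ {m n} → n ≤ m → fromℕ (m ∸ n) ≈ fromℕ m - fromℕ n
  fromℕ-∸ {m} {n} n≤m = begin
    fromℕ (m ∸ n)                      ≈⟨ solve 2 (λ x y → x := x :+ y :- y) refl (fromℕ (m ∸ n)) (fromℕ n) ⟩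
    fromℕ (m ∸ n) + fromℕ n - fromℕ n  ≈⟨ +-congʳ (fromℕ-+ (m ∸ n) n) ⟨
    fromℕ (m ∸ n ℕ.+ n) - fromℕ n      ≡⟨ cong (λ x → fromℕ x - fromℕ n) (ℕ.m∸n+n≡m n≤m) ⟩
    fromℕ m - fromℕ n                  ∎

  -- The reciprocal of ν as ∏ cᵢ/(cᵢ+⋯+c_s). The last factor c_s/c_s is 1 for positive entries;
  -- including it spares the recursion a case for one-element lists.
  invν : List ℕ → Carrier
  invν []       = 1#
  invν (a ∷ as) = fromℕ a * 1/ℕ (sum (a ∷ as)) * invν as

  invν-sum : ∀ {a as} → Positive (a ∷ as) →
             invν (a ∷ as) * fromℕ (sum (a ∷ as)) ≈ fromℕ a * invν as
  invν-sum {a} {as} pos = begin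
    fromℕ a * 1/ℕ S * invν as * fromℕ S
      ≈⟨ solve 4 (λ a r i s → a :* r :* i :* s := a :* i :* (r :* s)) refl (fromℕ a) (1/ℕ S) (invν as) (fromℕ S) ⟩
    fromℕ a * invν as * (1/ℕ S * fromℕ S)
      ≈⟨ *-congˡ (1/ℕ-inverse′ (positive-head pos (sum as))) ⟩
    fromℕ a * invν as * 1#
      ≈⟨ *-identityʳ _ ⟩
    fromℕ a * invν as ∎
    where S = sum (a ∷ as)

  -- f̂ as k h is f_{k,k-h}(0,as), and σ as (k ∸ h) is ξ_{k-h}.
  f̂ : List ℕ → ℕ → ℕ → Carrier
  f̂ as k h =
    ∏[ i ∈ upTo h ] (fromℕ (sum as ∸ σ as (k ∸ i)) * 1/ℕ (σ as (k ∸ i) ∸ σ as (k ∸ h)))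
      * (invν (take (k ∸ h) as) * invν (drop (k ∸ h) as))

  -- Differences of partial sums do not notice a new first entry. Only the `invν` of the left part
  -- changes, by the factor a over the shifted node.
  f̂-∷ : ∀ {a as k h} → Positive (a ∷ as) → h ≤ k →
        f̂ (a ∷ as) (suc k) h ≈ fromℕ a * 1/ℕ (a ℕ.+ σ as (k ∸ h)) * f̂ as k h
  f̂-∷ {a} {as} {k} {h} pos h≤k rewrite ℕ.+-∸-assoc 1 h≤k = begin
    _ * (fromℕ a * 1/ℕ (a ℕ.+ σ as (k ∸ h)) * invν (take (k ∸ h) as) * invν (drop (k ∸ h) as))
      ≈⟨ *-congʳ (∏-upTo-cong h (λ i i<h → reflexive (shift i (ℕ.<⇒≤ (ℕ.≤-trans i<h h≤k))))) ⟩
    P * (fromℕ a * 1/ℕ (a ℕ.+ σ as (k ∸ h)) * invν (take (k ∸ h) as) * invν (drop (k ∸ h) as))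
      ≈⟨ solve 5 (λ p a b c d → p :* (a :* b :* c :* d) := a :* b :* (p :* (c :* d))) refl
           P (fromℕ a) (1/ℕ (a ℕ.+ σ as (k ∸ h))) (invν (take (k ∸ h) as)) (invν (drop (k ∸ h) as)) ⟩
    fromℕ a * 1/ℕ (a ℕ.+ σ as (k ∸ h)) * f̂ as k h ∎
    where
    P = ∏[ i ∈ upTo h ] (fromℕ (sum as ∸ σ as (k ∸ i)) * 1/ℕ (σ as (k ∸ i) ∸ σ as (k ∸ h)))
    shift : ∀ i → i ≤ k →
      fromℕ (sum (a ∷ as) ∸ σ (a ∷ as) (suc k ∸ i)) * 1/ℕ (σ (a ∷ as) (suc k ∸ i) ∸ (a ℕ.+ σ as (k ∸ h)))
      ≡ fromℕ (sum as ∸ σ as (k ∸ i)) * 1/ℕ (σ as (k ∸ i) ∸ σ as (k ∸ h))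
    shift i i≤k rewrite ℕ.+-∸-assoc 1 i≤k = cong₂ (λ m n → fromℕ m * 1/ℕ n)
      (ℕ.[m+n]∸[m+o]≡n∸o a _ _) (ℕ.[m+n]∸[m+o]≡n∸o a _ _)

  -- Divided differences at the partial sums

  Q : List ℕ → ℕ → ℕ → Carrier
  Q as k v = ∏[ i ∈ upTo (suc k) ] ((fromℕ (sum as) - fromℕ (σ as i)) * 1/ℕ (σ as i ℕ.+ v))

  sum-∷-σ : ∀ a as s → fromℕ (sum (a ∷ as)) - fromℕ (a ℕ.+ s) ≈ fromℕ (sum as) - fromℕ s
  sum-∷-σ a as s = begin
    fromℕ (sum (a ∷ as)) - fromℕ (a ℕ.+ s)
      ≈⟨ +-cong (fromℕ-+ a _) (-‿cong (fromℕ-+ a s)) ⟩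
    fromℕ a + fromℕ (sum as) - (fromℕ a + fromℕ s)
      ≈⟨ solve 3 (λ a n s → a :+ n :- (a :+ s) := n :- s) refl (fromℕ a) (fromℕ (sum as)) (fromℕ s) ⟩
    fromℕ (sum as) - fromℕ s ∎

  Q-∷ : ∀ a as k v → Q (a ∷ as) (suc k) v ≈
        (fromℕ (sum (a ∷ as)) - fromℕ 0) * 1/ℕ v * Q as k (a ℕ.+ v)
  Q-∷ a as k v = begin
    Q (a ∷ as) (suc k) v
      ≡⟨ ∏-upTo-suc (suc k) _ ⟩
    (fromℕ N - fromℕ 0) * 1/ℕ v * ∏[ i ∈ upTo (suc k) ] ((fromℕ N - fromℕ (a ℕ.+ σ as i)) * 1/ℕ (a ℕ.+ σ as i ℕ.+ v))
      ≈⟨ *-congˡ (∏-cong (upTo (suc k)) (λ i → *-cong (sum-∷-σ a as (σ as i)) (reflexive (cong 1/ℕ (move (σ as i)))))) ⟩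
    (fromℕ N - fromℕ 0) * 1/ℕ v * Q as k (a ℕ.+ v) ∎
    where
    N = sum (a ∷ as)
    move : ∀ s → a ℕ.+ s ℕ.+ v ≡ s ℕ.+ (a ℕ.+ v)
    move s = ≡.trans (cong (ℕ._+ v) (ℕ.+-comm a s)) (ℕ.+-assoc s a v)

  -- This is the coefficient of the node 0, whose distance to the i-th moved node is a + σᵢ itself;
  -- hence `Q` with v = a.
  f̂-last : ∀ a as k → f̂ (a ∷ as) (suc k) (suc k) ≈ Q as k a * invν (a ∷ as)
  f̂-last a as k rewrite ℕ.n∸n≡0 k = *-cong product≈Q (*-identityˡ _)
    where
    g : ℕ → Carrier
    g l = fromℕ (sum (a ∷ as) ∸ σ (a ∷ as) (suc l)) * 1/ℕ (σ (a ∷ as) (suc l) ∸ 0)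
    product≈Q : ∏[ i ∈ upTo (suc k) ] (fromℕ (sum (a ∷ as) ∸ σ (a ∷ as) (suc k ∸ i)) * 1/ℕ (σ (a ∷ as) (suc k ∸ i) ∸ 0))
              ≈ Q as k a
    product≈Q = begin
      _                                      ≈⟨ ∏-upTo-cong (suc k) (λ i i<1+k → reflexive
                                                  (cong (λ j → fromℕ (sum (a ∷ as) ∸ σ (a ∷ as) j) * 1/ℕ (σ (a ∷ as) j ∸ 0))
                                                    (ℕ.+-∸-assoc 1 (ℕ.≤-pred i<1+k)))) ⟩
      -- The product in `f̂` runs downwards from the largest node, the one in `Q` upwards.
      ∏[ i ∈ upTo (suc k) ] g (k ∸ i)        ≈⟨ ∏-upTo-reverse k g ⟩
      ∏[ i ∈ upTo (suc k) ] g i              ≈⟨ ∏-cong (upTo (suc k)) (λ i → *-cong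
                                                  (trans (fromℕ-∸ (ℕ.+-monoʳ-≤ a (σ≤sum as i))) (sum-∷-σ a as (σ as i)))
                                                  (reflexive (cong 1/ℕ (ℕ.+-comm a (σ as i))))) ⟩
      Q as k a                               ∎

  -- Up to normalisation, Λ as k g is the divided difference of s ↦ g s / (N − s) at
  -- the nodes σ as 0 < ⋯ < σ as k, where N = sum as; it is opaque so that unification
  -- can recover g from Λ as k g.
  opaque
    Λ : List ℕ → ℕ → (ℕ → Carrier) → Carrier
    Λ as k g = ∑[ h ∈ upTo (suc k) ] ((- 1#) ^ h * f̂ as k h * g (σ as (k ∸ h)))

    Λ-cong : ∀ as k {g g′} → (∀ s → g s ≈ g′ s) → Λ as k g ≈ Λ as k g′
    Λ-cong as k e = ∑-cong (upTo (suc k)) (λ h → *-congˡ (e _))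

    Λ-linear : ∀ as k g g′ z z′ → Λ as k (λ s → z * g s + z′ * g′ s) ≈ z * Λ as k g + z′ * Λ as k g′
    Λ-linear as k g g′ z z′ = begin
      Λ as k (λ s → z * g s + z′ * g′ s)
        ≈⟨ ∑-cong (upTo (suc k)) (λ h → solve 5 (λ c z w p q → c :* (z :* p :+ w :* q) := z :* (c :* p) :+ w :* (c :* q)) refl
             ((- 1#) ^ h * f̂ as k h) z z′ (g (σ as (k ∸ h))) (g′ (σ as (k ∸ h)))) ⟩
      _ ≈⟨ ∑-+ (upTo (suc k)) _ _ ⟩
      _ ≈⟨ +-cong (∑-*ˡ (upTo (suc k)) z _) (∑-*ˡ (upTo (suc k)) z′ _) ⟩
      z * Λ as k g + z′ * Λ as k g′ ∎

    Λ-0 : ∀ as g → Λ as 0 g ≈ invν as * g 0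
    Λ-0 as g = solve 2 (λ i g → con (+ 1) :* (con (+ 1) :* (con (+ 1) :* i)) :* g :+ con (+ 0) := i :* g) refl (invν as) (g 0)

    -- A new first entry moves all nodes by a and creates the node 0. The moved nodes keep their
    -- coefficients up to the factor a/(a+s); the node 0 is the last summand, h = k+1.
    Λ-∷ : ∀ {a as} → Positive (a ∷ as) → ∀ k g →
          Λ (a ∷ as) (suc k) g ≈
            fromℕ a * Λ as k (λ s → 1/ℕ (a ℕ.+ s) * g (a ℕ.+ s)) + (- 1#) ^ suc k * (Q as k a * invν (a ∷ as)) * g 0
    Λ-∷ {a} {as} pos k g = begin
      Λ (a ∷ as) (suc k) g
        ≈⟨ ∑-upTo-last (suc k) _ ⟩
      ∑[ h ∈ upTo (suc k) ] ((- 1#) ^ h * f̂ (a ∷ as) (suc k) h * g (σ (a ∷ as) (suc k ∸ h)))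
        + (- 1#) ^ suc k * f̂ (a ∷ as) (suc k) (suc k) * g (σ (a ∷ as) (suc k ∸ suc k))
        ≈⟨ +-cong (trans (∑-upTo-cong (suc k) (λ h h<1+k → step h (ℕ.≤-pred h<1+k))) (∑-*ˡ (upTo (suc k)) (fromℕ a) _))
             (*-cong (*-congˡ (f̂-last a as k)) (reflexive (cong (λ j → g (σ (a ∷ as) j)) (ℕ.n∸n≡0 k)))) ⟩
      fromℕ a * Λ as k (λ s → 1/ℕ (a ℕ.+ s) * g (a ℕ.+ s)) + (- 1#) ^ suc k * (Q as k a * invν (a ∷ as)) * g 0 ∎
      where
      step : ∀ h → h ≤ k → (- 1#) ^ h * f̂ (a ∷ as) (suc k) h * g (σ (a ∷ as) (suc k ∸ h)) ≈
             fromℕ a * ((- 1#) ^ h * f̂ as k h * (1/ℕ (a ℕ.+ σ as (k ∸ h)) * g (a ℕ.+ σ as (k ∸ h))))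
      step h h≤k = begin
        (- 1#) ^ h * f̂ (a ∷ as) (suc k) h * g (σ (a ∷ as) (suc k ∸ h))
          ≈⟨ *-cong (*-congˡ (f̂-∷ pos h≤k)) (reflexive (cong (λ j → g (σ (a ∷ as) j)) (ℕ.+-∸-assoc 1 h≤k))) ⟩
        (- 1#) ^ h * (fromℕ a * ρ * f̂ as k h) * g s
          ≈⟨ solve 5 (λ m a ρ f g → m :* (a :* ρ :* f) :* g := a :* (m :* f :* (ρ :* g))) refl ((- 1#) ^ h) (fromℕ a) ρ (f̂ as k h) (g s) ⟩
        fromℕ a * ((- 1#) ^ h * f̂ as k h * (ρ * g s)) ∎
        where
        s : ℕ
        s = a ℕ.+ σ as (k ∸ h)
        ρ : Carrier
        ρ = 1/ℕ s

  -- The factor s kills the node 0 and cancels 1/(a+s) at all others. In this form a bit 1 removes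
  -- the first block.
  Λ-shift : ∀ {a as} → Positive (a ∷ as) → ∀ k (g : ℕ → Carrier) →
            Λ (a ∷ as) (suc k) (λ s → fromℕ s * g s) ≈ fromℕ a * Λ as k (λ s → g (a ℕ.+ s))
  Λ-shift {a} {as} pos k g = begin
    Λ (a ∷ as) (suc k) (λ s → fromℕ s * g s)
      ≈⟨ Λ-∷ pos k (λ s → fromℕ s * g s) ⟩
    fromℕ a * Λ as k (λ s → 1/ℕ (a ℕ.+ s) * (fromℕ (a ℕ.+ s) * g (a ℕ.+ s))) + e * (0# * g 0)
      ≈⟨ +-cong (*-congˡ (Λ-cong as k cancel)) (trans (*-congˡ (zeroˡ (g 0))) (zeroʳ e)) ⟩
    fromℕ a * Λ as k (λ s → g (a ℕ.+ s)) + 0#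
      ≈⟨ +-identityʳ _ ⟩
    fromℕ a * Λ as k (λ s → g (a ℕ.+ s)) ∎
    where
    e = (- 1#) ^ suc k * (Q as k a * invν (a ∷ as))
    cancel : ∀ s → 1/ℕ (a ℕ.+ s) * (fromℕ (a ℕ.+ s) * g (a ℕ.+ s)) ≈ g (a ℕ.+ s)
    cancel s = trans (sym (*-assoc _ _ _)) (trans (*-congʳ (1/ℕ-inverse′ (positive-head pos s))) (*-identityˡ _))

  -- The factor N - s compensates the 1/(N - s) inside the coefficients, leaving the divided
  -- difference of 1/(s+v), which is (-1)^k ∏ 1/(σᵢ+v). The induction rests on 1/((a+s)(a+s+v)) =
  -- (1/v)(1/(a+s) - 1/(a+s+v)); it calls the hypothesis at a and at a+v, so v stays general.
  Λ-partialFractions : ∀ {as} → Positive as → ∀ {k} → k ≤ length as → ∀ {v} → 1 ≤ v →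
    Λ as k (λ s → (fromℕ (sum as) - fromℕ s) * 1/ℕ (s ℕ.+ v)) ≈ (- 1#) ^ k * (invν as * Q as k v)
  Λ-partialFractions {as} pos {zero} _ {v} _ = trans (Λ-0 as _)
    (solve 2 (λ i g → i :* g := con (+ 1) :* (i :* (g :* con (+ 1)))) refl (invν as) _)
  Λ-partialFractions {a ∷ as} pos@(_ ∷ pos′) {suc k} (s≤s k≤) {v} 1≤v = begin
    Λ (a ∷ as) (suc k) (λ s → (fromℕ N - fromℕ s) * 1/ℕ (s ℕ.+ v))
      ≈⟨ Λ-∷ pos k _ ⟩
    fromℕ a * Λ as k (λ s → 1/ℕ (a ℕ.+ s) * ((fromℕ N - fromℕ (a ℕ.+ s)) * 1/ℕ (a ℕ.+ s ℕ.+ v)))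
      + - 1# * e * (q * t) * ((fromℕ N - fromℕ 0) * 1/ℕ v)
      ≈⟨ +-congʳ (*-congˡ (trans (Λ-cong as k split) (Λ-linear as k _ _ (1/ℕ v) (- 1/ℕ v)))) ⟩
    fromℕ a * (1/ℕ v * Λ as k (term a) + - 1/ℕ v * Λ as k (term (a ℕ.+ v)))
      + - 1# * e * (q * t) * ((fromℕ N - fromℕ 0) * 1/ℕ v)
      ≈⟨ +-congʳ (*-congˡ (+-cong (*-congˡ (Λ-partialFractions pos′ k≤ (positive-head₀ pos)))
           (*-congˡ (Λ-partialFractions pos′ k≤ (ℕ.m≤n⇒m≤o+n a 1≤v))))) ⟩
    fromℕ a * (1/ℕ v * (e * (invν as * q)) + - 1/ℕ v * (e * (invν as * q′)))
      + - 1# * e * (q * t) * ((fromℕ N - fromℕ 0) * 1/ℕ v)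
      ≈⟨ solve 8 (λ a r e i q q′ t n →
           a :* (r :* (e :* (i :* q)) :+ :- r :* (e :* (i :* q′))) :+ con -[1+ 0 ] :* e :* (q :* t) :* ((n :- con (+ 0)) :* r)
           := (a :* i) :* (r :* e :* (q :- q′)) :- (t :* n) :* (r :* e :* q)) refl
           (fromℕ a) (1/ℕ v) e (invν as) q q′ t (fromℕ N) ⟩
    (fromℕ a * invν as) * (1/ℕ v * e * (q - q′)) - (t * fromℕ N) * (1/ℕ v * e * q)
      -- Both terms now share the factor t N, so the contributions of q cancel and only q′ remains.
      ≈⟨ +-congʳ (*-congʳ (invν-sum pos)) ⟨
    (t * fromℕ N) * (1/ℕ v * e * (q - q′)) - (t * fromℕ N) * (1/ℕ v * e * q)
      ≈⟨ solve 6 (λ r e q q′ t n →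
           (t :* n) :* (r :* e :* (q :- q′)) :- (t :* n) :* (r :* e :* q)
           := con -[1+ 0 ] :* e :* (t :* ((n :- con (+ 0)) :* r :* q′))) refl
           (1/ℕ v) e q q′ t (fromℕ N) ⟩
    - 1# * e * (t * ((fromℕ N - fromℕ 0) * 1/ℕ v * q′))
      ≈⟨ *-congˡ (*-congˡ (Q-∷ a as k v)) ⟨
    (- 1#) ^ suc k * (t * Q (a ∷ as) (suc k) v) ∎
    where
    N = sum (a ∷ as)
    t = invν (a ∷ as)
    e = (- 1#) ^ k
    q = Q as k a
    q′ = Q as k (a ℕ.+ v)
    term : ℕ → ℕ → Carrier
    term w s = (fromℕ (sum as) - fromℕ s) * 1/ℕ (s ℕ.+ w)
    positive-head₀ : ∀ {b bs} → Positive (b ∷ bs) → 1 ≤ b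
    positive-head₀ (p ∷ _) = p
    split : ∀ s → 1/ℕ (a ℕ.+ s) * ((fromℕ N - fromℕ (a ℕ.+ s)) * 1/ℕ (a ℕ.+ s ℕ.+ v)) ≈
            1/ℕ v * term a s + - 1/ℕ v * term (a ℕ.+ v) s
    split s = begin
      1/ℕ p * ((fromℕ N - fromℕ p) * 1/ℕ (p ℕ.+ v))
        ≈⟨ *-congˡ (*-congʳ (sum-∷-σ a as s)) ⟩
      1/ℕ p * (d * 1/ℕ (p ℕ.+ v))
        ≈⟨ solve 3 (λ d x y → x :* (d :* y) := d :* (x :* y)) refl d (1/ℕ p) (1/ℕ (p ℕ.+ v)) ⟩
      d * (1/ℕ p * 1/ℕ (p ℕ.+ v))
        ≈⟨ *-congˡ (1/ℕ-1/ℕ p v (positive-head pos s) 1≤v) ⟩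
      d * (1/ℕ v * (1/ℕ p - 1/ℕ (p ℕ.+ v)))
        ≈⟨ solve 4 (λ d v x y → d :* (v :* (x :- y)) := v :* (d :* x) :+ :- v :* (d :* y)) refl d (1/ℕ v) (1/ℕ p) (1/ℕ (p ℕ.+ v)) ⟩
      1/ℕ v * (d * 1/ℕ p) + - 1/ℕ v * (d * 1/ℕ (p ℕ.+ v))
        ≡⟨ cong₂ (λ x y → 1/ℕ v * (d * 1/ℕ x) + - 1/ℕ v * (d * 1/ℕ y)) (ℕ.+-comm a s)
             (≡.trans (cong (ℕ._+ v) (ℕ.+-comm a s)) (ℕ.+-assoc s a v)) ⟩
      1/ℕ v * term a s + - 1/ℕ v * term (a ℕ.+ v) s ∎
      where
      p = a ℕ.+ s
      d = fromℕ (sum as) - fromℕ s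
      1/ℕ-1/ℕ : ∀ p v → 1 ≤ p → 1 ≤ v → 1/ℕ p * 1/ℕ (p ℕ.+ v) ≈ 1/ℕ v * (1/ℕ p - 1/ℕ (p ℕ.+ v))
      1/ℕ-1/ℕ p v 1≤p 1≤v = begin
        x * z
          ≈⟨ solve 3 (λ x y z → x :* z := con (+ 1) :* (x :* z)) refl x y z ⟩
        1# * (x * z)
          ≈⟨ *-congʳ (1/ℕ-inverse′ 1≤v) ⟨
        y * fromℕ v * (x * z)
          ≈⟨ solve 5 (λ x y z p v → y :* v :* (x :* z) := y :* (x :* (z :* (p :+ v)) :- z :* (x :* p))) refl x y z (fromℕ p) (fromℕ v) ⟩
        y * (x * (z * (fromℕ p + fromℕ v)) - z * (x * fromℕ p))
          ≈⟨ *-congˡ (+-cong (*-congˡ (*-congˡ (sym (fromℕ-+ p v)))) (-‿cong (*-congˡ (1/ℕ-inverse′ 1≤p)))) ⟩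
        y * (x * (z * fromℕ (p ℕ.+ v)) - z * 1#)
          ≈⟨ *-congˡ (+-congʳ (*-congˡ (1/ℕ-inverse′ (ℕ.m≤n⇒m≤n+o v 1≤p)))) ⟩
        y * (x * 1# - z * 1#)
          ≈⟨ *-congˡ (+-cong (*-identityʳ x) (-‿cong (*-identityʳ z))) ⟩
        y * (x - z) ∎
        where
        x = 1/ℕ p
        y = 1/ℕ v
        z = 1/ℕ (p ℕ.+ v)

  -- With N′ = N - a one has 1/(a+s) = (1/N)(1 + (N′ - s)/(s+a)). The moved nodes thus yield the
  -- same claim for `as` and a partial fraction with v = a, and the latter cancels the contribution
  -- of the node 0.
  Λ-1 : ∀ {as} → Positive as → ∀ {k} → k ≤ length as → Λ as k (λ _ → 1#) ≈ invν as
  Λ-1 {as} pos {zero} _ = trans (Λ-0 as _) (*-identityʳ _)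
  Λ-1 {a ∷ as} pos@(1≤a ∷ pos′) {suc k} (s≤s k≤) = begin
    Λ (a ∷ as) (suc k) (λ _ → 1#)
      ≈⟨ Λ-∷ pos k _ ⟩
    fromℕ a * Λ as k (λ s → 1/ℕ (a ℕ.+ s) * 1#) + - 1# * e * (q * t) * 1#
      ≈⟨ +-congʳ (*-congˡ (trans (Λ-cong as k split) (Λ-linear as k _ _ ρ ρ))) ⟩
    fromℕ a * (ρ * Λ as k (λ _ → 1#) + ρ * Λ as k _) + - 1# * e * (q * t) * 1#
      ≈⟨ +-congʳ (*-congˡ (+-cong (*-congˡ (Λ-1 pos′ k≤)) (*-congˡ (Λ-partialFractions pos′ k≤ 1≤a)))) ⟩
    fromℕ a * (ρ * invν as + ρ * (e * (invν as * q))) + - 1# * e * (q * (fromℕ a * ρ * invν as)) * 1#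
      ≈⟨ solve 5 (λ a ρ i e q → a :* (ρ :* i :+ ρ :* (e :* (i :* q))) :+ con -[1+ 0 ] :* e :* (q :* (a :* ρ :* i)) :* con (+ 1) := a :* ρ :* i)
           refl (fromℕ a) ρ (invν as) e q ⟩
    invν (a ∷ as) ∎
    where
    N = sum (a ∷ as)
    ρ = 1/ℕ N
    t = invν (a ∷ as)
    e = (- 1#) ^ k
    q = Q as k a
    split : ∀ s → 1/ℕ (a ℕ.+ s) * 1# ≈
            ρ * 1# + ρ * ((fromℕ (sum as) - fromℕ s) * 1/ℕ (s ℕ.+ a))
    split s rewrite ℕ.+-comm s a = fromℕ-cancelʳ (positive-head pos (sum as)) (begin
      x * 1# * fromℕ N
        ≈⟨ solve 2 (λ x n → x :* con (+ 1) :* n := con (+ 1) :* (x :* n)) refl x (fromℕ N) ⟩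
      1# * (x * fromℕ N)
        ≈⟨ *-congʳ (1/ℕ-inverse′ (positive-head pos (sum as))) ⟨
      ρ * fromℕ N * (x * fromℕ N)
        ≈⟨ solve 4 (λ ρ n x p → ρ :* n :* (x :* n) := ρ :* n :* (x :* p :+ (n :- p) :* x)) refl ρ (fromℕ N) x (fromℕ (a ℕ.+ s)) ⟩
      ρ * fromℕ N * (x * fromℕ (a ℕ.+ s) + (fromℕ N - fromℕ (a ℕ.+ s)) * x)
        ≈⟨ *-congˡ (+-cong (1/ℕ-inverse′ (positive-head pos s)) (*-congʳ (sum-∷-σ a as s))) ⟩
      ρ * fromℕ N * (1# + d * x)
        ≈⟨ solve 4 (λ ρ n d x → ρ :* n :* (con (+ 1) :+ d :* x) := (ρ :* con (+ 1) :+ ρ :* (d :* x)) :* n) refl ρ (fromℕ N) d x ⟩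
      (ρ * 1# + ρ * (d * x)) * fromℕ N ∎)
      where
      x = 1/ℕ (a ℕ.+ s)
      d = fromℕ (sum as) - fromℕ s

  -- Comparison with the rational coefficients `f` and `f₂`

  fromℚ-1 : fromℚ 1ℚ ≈ 1#
  fromℚ-1 = trans (fromℚ-ℕ→ℚ 1) fromℕ-1

  Πℕ-positive : ∀ k h → (∀ i → i < k → 1 ≤ h i) → 1 ≤ prodℕ (upTo k) h
  Πℕ-positive zero    h pos = ℕ.≤-refl
  Πℕ-positive (suc k) h pos rewrite cong product (map-upTo-suc h k) =
    ℕ.*-mono-≤ (pos 0 z<s) (Πℕ-positive k (h ∘ suc) (λ i i<k → pos (suc i) (s<s i<k)))

  ∏-fraction : ∀ k g h → (∀ i → i < k → 1 ≤ h i) →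
    fromℕ (prodℕ (upTo k) g) * 1/ℕ (prodℕ (upTo k) h) ≈ ∏[ i ∈ upTo k ] (fromℕ (g i) * 1/ℕ (h i))
  ∏-fraction zero    g h pos = trans (*-cong fromℕ-1 1/ℕ-1) (*-identityˡ 1#)
  ∏-fraction (suc k) g h pos = begin
    fromℕ (prodℕ (upTo (suc k)) g) * 1/ℕ (prodℕ (upTo (suc k)) h)
      ≡⟨ cong₂ (λ x y → fromℕ (product x) * 1/ℕ (product y)) (map-upTo-suc g k) (map-upTo-suc h k) ⟩
    fromℕ (g 0 ℕ.* G) * 1/ℕ (h 0 ℕ.* H)
      ≈⟨ *-cong (fromℕ-* (g 0) G) (1/ℕ-* (pos 0 z<s) (Πℕ-positive k (h ∘ suc) (λ i i<k → pos (suc i) (s<s i<k)))) ⟩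
    fromℕ (g 0) * fromℕ G * (1/ℕ (h 0) * 1/ℕ H)
      ≈⟨ solve 4 (λ a b c d → a :* b :* (c :* d) := a :* c :* (b :* d)) refl (fromℕ (g 0)) (fromℕ G) (1/ℕ (h 0)) (1/ℕ H) ⟩
    fromℕ (g 0) * 1/ℕ (h 0) * (fromℕ G * 1/ℕ H)
      ≈⟨ *-congˡ (∏-fraction k (g ∘ suc) (h ∘ suc) (λ i i<k → pos (suc i) (s<s i<k))) ⟩
    fromℕ (g 0) * 1/ℕ (h 0) * ∏[ i ∈ upTo k ] (fromℕ (g (suc i)) * 1/ℕ (h (suc i)))
      ≡⟨ ∏-upTo-suc k _ ⟨
    ∏[ i ∈ upTo (suc k) ] (fromℕ (g i) * 1/ℕ (h i)) ∎
    where
    G = prodℕ (upTo k) (g ∘ suc)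
    H = prodℕ (upTo k) (h ∘ suc)

  fromℚ-ratio : ∀ m {n} → 1 ≤ n → fromℚ (ℕ→ℚ m ÷₀ ℕ→ℚ n) ≈ fromℕ m * 1/ℕ n
  fromℚ-ratio m {n} 1≤n = trans
    (fromℚ-÷₀ (ℕ→ℚ m) (ℕ→ℚ n) (trans (*-congˡ (fromℚ-ℕ→ℚ n)) (1/ℕ-inverse′ 1≤n)))
    (*-congʳ (fromℚ-ℕ→ℚ m))

  ν-denominator-positive : ∀ {cs} → Positive cs → 1 ≤ ν-denominator cs
  ν-denominator-positive []            = ℕ.≤-refl
  ν-denominator-positive (_ ∷ [])      = ℕ.≤-refl
  ν-denominator-positive (p ∷ p′ ∷ ps) = ℕ.*-mono-≤ p (ν-denominator-positive (p′ ∷ ps))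

  invν-ν-numerator : ∀ {cs} → Positive cs → invν cs * fromℕ (ν-numerator cs) ≈ fromℕ (ν-denominator cs)
  invν-ν-numerator []       = *-identityˡ _
  invν-ν-numerator {c ∷ []} pos = begin
    invν (c ∷ []) * fromℕ 1          ≈⟨ *-congʳ (begin
      fromℕ c * 1/ℕ (c ℕ.+ 0) * 1#     ≈⟨ *-identityʳ _ ⟩
      fromℕ c * 1/ℕ (c ℕ.+ 0)          ≈⟨ *-comm _ _ ⟩
      1/ℕ (c ℕ.+ 0) * fromℕ c          ≡⟨ cong (λ z → 1/ℕ (c ℕ.+ 0) * fromℕ z) (ℕ.+-identityʳ c) ⟨
      1/ℕ (c ℕ.+ 0) * fromℕ (c ℕ.+ 0)  ≈⟨ 1/ℕ-inverse′ (positive-head pos 0) ⟩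
      1#                               ∎) ⟩
    1# * fromℕ 1                     ≈⟨ *-identityˡ _ ⟩
    fromℕ 1                          ∎
  invν-ν-numerator {c ∷ cs@(d ∷ _)} (p ∷ ps) = begin
    invν (c ∷ cs) * fromℕ (S ℕ.* ν-numerator cs)         ≈⟨ *-congˡ (fromℕ-* S (ν-numerator cs)) ⟩
    invν (c ∷ cs) * (fromℕ S * fromℕ (ν-numerator cs))   ≈⟨ *-assoc _ _ _ ⟨
    invν (c ∷ cs) * fromℕ S * fromℕ (ν-numerator cs)     ≈⟨ *-congʳ (invν-sum (p ∷ ps)) ⟩
    fromℕ c * invν cs * fromℕ (ν-numerator cs)           ≈⟨ *-assoc _ _ _ ⟩
    fromℕ c * (invν cs * fromℕ (ν-numerator cs))         ≈⟨ *-congˡ (invν-ν-numerator ps) ⟩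
    fromℕ c * fromℕ (ν-denominator cs)                   ≈⟨ fromℕ-* c (ν-denominator cs) ⟨
    fromℕ (c ℕ.* ν-denominator cs)                       ∎
    where S = sum (c ∷ cs)

  invν-inverse : ∀ {cs} → Positive cs → invν cs * fromℚ (ν cs) ≈ 1#
  invν-inverse {cs} ps = begin
    invν cs * fromℚ (ν cs)                                           ≈⟨ *-congˡ (fromℚ-ratio (ν-numerator cs) 1≤d) ⟩
    invν cs * (fromℕ (ν-numerator cs) * 1/ℕ (ν-denominator cs))      ≈⟨ *-assoc _ _ _ ⟨
    invν cs * fromℕ (ν-numerator cs) * 1/ℕ (ν-denominator cs)        ≈⟨ *-congʳ (invν-ν-numerator ps) ⟩
    fromℕ (ν-denominator cs) * 1/ℕ (ν-denominator cs)                ≈⟨ *-comm _ _ ⟩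
    1/ℕ (ν-denominator cs) * fromℕ (ν-denominator cs)                ≈⟨ 1/ℕ-inverse′ 1≤d ⟩
    1#                                                               ∎
    where 1≤d = ν-denominator-positive ps

  fromℚ-1÷νν : ∀ {cs ds} → Positive cs → Positive ds → fromℚ (1ℚ ÷₀ (ν cs ℚ.* ν ds)) ≈ invν cs * invν ds
  fromℚ-1÷νν {cs} {ds} ps qs = trans (fromℚ-÷₀ 1ℚ (ν cs ℚ.* ν ds) (begin
    invν cs * invν ds * fromℚ (ν cs ℚ.* ν ds)
      ≈⟨ *-congˡ (fromℚ-* (ν cs) (ν ds)) ⟩
    invν cs * invν ds * (fromℚ (ν cs) * fromℚ (ν ds))
      ≈⟨ solve 4 (λ a b c d → a :* b :* (c :* d) := a :* c :* (b :* d)) refl (invν cs) (invν ds) (fromℚ (ν cs)) (fromℚ (ν ds)) ⟩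
    invν cs * fromℚ (ν cs) * (invν ds * fromℚ (ν ds))
      ≈⟨ *-cong (invν-inverse ps) (invν-inverse qs) ⟩
    1# * 1#
      ≈⟨ *-identityˡ 1# ⟩
    1# ∎)) (trans (*-congʳ fromℚ-1) (*-identityˡ _))

  module _ (a : Composition n r) (pos : Positive (toList (rest a))) where
    private
      as : List ℕ
      as = toList (rest a)

      len : length as ≡ r
      len = length-toList (rest a)

    fromℚ-f : ∀ k → fromℚ (f a k) ≈ invν (take k as) * invν (drop k as)
    fromℚ-f k = fromℚ-1÷νν (All.take⁺ k pos) (All.drop⁺ k pos)

    fromℚ-f-last : fromℚ (f a r) ≈ invν as
    fromℚ-f-last = begin
      fromℚ (f a r)                       ≈⟨ fromℚ-f r ⟩
      invν (take r as) * invν (drop r as) ≡⟨ cong₂ (λ x y → invν x * invν y) (take-all r as (ℕ.≤-reflexive len)) (drop-all r as (ℕ.≤-reflexive len)) ⟩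
      invν as * 1#                        ≈⟨ *-identityʳ _ ⟩
      invν as                             ∎

    -- Interval sums are differences of partial sums as long as the endpoints are in order, which k
    -- < r ensures. `_⟨_∶_⟩` sorts its endpoints, so at k = r the first numerator would be a_r
    -- instead of the difference 0.
    fromℚ-mᵃ : ∀ {k h} → h ≤ k → k < r → fromℚ (mᵃ a k h) ≈
      ∏[ i ∈ upTo h ] (fromℕ (sum as ∸ σ as (k ∸ i)) * 1/ℕ (σ as (k ∸ i) ∸ σ as (k ∸ h)))
    fromℚ-mᵃ {k} {h} h≤k k<r = begin
      fromℚ (mᵃ a k h)
        ≈⟨ fromℚ-ratio (prodℕ (upTo h) G) (Πℕ-positive h H H-positive) ⟩
      fromℕ (prodℕ (upTo h) G) * 1/ℕ (prodℕ (upTo h) H)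
        ≈⟨ ∏-fraction h G H H-positive ⟩
      ∏[ i ∈ upTo h ] (fromℕ (G i) * 1/ℕ (H i))
        ≈⟨ ∏-upTo-cong h (λ i i<h → reflexive (cong₂ (λ x y → fromℕ x * 1/ℕ y) (G-σ i (ℕ.<⇒≤ (ℕ.<-≤-trans i<h h≤k))) (H-σ i i<h))) ⟩
      _ ∎
      where
      G H : ℕ → ℕ
      G i = a ⟨ r ∶ (k ℕ.+ 1) ∸ i ⟩
      H i = a ⟨ k ∸ i ∶ (k ∸ h) ℕ.+ 1 ⟩
      G-σ : ∀ i → i ≤ k → G i ≡ sum as ∸ σ as (k ∸ i)
      G-σ i i≤k = ≡.trans
        (cong (a ⟨ r ∶_⟩) (≡.trans (cong (_∸ i) (ℕ.+-comm k 1)) (ℕ.+-∸-assoc 1 i≤k)))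
        (≡.trans (⟨∶⟩-σ a (ℕ.≤-<-trans (ℕ.m∸n≤m k i) k<r))
          (cong (_∸ σ as (k ∸ i)) (σ-length as (ℕ.≤-reflexive len))))
      H-σ : ∀ i → i < h → H i ≡ σ as (k ∸ i) ∸ σ as (k ∸ h)
      H-σ i i<h = ≡.trans (cong (a ⟨ k ∸ i ∶_⟩) (ℕ.+-comm (k ∸ h) 1)) (⟨∶⟩-σ a (ℕ.∸-monoʳ-< i<h h≤k))
      H-positive : ∀ i → i < h → 1 ≤ H i
      H-positive i i<h rewrite H-σ i i<h = ℕ.m<n⇒0<n∸m (σ-strict pos (ℕ.∸-monoʳ-< i<h h≤k)
        (ℕ.≤-trans (ℕ.≤-trans (ℕ.m∸n≤m k i) (ℕ.<⇒≤ k<r)) (ℕ.≤-reflexive (≡.sym len))))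

    fromℚ-f₂ : ∀ {k h} → h ≤ k → k < r → fromℚ (f₂ a k h) ≈ f̂ as k h
    fromℚ-f₂ {k} {zero}  _   _   = trans (fromℚ-f k) (sym (*-identityˡ _))
    fromℚ-f₂ {k} {suc h} h≤k k<r = trans (fromℚ-* (mᵃ a k (suc h)) (f a (k ∸ suc h)))
      (*-cong (fromℚ-mᵃ h≤k k<r) (fromℚ-f (k ∸ suc h)))

  -- Factorisation of the weight of a sequence over its bits

  falling : Carrier → ℕ → Carrier
  falling t k = ∏[ i ∈ upTo k ] (t - fromℕ i)

  falling-cong : ∀ {t u} k → t ≈ u → falling t k ≈ falling u k
  falling-cong k e = ∏-cong (upTo k) (λ i → +-congʳ e)

  falling-suc : ∀ t k → falling t (suc k) ≈ t * falling (t - 1#) k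
  falling-suc t k = begin
    falling t (suc k)                                    ≡⟨ ∏-upTo-suc k _ ⟩
    (t - 0#) * ∏[ i ∈ upTo k ] (t - (1# + fromℕ i))      ≈⟨ *-cong (x-0≈x t) (∏-cong (upTo k) (λ i →
        solve 2 (λ t i → t :- (con (+ 1) :+ i) := (t :- con (+ 1)) :- i) refl t (fromℕ i))) ⟩
    t * falling (t - 1#) k                               ∎

  -- The product over j ≥ 1 in γ, with E in the role of a₀ − b₀.
  blockWeight : Carrier → Vec ℕ r → Vec ℕ r → Carrier
  blockWeight E []       []       = 1#
  blockWeight E (a ∷ as) (b ∷ bs) =
    fromℕ a * falling ((fromℕ a - 1#) + E) (b ∸ 1) * blockWeight (E + (fromℕ a - fromℕ b)) as bs

  -- With t bits read and k of them equal to 1, reading a further bit 0 has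
  -- weight ξ_k − t, and reading a bit 1 has weight a_{k+1}; here E = ξ_k − t.
  weight : Carrier → Vec ℕ r → Composition n r → Carrier
  weight E as b = falling E (first b) * blockWeight (E - fromℕ (first b)) as (rest b)

  blockWeight-cong : ∀ {E F} (as bs : Vec ℕ r) → E ≈ F → blockWeight E as bs ≈ blockWeight F as bs
  blockWeight-cong []       []       e = refl
  blockWeight-cong (a ∷ as) (b ∷ bs) e =
    *-cong (*-congˡ (falling-cong (b ∸ 1) (+-congˡ e))) (blockWeight-cong as bs (+-congʳ e))

  weight-cong : ∀ {E F} (as : Vec ℕ r) (b : Composition n r) → E ≈ F → weight E as b ≈ weight F as b
  weight-cong as b e = *-cong (falling-cong (first b) e) (blockWeight-cong as (rest b) (+-congʳ e))

  weight-0∷ : ∀ E (as : Vec ℕ r) (b : Composition n r) → weight E as (0∷ b) ≈ E * weight (E - 1#) as b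
  weight-0∷ E as b = begin
    falling E (suc (first b)) * blockWeight (E - (1# + fromℕ (first b))) as (rest b)
      ≈⟨ *-cong (falling-suc E (first b)) (blockWeight-cong as (rest b)
           (solve 2 (λ t i → t :- (con (+ 1) :+ i) := (t :- con (+ 1)) :- i) refl E (fromℕ (first b)))) ⟩
    E * falling (E - 1#) (first b) * blockWeight (E - 1# - fromℕ (first b)) as (rest b)
      ≈⟨ *-assoc _ _ _ ⟩
    E * weight (E - 1#) as b ∎

  weight-1∷ : ∀ E a (as : Vec ℕ r) (b : Composition n r) →
              weight E (a ∷ as) (1∷ b) ≈ fromℕ a * weight (E + (fromℕ a - 1#)) as b
  weight-1∷ E a as b = begin
    1# * (fromℕ a * falling ((fromℕ a - 1#) + (E - 0#)) (first b)
          * blockWeight ((E - 0#) + (fromℕ a - (1# + fromℕ (first b)))) as (rest b))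
      ≈⟨ *-identityˡ _ ⟩
    fromℕ a * falling ((fromℕ a - 1#) + (E - 0#)) (first b)
          * blockWeight ((E - 0#) + (fromℕ a - (1# + fromℕ (first b)))) as (rest b)
      ≈⟨ *-cong
           (*-congˡ (falling-cong (first b)
             (solve 2 (λ a e → (a :- con (+ 1)) :+ (e :- con (+ 0)) := e :+ (a :- con (+ 1))) refl (fromℕ a) E)))
           (blockWeight-cong as (rest b)
             (solve 3 (λ a e b → (e :- con (+ 0)) :+ (a :- (con (+ 1) :+ b)) := e :+ (a :- con (+ 1)) :- b) refl (fromℕ a) E (fromℕ (first b)))) ⟩
    fromℕ a * falling (E + (fromℕ a - 1#)) (first b) * blockWeight (E + (fromℕ a - 1#) - fromℕ (first b)) as (rest b)
      ≈⟨ *-assoc _ _ _ ⟩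
    fromℕ a * weight (E + (fromℕ a - 1#)) as b ∎

  -- At e = 0 the surplus would become -1; there the factor e vanishes, so the default `pred 0 = 0`
  -- does no harm.
  weight-fromℕ-0∷ : ∀ e (as : Vec ℕ r) (b : Composition n r) →
             weight (fromℕ e) as (0∷ b) ≈ fromℕ e * weight (fromℕ (pred e)) as b
  weight-fromℕ-0∷ zero    as b = trans (weight-0∷ 0# as b) (trans (zeroˡ _) (sym (zeroˡ _)))
  weight-fromℕ-0∷ (suc e) as b = trans (weight-0∷ (fromℕ (suc e)) as b) (*-congˡ (weight-cong as b
    (solve 1 (λ e → con (+ 1) :+ e :- con (+ 1) := e) refl (fromℕ e))))

  weight-fromℕ-1∷ : ∀ e {a} → 1 ≤ a → (as : Vec ℕ r) (b : Composition n r) →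
             weight (fromℕ e) (a ∷ as) (1∷ b) ≈ fromℕ a * weight (fromℕ (e ℕ.+ (a ∸ 1))) as b
  weight-fromℕ-1∷ e {suc a} _ as b = trans (weight-1∷ (fromℕ e) (suc a) as b) (*-congˡ (weight-cong as b (begin
    fromℕ e + (1# + fromℕ a - 1#)  ≈⟨ solve 2 (λ e a → e :+ (con (+ 1) :+ a :- con (+ 1)) := e :+ a) refl (fromℕ e) (fromℕ a) ⟩
    fromℕ e + fromℕ a              ≈⟨ fromℕ-+ e a ⟨
    fromℕ (e ℕ.+ a)                ∎)))

  -- A bit 0 read at surplus 0 has weight 0. As long as this does not happen, b stays ahead of the
  -- sequence made of e zeros and the blocks of `as`. The surplus is a natural number so that the
  -- case e = 0 can be decided.
  weight≈0⊎dominates : ∀ e (as : Vec ℕ r) → Positive (toList as) → (b : Composition n r) →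
              weight (fromℕ e) as b ≈ 0# ⊎ (∀ m → prefixOnes e (toList as) m ≤ ones b m)
  weight≈0⊎dominates zero    as pos (composition (suc b) bs ps ≡.refl) =
    inj₁ (trans (weight-fromℕ-0∷ 0 as (composition b bs ps ≡.refl)) (zeroˡ _))
  weight≈0⊎dominates (suc e) as pos (composition (suc b) bs ps ≡.refl) with weight≈0⊎dominates e as pos (composition b bs ps ≡.refl)
  ... | inj₁ w≈0 = inj₁ (trans (weight-fromℕ-0∷ (suc e) as (composition b bs ps ≡.refl)) (trans (*-congˡ w≈0) (zeroʳ _)))
  ... | inj₂ dom = inj₂ λ where
    zero    → z≤n
    (suc m) → dom m
  weight≈0⊎dominates e (a ∷ as) (1≤a ∷ pos) (composition zero (suc b ∷ bs) (s≤s z≤n ∷ ps) ≡.refl)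
    with weight≈0⊎dominates (e ℕ.+ (a ∸ 1)) as pos (composition b bs ps ≡.refl)
  ... | inj₁ w≈0 = inj₁ (trans (weight-fromℕ-1∷ e 1≤a as (composition b bs ps ≡.refl)) (trans (*-congˡ w≈0) (zeroʳ _)))
  ... | inj₂ dom = inj₂ λ where
    zero    → z≤n
    (suc m) → ℕ.≤-trans (prefixOnes-∷ e a (toList as) m) (s≤s (dom m))
  weight≈0⊎dominates e [] [] (composition zero [] [] ≡.refl) = inj₂ (λ m → ℕ.≤-reflexive (zeros e m))
    where
    zeros : ∀ e m → prefixOnes e [] m ≡ sum (take m [])
    zeros e       zero    = ≡.refl
    zeros zero    (suc m) = ≡.refl
    zeros (suc e) (suc m) = ≡.trans (zeros e m) (take-[] m)
      where
      take-[] : ∀ m → sum (take m []) ≡ 0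
      take-[] zero    = ≡.refl
      take-[] (suc m) = ≡.refl

  -- Taking off the first block moves the first summand of each inner sum into E, which is why E is
  -- arbitrary here.
  ∏-blockWeight : ∀ E (as bs : Vec ℕ r) →
    ∏[ i ∈ upTo r ] (fromℕ (nth (toList as) i)
      * falling ((fromℕ (nth (toList as) i) - 1#)
                 + (E + ∑[ l ∈ upTo i ] (fromℕ (nth (toList as) l) - fromℕ (nth (toList bs) l))))
                (nth (toList bs) i ∸ 1))
    ≈ blockWeight E as bs
  ∏-blockWeight E []       []       = refl
  ∏-blockWeight {suc r} E (a ∷ as) (b ∷ bs) = begin
    _ ≡⟨ ∏-upTo-suc r _ ⟩
    fromℕ a * falling ((fromℕ a - 1#) + (E + 0#)) (b ∸ 1) * _
      ≈⟨ *-cong (*-congˡ (falling-cong (b ∸ 1) (+-congˡ (+-identityʳ E))))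
           (∏-cong (upTo r) (λ i → *-congˡ (falling-cong (nth (toList bs) i ∸ 1) (+-congˡ
             (trans (+-congˡ (reflexive (∑-upTo-suc i _))) (sym (+-assoc _ _ _))))))) ⟩
    fromℕ a * falling ((fromℕ a - 1#) + E) (b ∸ 1) * _
      ≈⟨ *-congˡ (∏-blockWeight (E + (fromℕ a - fromℕ b)) as bs) ⟩
    blockWeight E (a ∷ as) (b ∷ bs) ∎

  ∏-weight : (a b : Composition n r) →
    falling (fromℕ (a ‼ 0)) (b ‼ 0) * ∏[ j ∈ [ 1 ⋯ r ] ] (fromℕ (a ‼ j)
      * falling ((fromℕ (a ‼ j) - 1#) + ∑[ i ∈ upTo j ] (fromℕ (a ‼ i) - fromℕ (b ‼ i))) (b ‼ j ∸ 1))
    ≈ weight (fromℕ (first a)) (rest a) b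
  ∏-weight {r = r} a b = *-congˡ (begin
    _ ≡⟨ cong (foldr _*_ 1#) (map-∘ (upTo r)) ⟨
    _ ≈⟨ ∏-cong (upTo r) (λ i → *-congˡ (falling-cong (nth (toList (rest b)) i ∸ 1) (+-congˡ (reflexive (∑-upTo-suc i _))))) ⟩
    _ ≈⟨ ∏-blockWeight _ (rest a) (rest b) ⟩
    blockWeight (fromℕ (first a) - fromℕ (first b)) (rest a) (rest b) ∎)

  -- Total weights, by recursion on the first bit

  ∑-weight-suc : ∀ n r e {a} → 1 ≤ a → (as : Vec ℕ r) (g : Composition (suc n) (suc r) → Carrier) →
    ∑[ b ∈ compositions (suc n) (suc r) ] (weight (fromℕ e) (a ∷ as) b * g b) ≈
      fromℕ e * ∑[ b ∈ compositions n (suc r) ] (weight (fromℕ (pred e)) (a ∷ as) b * g (0∷ b))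
      + fromℕ a * ∑[ b ∈ compositions n r ] (weight (fromℕ (e ℕ.+ (a ∸ 1))) as b * g (1∷ b))
  ∑-weight-suc n r e {a} 1≤a as g = begin
    _ ≈⟨ ∑-++ (map 0∷_ (compositions n (suc r))) (map 1∷_ (compositions n r)) _ ⟩
    _ ≡⟨ cong₂ _+_ (∑-map 0∷_ (compositions n (suc r)) _) (∑-map 1∷_ (compositions n r) _) ⟩
    _ ≈⟨ +-cong (∑-cong (compositions n (suc r)) (λ b → trans (*-congʳ (weight-fromℕ-0∷ e (a ∷ as) b)) (*-assoc _ _ _)))
                (∑-cong (compositions n r) (λ b → trans (*-congʳ (weight-fromℕ-1∷ e 1≤a as b)) (*-assoc _ _ _))) ⟩
    _ ≈⟨ +-cong (∑-*ˡ (compositions n (suc r)) (fromℕ e) _) (∑-*ˡ (compositions n r) (fromℕ a) _) ⟩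
    _ ∎

  step-suc : ∀ e {a} → 1 ≤ a → ∀ s → suc (e ℕ.+ (a ∸ 1) ℕ.+ s) ≡ e ℕ.+ (a ℕ.+ s)
  step-suc e {suc a} _ s = ≡.trans (cong suc (ℕ.+-assoc e a s)) (≡.sym (ℕ.+-suc e (a ℕ.+ s)))

  total-step : ∀ e {a s n} → 1 ≤ a → e ℕ.+ (a ℕ.+ s) ≡ suc n → e ℕ.+ (a ∸ 1) ℕ.+ s ≡ n
  total-step e {s = s} 1≤a p = ℕ.suc-injective (≡.trans (step-suc e 1≤a s) p)

  -- Replacing a · invν(as) by N · invν(a ∷ as) gives both choices of the first bit the same factor
  -- n! · invν(a ∷ as); their sum carries e + N, which is the new length. The summand keeps `* 1#`
  -- because the indicator for an empty prefix computes to `1#`.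
  ∑-weight : ∀ n r e (as : Vec ℕ r) → Positive (toList as) → e ℕ.+ sum (toList as) ≡ n →
    ∑[ b ∈ compositions n r ] (weight (fromℕ e) as b * 1#) ≈ fromℕ (n !) * invν (toList as)
  ∑-weight zero zero zero [] [] _ =
    solve 0 (con (+ 1) :* con (+ 1) :* con (+ 1) :+ con (+ 0) := (con (+ 1) :+ con (+ 0)) :* con (+ 1)) refl
  ∑-weight zero (suc r) e (suc a ∷ as) pos tot with ≡.trans (≡.sym (ℕ.+-suc e _)) tot
  ... | ()
  ∑-weight zero (suc r) e (zero ∷ as) (() ∷ _) _
  ∑-weight (suc n) zero (suc e) [] [] tot = begin
    _ ≡⟨ ∑-map 0∷_ (compositions n 0) _ ⟩
    _ ≈⟨ ∑-cong (compositions n 0) (λ b → trans (*-congʳ (weight-fromℕ-0∷ (suc e) [] b)) (*-assoc _ _ _)) ⟩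
    _ ≈⟨ ∑-*ˡ (compositions n 0) (fromℕ (suc e)) _ ⟩
    _ ≈⟨ *-congˡ (∑-weight n zero e [] [] (ℕ.suc-injective tot)) ⟩
    fromℕ (suc e) * (fromℕ (n !) * 1#)
      ≈⟨ *-assoc _ _ _ ⟨
    fromℕ (suc e) * fromℕ (n !) * 1#
      ≈⟨ *-congʳ (fromℕ-* (suc e) (n !)) ⟨
    fromℕ (suc e ℕ.* n !) * 1#
      ≡⟨ cong (λ k → fromℕ (k ℕ.* n !) * 1#) (≡.trans (≡.sym (ℕ.+-identityʳ (suc e))) tot) ⟩
    fromℕ (suc n !) * 1# ∎
  ∑-weight (suc n) (suc r) e (a ∷ as) pos@(1≤a ∷ pos′) tot = begin
    _ ≈⟨ ∑-weight-suc n r e 1≤a as (λ _ → 1#) ⟩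
    fromℕ e * ∑[ b ∈ compositions n (suc r) ] (weight (fromℕ (pred e)) (a ∷ as) b * 1#)
      + fromℕ a * ∑[ b ∈ compositions n r ] (weight (fromℕ (e ℕ.+ (a ∸ 1))) as b * 1#)
      ≈⟨ +-cong (zeros e tot) (*-congˡ (∑-weight n r (e ℕ.+ (a ∸ 1)) as pos′ (total-step e 1≤a tot))) ⟩
    fromℕ e * (F * t) + fromℕ a * (F * invν (toList as))
      ≈⟨ solve 5 (λ e f t a i → e :* (f :* t) :+ a :* (f :* i) := e :* (f :* t) :+ f :* (a :* i)) refl
           (fromℕ e) F t (fromℕ a) (invν (toList as)) ⟩
    fromℕ e * (F * t) + F * (fromℕ a * invν (toList as))
      ≈⟨ +-congˡ (*-congˡ (invν-sum pos)) ⟨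
    fromℕ e * (F * t) + F * (t * fromℕ N)
      ≈⟨ solve 4 (λ e f t n → e :* (f :* t) :+ f :* (t :* n) := (e :+ n) :* f :* t) refl (fromℕ e) F t (fromℕ N) ⟩
    (fromℕ e + fromℕ N) * F * t
      ≈⟨ *-congʳ (*-congʳ (trans (sym (fromℕ-+ e N)) (fromℕ-cong tot))) ⟩
    fromℕ (suc n) * F * t
      ≈⟨ *-congʳ (fromℕ-* (suc n) (n !)) ⟨
    fromℕ (suc n !) * t ∎
    where
    N = sum (a ∷ toList as)
    t = invν (a ∷ toList as)
    F = fromℕ (n !)
    zeros : ∀ e → e ℕ.+ N ≡ suc n →
      fromℕ e * ∑[ b ∈ compositions n (suc r) ] (weight (fromℕ (pred e)) (a ∷ as) b * 1#) ≈ fromℕ e * (F * t)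
    -- At e = 0 the induction hypothesis does not apply, since the lengths no longer add up to n,
    -- but both sides carry the factor 0.
    zeros zero    _   = trans (zeroˡ _) (sym (zeroˡ _))
    zeros (suc e) tot = *-congˡ (∑-weight n (suc r) e (a ∷ as) pos (ℕ.suc-injective tot))

  -- From (m+1) C(t,m+1) = t C(t-1,m) with t = e + s. The summand e of the factor t matches a first
  -- bit 0, which lowers the surplus; the summand s matches a first bit 1 and is the factor removed
  -- by `Λ-shift`.
  binomial-absorb : ∀ e s m → fromℕ (suc m) * fromℕ ((e ℕ.+ s) C suc m) ≈
    fromℕ e * fromℕ ((pred e ℕ.+ s) C m) + fromℕ s * fromℕ (pred (e ℕ.+ s) C m)
  binomial-absorb e s m = begin
    fromℕ (suc m) * fromℕ ((e ℕ.+ s) C suc m)           ≈⟨ fromℕ-* (suc m) ((e ℕ.+ s) C suc m) ⟨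
    fromℕ (suc m ℕ.* ((e ℕ.+ s) C suc m))               ≈⟨ fromℕ-cong (absorb (e ℕ.+ s)) ⟩
    fromℕ ((e ℕ.+ s) ℕ.* (pred (e ℕ.+ s) C m))          ≈⟨ fromℕ-* (e ℕ.+ s) (pred (e ℕ.+ s) C m) ⟩
    fromℕ (e ℕ.+ s) * fromℕ (pred (e ℕ.+ s) C m)        ≈⟨ *-congʳ (fromℕ-+ e s) ⟩
    (fromℕ e + fromℕ s) * fromℕ (pred (e ℕ.+ s) C m)    ≈⟨ distribʳ _ _ _ ⟩
    fromℕ e * fromℕ (pred (e ℕ.+ s) C m) + fromℕ s * fromℕ (pred (e ℕ.+ s) C m)
      ≈⟨ +-congʳ (pred-+ e) ⟩
    fromℕ e * fromℕ ((pred e ℕ.+ s) C m) + fromℕ s * fromℕ (pred (e ℕ.+ s) C m) ∎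
    where
    absorb : ∀ n → suc m ℕ.* (n C suc m) ≡ n ℕ.* (pred n C m)
    absorb zero    = ≡.trans (cong (suc m ℕ.*_) (k>n⇒nCk≡0 {0} {suc m} z<s)) (ℕ.*-zeroʳ m)
    absorb (suc n) = [1+k]*[1+n]C[1+k]≡[1+n]*nCk n m
    pred-+ : ∀ e → fromℕ e * fromℕ (pred (e ℕ.+ s) C m) ≈ fromℕ e * fromℕ ((pred e ℕ.+ s) C m)
    pred-+ zero    = trans (zeroˡ _) (sym (zeroˡ _))
    pred-+ (suc e) = refl

  -- Reading a 1 drops the first block, lowers k and changes the surplus to e + a - 1, so the
  -- remaining nodes e + a + s are lowered by one; reading a 0 lowers all of them by one.
  -- `binomial-absorb` combines the two. The bound k < r provides a block, which excludes n = 0 when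
  -- m > 0.
  ∑-weight-≤ : ∀ n r m k e (as : Vec ℕ r) → suc k ≤ r → Positive (toList as) → e ℕ.+ sum (toList as) ≡ n →
    ∑[ b ∈ compositions n r ] (weight (fromℕ e) as b * χ (ones b m) k) ≈
      fromℕ (m ! ℕ.* (n ∸ m) !) * Λ (toList as) k (λ s → fromℕ ((e ℕ.+ s) C m))
  ∑-weight-≤ n r zero k e as k<r pos tot = begin
    _ ≈⟨ ∑-weight n r e as pos tot ⟩
    fromℕ (n !) * invν (toList as)
      ≈⟨ *-cong (fromℕ-cong (ℕ.+-identityʳ (n !)))
           (trans (Λ-cong (toList as) k (λ s → trans (fromℕ-cong (nC0≡1 (e ℕ.+ s))) fromℕ-1))
             (Λ-1 pos (ℕ.≤-trans (ℕ.<⇒≤ k<r) (ℕ.≤-reflexive (≡.sym (length-toList as)))))) ⟨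
    fromℕ (1 ℕ.* n !) * Λ (toList as) k (λ s → fromℕ ((e ℕ.+ s) C 0)) ∎
  ∑-weight-≤ zero    (suc r) (suc m) k e (suc a ∷ as) _ pos tot with ≡.trans (≡.sym (ℕ.+-suc e _)) tot
  ... | ()
  ∑-weight-≤ zero    (suc r) (suc m) k e (zero ∷ as) _ (() ∷ _) _
  ∑-weight-≤ (suc n) (suc r) (suc m) k e (a ∷ as) k<r pos@(1≤a ∷ pos′) tot = begin
    _ ≈⟨ ∑-weight-suc n r e 1≤a as (λ b → χ (ones b (suc m)) k) ⟩
    fromℕ e * ∑[ b ∈ compositions n (suc r) ] (weight (fromℕ (pred e)) (a ∷ as) b * χ (ones b m) k)
      + fromℕ a * ∑[ b ∈ compositions n r ] (weight (fromℕ (e ℕ.+ (a ∸ 1))) as b * χ (suc (ones b m)) k)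
      ≈⟨ +-congʳ (step₀ e tot) ⟩
    fromℕ e * (F * Λ A k (λ s → fromℕ ((pred e ℕ.+ s) C m)))
      + fromℕ a * ∑[ b ∈ compositions n r ] (weight (fromℕ (e ℕ.+ (a ∸ 1))) as b * χ (suc (ones b m)) k)
      ≈⟨ +-congˡ (step₁ k k<r) ⟩
    fromℕ e * (F * Λ A k (λ s → fromℕ ((pred e ℕ.+ s) C m)))
      + F * Λ A k (λ s → fromℕ s * fromℕ (pred (e ℕ.+ s) C m))
      ≈⟨ solve 4 (λ e f x y → e :* (f :* x) :+ f :* y := f :* (e :* x :+ con (+ 1) :* y)) refl (fromℕ e) F _ _ ⟩
    F * (fromℕ e * Λ A k (λ s → fromℕ ((pred e ℕ.+ s) C m))
      + 1# * Λ A k (λ s → fromℕ s * fromℕ (pred (e ℕ.+ s) C m)))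
      ≈⟨ *-congˡ (Λ-linear A k _ _ (fromℕ e) 1#) ⟨
    F * Λ A k (λ s → fromℕ e * fromℕ ((pred e ℕ.+ s) C m) + 1# * (fromℕ s * fromℕ (pred (e ℕ.+ s) C m)))
      ≈⟨ *-congˡ (Λ-cong A k (λ s → trans (+-congˡ (*-identityˡ _))
           (trans (sym (binomial-absorb e s m)) (trans (sym (+-identityʳ _)) (+-congˡ (sym (zeroˡ 0#))))))) ⟩
    -- The summand `0# * 0#` is padding: it lets `Λ-linear`, stated for two functions, extract a
    -- single scalar.
    F * Λ A k (λ s → fromℕ (suc m) * fromℕ ((e ℕ.+ s) C suc m) + 0# * 0#)
      ≈⟨ *-congˡ (Λ-linear A k _ _ (fromℕ (suc m)) 0#) ⟩
    F * (fromℕ (suc m) * L + 0# * Λ A k (λ _ → 0#))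
      ≈⟨ solve 4 (λ f m l z → f :* (m :* l :+ con (+ 0) :* z) := m :* f :* l) refl F (fromℕ (suc m)) L _ ⟩
    fromℕ (suc m) * F * L
      ≈⟨ *-congʳ (fromℕ-* (suc m) (m ! ℕ.* (n ∸ m) !)) ⟨
    fromℕ (suc m ℕ.* (m ! ℕ.* (n ∸ m) !)) * L
      ≡⟨ cong (λ z → fromℕ z * L) (ℕ.*-assoc (suc m) (m !) _) ⟨
    fromℕ (suc m ! ℕ.* (n ∸ m) !) * L ∎
    where
    A = a ∷ toList as
    F = fromℕ (m ! ℕ.* (n ∸ m) !)
    L = Λ A k (λ s → fromℕ ((e ℕ.+ s) C suc m))
    step₀ : ∀ e → e ℕ.+ sum A ≡ suc n →
      fromℕ e * ∑[ b ∈ compositions n (suc r) ] (weight (fromℕ (pred e)) (a ∷ as) b * χ (ones b m) k)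
      ≈ fromℕ e * (F * Λ A k (λ s → fromℕ ((pred e ℕ.+ s) C m)))
    step₀ zero    _   = trans (zeroˡ _) (sym (zeroˡ _))
    step₀ (suc e) tot = *-congˡ (∑-weight-≤ n (suc r) m k e (a ∷ as) k<r pos (ℕ.suc-injective tot))
    pred-move : ∀ s → e ℕ.+ (a ∸ 1) ℕ.+ s ≡ pred (e ℕ.+ (a ℕ.+ s))
    pred-move s = cong pred (step-suc e 1≤a s)
    step₁ : ∀ k → suc k ≤ suc r →
      fromℕ a * ∑[ b ∈ compositions n r ] (weight (fromℕ (e ℕ.+ (a ∸ 1))) as b * χ (suc (ones b m)) k)
      ≈ F * Λ A k (λ s → fromℕ s * fromℕ (pred (e ℕ.+ s) C m))
    -- With k = 0 a leading 1 already exceeds the bound; on the other side the only node is 0, where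
    -- the factor s vanishes.
    step₁ zero    _ = begin
      _ ≈⟨ *-congˡ (trans (∑-cong (compositions n r) (λ _ → zeroʳ _)) (∑-0 (compositions n r))) ⟩
      fromℕ a * 0#
        ≈⟨ solve 4 (λ a f i c → a :* con (+ 0) := f :* (i :* (con (+ 0) :* c))) refl (fromℕ a) F (invν A) _ ⟩
      F * (invν A * (0# * fromℕ (pred (e ℕ.+ 0) C m)))
        ≈⟨ *-congˡ (Λ-0 A _) ⟨
      F * Λ A 0 (λ s → fromℕ s * fromℕ (pred (e ℕ.+ s) C m)) ∎
    step₁ (suc k) (s≤s k<r) = begin
      _ ≈⟨ *-congˡ (∑-weight-≤ n r m k (e ℕ.+ (a ∸ 1)) as k<r pos′ (total-step e 1≤a tot)) ⟩
      fromℕ a * (F * Λ (toList as) k (λ s → fromℕ ((e ℕ.+ (a ∸ 1) ℕ.+ s) C m)))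
        ≈⟨ *-congˡ (*-congˡ (Λ-cong (toList as) k (λ s → fromℕ-cong (cong (_C m) (pred-move s))))) ⟩
      fromℕ a * (F * Λ (toList as) k (λ s → fromℕ (pred (e ℕ.+ (a ℕ.+ s)) C m)))
        ≈⟨ solve 3 (λ a f l → a :* (f :* l) := f :* (a :* l)) refl (fromℕ a) F _ ⟩
      F * (fromℕ a * Λ (toList as) k (λ s → fromℕ (pred (e ℕ.+ (a ℕ.+ s)) C m)))
        ≈⟨ *-congˡ (Λ-shift pos k (λ s → fromℕ (pred (e ℕ.+ s) C m))) ⟨
      F * Λ A (suc k) (λ s → fromℕ s * fromℕ (pred (e ℕ.+ s) C m)) ∎

-- Telescoping sums and τ

module Telescoping {c ℓ} (A : CommutativeRing c ℓ) where
  open CommutativeRing A hiding (zero)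
  open IntegerMultiples A
  open Solver using (solve; _:=_; _:*_; _:+_; _:-_; :-_; con)
  open BigOperators rawRing
  open BigOperatorProperties A
  open RawSemiringDefs (Semiring.rawSemiring semiring) using (_^_) renaming (_×_ to _·_)
  open Algebra.Properties.Semiring.Mult semiring using (×-assoc-*; ×-comm-*; ×-congʳ)
  open import Relation.Binary.Reasoning.Setoid setoid

  ·-fromℕ : ∀ m z → m · z ≈ fromℕ m * z
  ·-fromℕ m z = sym (trans (×-assoc-* m 1# z) (×-congʳ m (*-identityˡ z)))

  -- Abel summation: the indicator keeps exactly the differences with w ≤ k < r, and these
  -- telescope.
  telescope : ∀ (v : ℕ → Carrier) {w r} → w ≤ r →
              v w ≈ v r + ∑[ k ∈ upTo r ] (χ w k * (v k - v (suc k)))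
  telescope v {zero}  {zero}  z≤n = sym (+-identityʳ _)
  telescope v {zero}  {suc r} z≤n = begin
    v 0
      ≈⟨ solve 2 (λ x y → x := con (+ 1) :* (x :- y) :+ y) refl (v 0) (v 1) ⟩
    1# * (v 0 - v 1) + v 1
      ≈⟨ +-congˡ (telescope (v ∘ suc) {zero} {r} z≤n) ⟩
    1# * (v 0 - v 1) + (v (suc r) + ∑[ k ∈ upTo r ] (χ 0 k * (v (suc k) - v (suc (suc k)))))
      ≈⟨ solve 3 (λ x y z → x :+ (y :+ z) := y :+ (x :+ z)) refl (1# * (v 0 - v 1)) (v (suc r)) _ ⟩
    v (suc r) + (1# * (v 0 - v 1) + ∑[ k ∈ upTo r ] (χ 0 (suc k) * (v (suc k) - v (suc (suc k)))))
      ≡⟨ cong (λ z → v (suc r) + z) (∑-upTo-suc r (λ k → χ 0 k * (v k - v (suc k)))) ⟨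
    v (suc r) + ∑[ k ∈ upTo (suc r) ] (χ 0 k * (v k - v (suc k))) ∎
  telescope v {suc w} {suc r} (s≤s w≤r) = begin
    v (suc w)
      ≈⟨ telescope (v ∘ suc) w≤r ⟩
    v (suc r) + S
      ≈⟨ solve 3 (λ y z u → y :+ z := y :+ (con (+ 0) :* u :+ z)) refl (v (suc r)) S (v 0 - v 1) ⟩
    v (suc r) + (0# * (v 0 - v 1) + S)
      ≡⟨ cong (λ z → v (suc r) + z) (∑-upTo-suc r (λ k → χ (suc w) k * (v k - v (suc k)))) ⟨
    v (suc r) + ∑[ k ∈ upTo (suc r) ] (χ (suc w) k * (v k - v (suc k))) ∎
    where S = ∑[ k ∈ upTo r ] (χ w k * (v (suc k) - v (suc (suc k))))

  ∑-subsets : ∀ n (g : ℕ → Carrier) →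
              ∑[ S ∈ subsets n ] g ∣ S ∣ ≈ ∑[ m ∈ upTo (suc n) ] (fromℕ (n C m) * g m)
  ∑-subsets zero    g = +-congʳ (sym (trans (*-congʳ fromℕ-1) (*-identityˡ _)))
  ∑-subsets (suc n) g = begin
    _ ≈⟨ ∑-++ (map (outside ∷_) (subsets n)) (map (inside ∷_) (subsets n)) _ ⟩
    _ ≡⟨ cong₂ _+_ (∑-map (outside ∷_) (subsets n) _) (∑-map (inside ∷_) (subsets n) _) ⟩
    ∑[ S ∈ subsets n ] g ∣ S ∣ + ∑[ S ∈ subsets n ] g (suc ∣ S ∣)
      ≈⟨ +-cong (∑-subsets n g) (∑-subsets n (g ∘ suc)) ⟩
    ∑[ m ∈ upTo (suc n) ] (fromℕ (n C m) * g m) + V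
      ≈⟨ +-congʳ (+-identityʳ _) ⟨
    ∑[ m ∈ upTo (suc n) ] (fromℕ (n C m) * g m) + 0# + V
      ≈⟨ +-congʳ (+-congˡ (trans (*-congʳ (fromℕ-cong (k>n⇒nCk≡0 {n} {suc n} (ℕ.n<1+n n)))) (zeroˡ _))) ⟨
    ∑[ m ∈ upTo (suc n) ] (fromℕ (n C m) * g m) + fromℕ (n C suc n) * g (suc n) + V
      ≈⟨ +-congʳ (∑-upTo-last (suc n) _) ⟨
    ∑[ m ∈ upTo (suc (suc n)) ] (fromℕ (n C m) * g m) + V
      ≡⟨ cong (_+ V) (∑-upTo-suc (suc n) _) ⟩
    fromℕ (n C 0) * g 0 + ∑[ m ∈ upTo (suc n) ] (fromℕ (n C suc m) * g (suc m)) + V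
      ≈⟨ trans (+-assoc _ _ _) (+-congˡ (sym (∑-+ (upTo (suc n)) _ _))) ⟩
    fromℕ (n C 0) * g 0 + ∑[ m ∈ upTo (suc n) ] (fromℕ (n C suc m) * g (suc m) + fromℕ (n C m) * g (suc m))
      ≈⟨ +-cong (*-congʳ (fromℕ-cong (≡.trans (nC0≡1 n) (≡.sym (nC0≡1 (suc n))))))
           (∑-cong (upTo (suc n)) (λ m → trans (sym (distribʳ _ _ _)) (*-congʳ (trans (+-comm _ _)
             (trans (sym (fromℕ-+ (n C m) (n C suc m))) (fromℕ-cong (nCk+nC[k+1]≡[n+1]C[k+1] n m))))))) ⟩
    fromℕ (suc n C 0) * g 0 + ∑[ m ∈ upTo (suc n) ] (fromℕ (suc n C suc m) * g (suc m))
      ≡⟨ ∑-upTo-suc (suc n) _ ⟨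
    ∑[ m ∈ upTo (suc (suc n)) ] (fromℕ (suc n C m) * g m) ∎
    where V = ∑[ m ∈ upTo (suc n) ] (fromℕ (n C m) * g (suc m))

  module _ (X Y : Carrier) where

    -- The power Y^(m-k-1) for k < m, and 0 otherwise, where truncated subtraction would wrongly
    -- give exponent 0.
    p : ℕ → ℕ → Carrier
    p zero    k       = 0#
    p (suc m) zero    = Y ^ m
    p (suc m) (suc k) = p m k

    p-< : ∀ {m k} → k < m → p m k ≡ Y ^ (m ∸ suc k)
    p-< {suc m} {zero}  _         = ≡.refl
    p-< {suc m} {suc k} (s≤s k<m) = p-< k<m

    p-≥ : ∀ {m k} → m ≤ k → p m k ≡ 0#
    p-≥ {zero}  _         = ≡.refl
    p-≥ {suc m} (s≤s m≤k) = p-≥ m≤k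

    u : ℕ → ℕ → ℕ → Carrier
    u r m j = X ^ (r ∸ j) * Y ^ (m ∸ j)

    ^-step : ∀ Z {r k} → k < r → Z ^ (r ∸ k) ≡ Z * Z ^ (r ∸ suc k)
    ^-step Z {r} {k} k<r = cong (Z ^_) (ℕ.+-∸-assoc 1 k<r)

    -- For k < m the common monomial factors out and leaves XY - 1. For m ≤ k both indices are
    -- truncated to m, so the difference vanishes together with `p`.
    u-step : ∀ {r k} m → k < r →
      u r m (k ⊓ m) - u r m (suc k ⊓ m) ≈ (X * Y - 1#) * (X ^ (r ∸ k ∸ 1) * p m k)
    u-step {r} {k} m k<r with ℕ.<-≤-connex k m
    ... | inj₁ k<m = begin
      u r m (k ⊓ m) - u r m (suc k ⊓ m)
        ≡⟨ cong₂ (λ i j → u r m i - u r m j) (ℕ.m≤n⇒m⊓n≡m (ℕ.<⇒≤ k<m)) (ℕ.m≤n⇒m⊓n≡m k<m) ⟩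
      X ^ (r ∸ k) * Y ^ (m ∸ k) - X ^ (r ∸ suc k) * Y ^ (m ∸ suc k)
        ≡⟨ cong₂ (λ w z → w * z - X ^ (r ∸ suc k) * Y ^ (m ∸ suc k)) (^-step X k<r) (^-step Y k<m) ⟩
      X * X ^ (r ∸ suc k) * (Y * Y ^ (m ∸ suc k)) - X ^ (r ∸ suc k) * Y ^ (m ∸ suc k)
        ≈⟨ solve 4 (λ x y a b → x :* a :* (y :* b) :- a :* b := (x :* y :- con (+ 1)) :* (a :* b)) refl
             X Y (X ^ (r ∸ suc k)) (Y ^ (m ∸ suc k)) ⟩
      (X * Y - 1#) * (X ^ (r ∸ suc k) * Y ^ (m ∸ suc k))
        ≡⟨ cong₂ (λ i z → (X * Y - 1#) * (X ^ i * z)) (≡.trans (ℕ.∸-+-assoc r k 1) (cong (r ∸_) (ℕ.+-comm k 1))) (p-< k<m) ⟨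
      (X * Y - 1#) * (X ^ (r ∸ k ∸ 1) * p m k) ∎
    ... | inj₂ m≤k = begin
      u r m (k ⊓ m) - u r m (suc k ⊓ m)
        ≡⟨ cong₂ (λ i j → u r m i - u r m j) (ℕ.m≥n⇒m⊓n≡n m≤k) (ℕ.m≥n⇒m⊓n≡n (ℕ.m≤n⇒m≤1+n m≤k)) ⟩
      u r m m - u r m m
        ≈⟨ solve 3 (λ z a b → z :- z := a :* (b :* con (+ 0))) refl (u r m m) (X * Y - 1#) (X ^ (r ∸ k ∸ 1)) ⟩
      (X * Y - 1#) * (X ^ (r ∸ k ∸ 1) * 0#)
        ≡⟨ cong (λ z → (X * Y - 1#) * (X ^ (r ∸ k ∸ 1) * z)) (p-≥ m≤k) ⟨
      (X * Y - 1#) * (X ^ (r ∸ k ∸ 1) * p m k) ∎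

    ∑-p : ∀ n k → k ≤ n → (g : ℕ → Carrier) →
      ∑[ m ∈ upTo (suc n) ] (g m * p m k) ≈ ∑[ m ∈ upTo (n ∸ k) ] (g (suc k ℕ.+ m) * Y ^ m)
    ∑-p n       zero    z≤n       g = begin
      _ ≡⟨ ∑-upTo-suc n _ ⟩
      g 0 * 0# + ∑[ m ∈ upTo n ] (g (suc m) * Y ^ m)  ≈⟨ +-congʳ (zeroʳ _) ⟩
      0# + ∑[ m ∈ upTo n ] (g (suc m) * Y ^ m)        ≈⟨ +-identityˡ _ ⟩
      ∑[ m ∈ upTo n ] (g (suc m) * Y ^ m)             ∎
    ∑-p (suc n) (suc k) (s≤s k≤n) g = begin
      _ ≡⟨ ∑-upTo-suc (suc n) _ ⟩
      g 0 * 0# + ∑[ m ∈ upTo (suc n) ] (g (suc m) * p m k)  ≈⟨ trans (+-congʳ (zeroʳ _)) (+-identityˡ _) ⟩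
      ∑[ m ∈ upTo (suc n) ] (g (suc m) * p m k)             ≈⟨ ∑-p n k k≤n (g ∘ suc) ⟩
      ∑[ m ∈ upTo (n ∸ k) ] (g (suc (suc k ℕ.+ m)) * Y ^ m) ∎

    -- This is τ(k+1, β-1; y). With the shift, α = -1 becomes the empty sum β = 0, from which the
    -- induction starts.
    τ-sum : Carrier → ℕ → ℕ → Carrier
    τ-sum y k β = ∑[ i ∈ upTo β ] (((k ℕ.+ β ∸ suc i) C (β ∸ suc i)) · y ^ i)

    -- The first M terms of the quotient of (Y + 1)^N by Y^{k+1}.
    taylor : ℕ → ℕ → ℕ → Carrier
    taylor M k N = ∑[ m ∈ upTo M ] (fromℕ (N C (suc k ℕ.+ m)) * Y ^ m)

    taylor-low : ∀ M {k N} → N ≤ k → taylor M k N ≈ 0#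
    taylor-low M {k} {N} N≤k = trans
      (∑-cong (upTo M) (λ m → trans (*-congʳ (fromℕ-cong (k>n⇒nCk≡0 {N} (s≤s (ℕ.≤-trans N≤k (ℕ.m≤m+n k m)))))) (zeroˡ _)))
      (∑-0 (upTo M))

    -- Multiplication by Y+1 multiplies the quotient by Y+1 and lifts the coefficient C(N,k) of Y^k
    -- from the remainder into its constant term. N ≤ k + M makes the last retained coefficient
    -- zero, so nothing is lost to the cutoff.
    taylor-suc : ∀ M k N → N ≤ k ℕ.+ M →
      taylor (suc M) k (suc N) ≈ fromℕ (N C k) + (Y + 1#) * taylor (suc M) k N
    taylor-suc M k N N≤k+M = begin
      taylor (suc M) k (suc N)
        ≈⟨ ∑-cong (upTo (suc M)) (λ m → trans (*-congʳ (trans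
             (fromℕ-cong (≡.sym (nCk+nC[k+1]≡[n+1]C[k+1] N (k ℕ.+ m)))) (fromℕ-+ (N C (k ℕ.+ m)) _))) (distribʳ _ _ _)) ⟩
      _ ≈⟨ ∑-+ (upTo (suc M)) _ _ ⟩
      ∑[ m ∈ upTo (suc M) ] (fromℕ (N C (k ℕ.+ m)) * Y ^ m) + taylor (suc M) k N
        ≡⟨ cong (_+ taylor (suc M) k N) (∑-upTo-suc M _) ⟩
      fromℕ (N C (k ℕ.+ 0)) * 1# + ∑[ m ∈ upTo M ] (fromℕ (N C (k ℕ.+ suc m)) * (Y * Y ^ m)) + taylor (suc M) k N
        ≈⟨ +-congʳ (+-cong (trans (*-identityʳ _) (fromℕ-cong (cong (N C_) (ℕ.+-identityʳ k))))
             (trans (∑-cong (upTo M) (λ m → trans (*-congʳ (fromℕ-cong (cong (N C_) (ℕ.+-suc k m))))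
                (solve 3 (λ a y z → a :* (y :* z) := y :* (a :* z)) refl (fromℕ (N C (suc k ℕ.+ m))) Y (Y ^ m))))
             (∑-*ˡ (upTo M) Y _))) ⟩
      fromℕ (N C k) + Y * taylor M k N + taylor (suc M) k N
        ≈⟨ +-congʳ (+-congˡ (*-congˡ last)) ⟨
      fromℕ (N C k) + Y * taylor (suc M) k N + taylor (suc M) k N
        ≈⟨ solve 3 (λ c y t → c :+ y :* t :+ t := c :+ (y :+ con (+ 1)) :* t) refl (fromℕ (N C k)) Y (taylor (suc M) k N) ⟩
      fromℕ (N C k) + (Y + 1#) * taylor (suc M) k N ∎
      where
      last : taylor (suc M) k N ≈ taylor M k N
      last = trans (∑-upTo-last M _) (trans (+-congˡ (trans
        (*-congʳ (fromℕ-cong (k>n⇒nCk≡0 {N} (s≤s N≤k+M)))) (zeroˡ _))) (+-identityʳ _))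

    -- Both sides satisfy F(β+1) = C(k+β,k) + y F(β): the left by taking off the term i = 0, the
    -- right by `taylor-suc`.
    τ-taylor : ∀ {y} → y ≈ Y + 1# → ∀ M k β → β ≤ suc M → τ-sum y k β ≈ taylor (suc M) k (k ℕ.+ β)
    τ-taylor y≈ M k zero    _ = sym (taylor-low (suc M) (ℕ.≤-reflexive (ℕ.+-identityʳ k)))
    τ-taylor {y} y≈ M k (suc β) (s≤s β≤M) rewrite ℕ.+-suc k β = begin
      _ ≡⟨ ∑-upTo-suc β _ ⟩
      ((k ℕ.+ β) C β) · 1# + ∑[ i ∈ upTo β ] (((k ℕ.+ β ∸ suc i) C (β ∸ suc i)) · (y * y ^ i))
        ≈⟨ +-cong (fromℕ-cong symmetry) (trans (∑-cong (upTo β) (λ i →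
             sym (×-comm-* ((k ℕ.+ β ∸ suc i) C (β ∸ suc i)) y (y ^ i)))) (∑-*ˡ (upTo β) y _)) ⟩
      fromℕ ((k ℕ.+ β) C k) + y * τ-sum y k β
        ≈⟨ +-congˡ (*-cong y≈ (τ-taylor y≈ M k β (ℕ.m≤n⇒m≤1+n β≤M))) ⟩
      fromℕ ((k ℕ.+ β) C k) + (Y + 1#) * taylor (suc M) k (k ℕ.+ β)
        ≈⟨ taylor-suc M k (k ℕ.+ β) (ℕ.+-monoʳ-≤ k β≤M) ⟨
      taylor (suc M) k (suc (k ℕ.+ β)) ∎
      where
      symmetry : (k ℕ.+ β) C β ≡ (k ℕ.+ β) C k
      symmetry = ≡.trans (nCk≡nC[n∸k] (ℕ.m≤n+m β k)) (cong ((k ℕ.+ β) C_) (ℕ.m+n∸n≡m k β))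

    -- Either m > k ≥ s and the binomial coefficient vanishes, or m ≤ k and `p` does. This is the
    -- counterpart of τ = 0 for negative α, and it also removes the node ξ_0 = 0.
    ∑-binomial-p-low : ∀ n {s k} → s ≤ k → ∑[ m ∈ upTo (suc n) ] (fromℕ (s C m) * p m k) ≈ 0#
    ∑-binomial-p-low n {s} {k} s≤k = trans (∑-cong (upTo (suc n)) vanish) (∑-0 (upTo (suc n)))
      where
      vanish : ∀ m → fromℕ (s C m) * p m k ≈ 0#
      vanish m with ℕ.<-≤-connex k m
      ... | inj₁ k<m = trans (*-congʳ (fromℕ-cong (k>n⇒nCk≡0 (ℕ.≤-<-trans s≤k k<m)))) (zeroˡ _)
      ... | inj₂ m≤k = trans (*-congˡ (reflexive (p-≥ m≤k))) (zeroʳ _)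

    τ-binomial : ∀ {y} → y ≈ Y + 1# → ∀ {n k s} → k < s → s ≤ n →
      τ-sum y k (s ∸ k) ≈ ∑[ m ∈ upTo (suc n) ] (fromℕ (s C m) * p m k)
    τ-binomial {y} y≈ {n} {k} {s} k<s s≤n = begin
      τ-sum y k (s ∸ k)
        ≈⟨ τ-taylor y≈ (n ∸ suc k) k (s ∸ k) (ℕ.≤-trans (ℕ.∸-monoˡ-≤ k s≤n) (ℕ.≤-reflexive n∸k)) ⟩
      taylor (suc (n ∸ suc k)) k (k ℕ.+ (s ∸ k))
        ≡⟨ cong₂ (λ M N → taylor M k N) n∸k (≡.sym (ℕ.m+[n∸m]≡n (ℕ.<⇒≤ k<s))) ⟨
      taylor (n ∸ k) k s
        ≈⟨ ∑-p n k (ℕ.≤-trans (ℕ.<⇒≤ k<s) s≤n) (λ m → fromℕ (s C m)) ⟨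
      ∑[ m ∈ upTo (suc n) ] (fromℕ (s C m) * p m k) ∎
      where
      n∸k : n ∸ k ≡ suc (n ∸ suc k)
      n∸k = ℕ.+-∸-assoc 1 (ℕ.≤-trans k<s s≤n)

    τ-sum-suc : ∀ y k α → ∑[ i ∈ upTo (suc α) ] (((α ℕ.+ suc k ∸ 1 ∸ i) C (α ∸ i)) · y ^ i) ≈ τ-sum y k (suc α)
    τ-sum-suc y k α = ∑-cong (upTo (suc α)) (λ i → reflexive (cong (λ N → ((N C (α ∸ i)) · y ^ i))
      (≡.trans (ℕ.∸-+-assoc (α ℕ.+ suc k) 1 i) (cong (_∸ suc i) (≡.trans (ℕ.+-suc α k) (≡.trans (cong suc (ℕ.+-comm α k)) (≡.sym (ℕ.+-suc k α))))))))

    τ-high : ∀ {y} → y ≈ Y + 1# → ∀ {n k s} → k < s → s ≤ n → let α = s ∸ suc k in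
      ∑[ i ∈ upTo (suc α) ] (((α ℕ.+ suc k ∸ 1 ∸ i) C (α ∸ i)) · y ^ i) ≈ ∑[ m ∈ upTo (suc n) ] (fromℕ (s C m) * p m k)
    τ-high {y} y≈ {n} {k} {s} k<s s≤n = begin
      _                         ≈⟨ τ-sum-suc y k (s ∸ suc k) ⟩
      τ-sum y k (suc (s ∸ suc k)) ≡⟨ cong (τ-sum y k) (ℕ.+-∸-assoc 1 k<s) ⟨
      τ-sum y k (s ∸ k)         ≈⟨ τ-binomial y≈ k<s s≤n ⟩
      _                         ∎

-- Polynomials

module Convolution {c ℓ} (R : CommutativeRing c ℓ) where
  open CommutativeRing R hiding (zero)
  open Algebra.Properties.Ring ring using (-0#≈0#)
  open Algebra.Properties.CommutativeSemigroup +-commutativeSemigroup using (interchange; x∙yz≈y∙xz)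
  open import Relation.Binary.Reasoning.Setoid setoid

  infixl 7 _⋆_
  _⋆_ : (ℕ → Carrier) → (ℕ → Carrier) → ℕ → Carrier
  (u ⋆ v) zero    = u 0 * v 0
  (u ⋆ v) (suc i) = u 0 * v (suc i) + ((u ∘ suc) ⋆ v) i

  ⋆-cong : ∀ {u u′ v v′} → (∀ i → u i ≈ u′ i) → (∀ i → v i ≈ v′ i) → ∀ i → (u ⋆ v) i ≈ (u′ ⋆ v′) i
  ⋆-cong e e′ zero    = *-cong (e 0) (e′ 0)
  ⋆-cong e e′ (suc i) = +-cong (*-cong (e 0) (e′ (suc i))) (⋆-cong (e ∘ suc) e′ i)

  -- The recursion of `_⋆_` consumes the left factor; a recursion consuming the right one is what
  -- commutativity requires.
  ⋆-last : ∀ u v i → (u ⋆ v) (suc i) ≈ u (suc i) * v 0 + (u ⋆ (v ∘ suc)) i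
  ⋆-last u v zero    = +-comm _ _
  ⋆-last u v (suc i) = trans (+-congˡ (⋆-last (u ∘ suc) v i)) (x∙yz≈y∙xz _ _ _)

  ⋆-comm : ∀ u v i → (u ⋆ v) i ≈ (v ⋆ u) i
  ⋆-comm u v zero    = *-comm _ _
  ⋆-comm u v (suc i) = trans (+-cong (*-comm _ _) (⋆-comm (u ∘ suc) v i)) (sym (⋆-last v u i))

  ⋆-distribʳ : ∀ u u′ v i → ((λ j → u j + u′ j) ⋆ v) i ≈ (u ⋆ v) i + (u′ ⋆ v) i
  ⋆-distribʳ u u′ v zero    = distribʳ _ _ _
  ⋆-distribʳ u u′ v (suc i) =
    trans (+-cong (distribʳ _ _ _) (⋆-distribʳ (u ∘ suc) (u′ ∘ suc) v i)) (interchange _ _ _ _)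

  ⋆-scale : ∀ z u v i → ((λ j → z * u j) ⋆ v) i ≈ z * (u ⋆ v) i
  ⋆-scale z u v zero    = *-assoc _ _ _
  ⋆-scale z u v (suc i) = trans (+-cong (*-assoc _ _ _) (⋆-scale z (u ∘ suc) v i)) (sym (distribˡ _ _ _))

  ⋆-assoc : ∀ u v w i → ((u ⋆ v) ⋆ w) i ≈ (u ⋆ (v ⋆ w)) i
  ⋆-assoc u v w zero    = *-assoc _ _ _
  ⋆-assoc u v w (suc i) = begin
    u 0 * v 0 * w (suc i) + ((λ j → u 0 * v (suc j) + ((u ∘ suc) ⋆ v) j) ⋆ w) i
      ≈⟨ +-cong (*-assoc _ _ _) (⋆-distribʳ _ _ w i) ⟩
    u 0 * (v 0 * w (suc i)) + (((λ j → u 0 * v (suc j)) ⋆ w) i + (((u ∘ suc) ⋆ v) ⋆ w) i)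
      ≈⟨ +-congˡ (+-cong (⋆-scale (u 0) (v ∘ suc) w i) (⋆-assoc (u ∘ suc) v w i)) ⟩
    u 0 * (v 0 * w (suc i)) + (u 0 * ((v ∘ suc) ⋆ w) i + ((u ∘ suc) ⋆ (v ⋆ w)) i)
      ≈⟨ +-assoc _ _ _ ⟨
    u 0 * (v 0 * w (suc i)) + u 0 * ((v ∘ suc) ⋆ w) i + ((u ∘ suc) ⋆ (v ⋆ w)) i
      ≈⟨ +-congʳ (distribˡ _ _ _) ⟨
    (u ⋆ (v ⋆ w)) (suc i) ∎

  ⋆-zeroˡ : ∀ v i → ((λ _ → 0#) ⋆ v) i ≈ 0#
  ⋆-zeroˡ v zero    = zeroˡ _
  ⋆-zeroˡ v (suc i) = trans (+-cong (zeroˡ _) (⋆-zeroˡ v i)) (+-identityˡ _)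

  coeff : List Carrier → ℕ → Carrier
  coeff = coefficient rawRing

  coeff-add : ∀ p q i → coeff (add rawRing p q) i ≈ coeff p i + coeff q i
  coeff-add []      q       i       = sym (+-identityˡ _)
  coeff-add (a ∷ p) []      i       = sym (+-identityʳ _)
  coeff-add (a ∷ p) (b ∷ q) zero    = refl
  coeff-add (a ∷ p) (b ∷ q) (suc i) = coeff-add p q i

  coeff-map : ∀ {g : Carrier → Carrier} → g 0# ≈ 0# → ∀ p i → coeff (map g p) i ≈ g (coeff p i)
  coeff-map g0 []      i       = sym g0
  coeff-map g0 (a ∷ p) zero    = refl
  coeff-map g0 (a ∷ p) (suc i) = coeff-map g0 p i

  -- Polynomial equality being coefficientwise, this transfers the ring laws to infinite sequences,
  -- where list lengths play no part.
  coeff-mul : ∀ p q i → coeff (mul rawRing p q) i ≈ (coeff p ⋆ coeff q) i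
  coeff-mul []      q i       = sym (⋆-zeroˡ (coeff q) i)
  coeff-mul (a ∷ p) q zero    = trans (coeff-add (map (a *_) q) (0# ∷ mul rawRing p q) 0)
    (trans (+-identityʳ _) (coeff-map (zeroʳ a) q 0))
  coeff-mul (a ∷ p) q (suc i) = trans (coeff-add (map (a *_) q) (0# ∷ mul rawRing p q) (suc i))
    (+-cong (coeff-map (zeroʳ a) q (suc i)) (coeff-mul p q i))

  coeff-neg : ∀ p i → coeff (map -_ p) i ≈ - coeff p i
  coeff-neg = coeff-map -0#≈0#

  coeff-1 : ∀ v i → (coeff (1# ∷ []) ⋆ v) i ≈ v i
  coeff-1 v zero    = *-identityˡ _
  coeff-1 v (suc i) = trans (+-cong (*-identityˡ _) (⋆-zeroˡ v i)) (+-identityʳ _)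

polynomialCommutativeRing : ∀ {c ℓ} → CommutativeRing c ℓ → CommutativeRing c ℓ
polynomialCommutativeRing R = record
  { RawRing (polynomialRing rawRing)
  ; isCommutativeRing = record
    { isRing = record
      { +-isAbelianGroup = record
        { isGroup = record
          { isMonoid = record
            { isSemigroup = record
              { isMagma = record
                { isEquivalence = record
                  { refl  = λ _ → refl
                  ; sym   = λ e i → sym (e i)
                  ; trans = λ e e′ i → trans (e i) (e′ i)
                  }
                ; ∙-cong = λ {p} {p′} {q} {q′} e e′ i →
                    trans (coeff-add p q i) (trans (+-cong (e i) (e′ i)) (sym (coeff-add p′ q′ i)))
                }
              ; assoc = λ p q s i → begin
                  coeff (p ⊞ q ⊞ s) i                ≈⟨ coeff-add (p ⊞ q) s i ⟩
                  coeff (p ⊞ q) i + coeff s i        ≈⟨ +-congʳ (coeff-add p q i) ⟩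
                  coeff p i + coeff q i + coeff s i  ≈⟨ +-assoc _ _ _ ⟩
                  coeff p i + (coeff q i + coeff s i) ≈⟨ +-congˡ (coeff-add q s i) ⟨
                  coeff p i + coeff (q ⊞ s) i        ≈⟨ coeff-add p (q ⊞ s) i ⟨
                  coeff (p ⊞ (q ⊞ s)) i              ∎
              }
            ; identity = (λ p i → refl) , λ p i → trans (coeff-add p [] i) (+-identityʳ _)
            }
          ; inverse =
              (λ p i → trans (coeff-add (map -_ p) p i) (trans (+-congʳ (coeff-neg p i)) (-‿inverseˡ _)))
            , (λ p i → trans (coeff-add p (map -_ p) i) (trans (+-congˡ (coeff-neg p i)) (-‿inverseʳ _)))
          ; ⁻¹-cong = λ {p} {q} e i → trans (coeff-neg p i) (trans (-‿cong (e i)) (sym (coeff-neg q i)))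
          }
        ; comm = λ p q i → trans (coeff-add p q i) (trans (+-comm _ _) (sym (coeff-add q p i)))
        }
      ; *-cong = λ {p} {p′} {q} {q′} e e′ i →
          trans (coeff-mul p q i) (trans (⋆-cong e e′ i) (sym (coeff-mul p′ q′ i)))
      ; *-assoc = λ p q s i → begin
          coeff (p ⊠ q ⊠ s) i                ≈⟨ coeff-mul (p ⊠ q) s i ⟩
          (coeff (p ⊠ q) ⋆ coeff s) i        ≈⟨ ⋆-cong (coeff-mul p q) (λ _ → refl) i ⟩
          ((coeff p ⋆ coeff q) ⋆ coeff s) i  ≈⟨ ⋆-assoc (coeff p) (coeff q) (coeff s) i ⟩
          (coeff p ⋆ (coeff q ⋆ coeff s)) i  ≈⟨ ⋆-cong (λ _ → refl) (coeff-mul q s) i ⟨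
          (coeff p ⋆ coeff (q ⊠ s)) i        ≈⟨ coeff-mul p (q ⊠ s) i ⟨
          coeff (p ⊠ (q ⊠ s)) i              ∎
      ; *-identity =
          (λ p i → trans (coeff-mul (1# ∷ []) p i) (coeff-1 (coeff p) i))
        , (λ p i → trans (coeff-mul p (1# ∷ []) i) (trans (⋆-comm (coeff p) _ i) (coeff-1 (coeff p) i)))
      ; distrib =
          (λ p q s i → begin
            coeff (p ⊠ (q ⊞ s)) i                               ≈⟨ coeff-mul p (q ⊞ s) i ⟩
            (coeff p ⋆ coeff (q ⊞ s)) i                         ≈⟨ ⋆-comm (coeff p) _ i ⟩
            (coeff (q ⊞ s) ⋆ coeff p) i                         ≈⟨ ⋆-cong (coeff-add q s) (λ _ → refl) i ⟩
            ((λ j → coeff q j + coeff s j) ⋆ coeff p) i         ≈⟨ ⋆-distribʳ (coeff q) (coeff s) (coeff p) i ⟩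
            (coeff q ⋆ coeff p) i + (coeff s ⋆ coeff p) i       ≈⟨ +-cong (⋆-comm (coeff q) _ i) (⋆-comm (coeff s) _ i) ⟩
            (coeff p ⋆ coeff q) i + (coeff p ⋆ coeff s) i       ≈⟨ +-cong (coeff-mul p q i) (coeff-mul p s i) ⟨
            coeff (p ⊠ q) i + coeff (p ⊠ s) i                   ≈⟨ coeff-add (p ⊠ q) (p ⊠ s) i ⟨
            coeff (p ⊠ q ⊞ p ⊠ s) i                             ∎)
        , (λ p q s i → begin
            coeff ((q ⊞ s) ⊠ p) i                               ≈⟨ coeff-mul (q ⊞ s) p i ⟩
            (coeff (q ⊞ s) ⋆ coeff p) i                         ≈⟨ ⋆-cong (coeff-add q s) (λ _ → refl) i ⟩
            ((λ j → coeff q j + coeff s j) ⋆ coeff p) i         ≈⟨ ⋆-distribʳ (coeff q) (coeff s) (coeff p) i ⟩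
            (coeff q ⋆ coeff p) i + (coeff s ⋆ coeff p) i       ≈⟨ +-cong (coeff-mul q p i) (coeff-mul s p i) ⟨
            coeff (q ⊠ p) i + coeff (s ⊠ p) i                   ≈⟨ coeff-add (q ⊠ p) (s ⊠ p) i ⟨
            coeff (q ⊠ p ⊞ s ⊠ p) i                             ∎)
      }
    ; *-comm = λ p q i → trans (coeff-mul p q i) (trans (⋆-comm (coeff p) (coeff q) i) (sym (coeff-mul q p i)))
    }
  }
  where
  open CommutativeRing R hiding (zero)
  open Convolution R
  open RawRing (polynomialRing rawRing) using () renaming (_+_ to infixl 6 _⊞_; _*_ to infixl 7 _⊠_)
  open import Relation.Binary.Reasoning.Setoid setoid

constant-isRingHomomorphism : ∀ {c ℓ} (R : CommutativeRing c ℓ) → let open CommutativeRing R in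
  IsRingHomomorphism rawRing (polynomialRing rawRing) (constant rawRing)
constant-isRingHomomorphism R = record
  { isSemiringHomomorphism = record
    { isNearSemiringHomomorphism = record
      { +-isMonoidHomomorphism = record
        { isMagmaHomomorphism = record
          { isRelHomomorphism = record { cong = λ { e zero → e ; e (suc i) → refl } }
          ; homo = λ s t i → refl
          }
        ; ε-homo = λ { zero → refl ; (suc i) → refl }
        }
      ; *-homo = λ { s t zero → sym (+-identityʳ _) ; s t (suc i) → refl }
      }
    ; 1#-homo = λ i → refl
    }
  ; -‿homo = λ s i → refl
  }
  where open CommutativeRing R hiding (zero)

-- The specialization of γ(a)

module Specialization {c ℓ} (R : CommutativeRing c ℓ) (1/ℕ : ℕ → CommutativeRing.Carrier R)
  (1/ℕ-inverse : IntegerMultiples.IsReciprocal R 1/ℕ) (1≉0 : IntegerMultiples.Nontrivial R)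
  {c′ ℓ′} (A : CommutativeRing c′ ℓ′) (φ : CommutativeRing.Carrier R → CommutativeRing.Carrier A)
  (φ-isRingHomomorphism : IsRingHomomorphism (CommutativeRing.rawRing R) (CommutativeRing.rawRing A) φ) where

  module R = CommutativeRing R
  module ℕ→R = IntegerMultiples R
  open CommutativeRing A hiding (zero)
  open IsRingHomomorphism φ-isRingHomomorphism using ()
    renaming (⟦⟧-cong to φ-cong; +-homo to φ-+; *-homo to φ-*; -‿homo to φ-neg; 0#-homo to φ-0; 1#-homo to φ-1)


  module ℚ→R = RationalScalars R 1/ℕ 1/ℕ-inverse 1≉0
  module R∑ = BigOperators R.rawRing
  open ℚ→R using (Λ; f̂; invν)
  open IntegerMultiples A
  open Solver using (solve; _:=_; _:*_; _:+_; _:-_; :-_; con)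
  open BigOperators rawRing
  open BigOperatorProperties A
  open RawSemiringDefs (Semiring.rawSemiring semiring) using (_^_) renaming (_×_ to _·_)
  open RawSemiringDefs (Semiring.rawSemiring R.semiring) using () renaming (_^_ to _^ᴿ_)
  open Telescoping A
  open import Relation.Binary.Reasoning.Setoid setoid

  φ-fromℕ : ∀ m → φ (ℕ→R.fromℕ m) ≈ fromℕ m
  φ-fromℕ zero    = φ-0
  φ-fromℕ (suc m) = trans (φ-+ _ _) (+-cong φ-1 (φ-fromℕ m))

  φ-χ : ∀ w k → φ (ℕ→R.χ w k) ≈ χ w k
  φ-χ zero    k       = φ-1
  φ-χ (suc w) zero    = φ-0
  φ-χ (suc w) (suc k) = φ-χ w k

  φ-∑ : ∀ {a} {I : Set a} (is : List I) g → φ (R∑.∑ is g) ≈ ∑[ i ∈ is ] φ (g i)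
  φ-∑ []       g = φ-0
  φ-∑ (i ∷ is) g = trans (φ-+ _ _) (+-congˡ (φ-∑ is g))

  φ-sign : ∀ h → φ ((R.- R.1#) ^ᴿ h) ≈ (- 1#) ^ h
  φ-sign zero    = φ-1
  φ-sign (suc h) = trans (φ-* _ _) (*-cong (trans (φ-neg _) (-‿cong φ-1)) (φ-sign h))

  module _ (X Y : Carrier) {n r} (as : Vec ℕ r) (pos : Positive (toList as)) (tot : sum (toList as) ≡ n)
    (g : Composition n r → R.Carrier) (g≈weight : ∀ b → g b R.≈ ℚ→R.weight R.0# as b) where

    private
      A∷ = toList as
      L : ℕ → ℕ → R.Carrier
      L k m = Λ A∷ k (λ s → ℕ→R.fromℕ (s C m))
      v : ℕ → ℕ → Carrier
      v m k = u X Y r m (k ⊓ m)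
      cs = compositions n r
      i = φ (1/ℕ (n !))

    ∑-φg : ∑[ b ∈ cs ] φ (g b) ≈ φ (ℕ→R.fromℕ (n !) R.* invν A∷)
    ∑-φg = begin
      ∑[ b ∈ cs ] φ (g b)
        ≈⟨ ∑-cong cs (λ b → φ-cong (R.trans (g≈weight b) (R.sym (R.*-identityʳ _)))) ⟩
      ∑[ b ∈ cs ] φ (ℚ→R.weight R.0# as b R.* R.1#)
        ≈⟨ φ-∑ cs _ ⟨
      φ (R∑.∑ cs (λ b → ℚ→R.weight R.0# as b R.* R.1#))
        ≈⟨ φ-cong (ℚ→R.∑-weight n r 0 as pos tot) ⟩
      φ (ℕ→R.fromℕ (n !) R.* invν A∷) ∎

    ∑-φg-χ : ∀ m k → k < r → ∑[ b ∈ cs ] (φ (g b) * χ (ones b m) k) ≈ φ (ℕ→R.fromℕ (m ! ℕ.* (n ∸ m) !) R.* L k m)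
    ∑-φg-χ m k k<r = begin
      ∑[ b ∈ cs ] (φ (g b) * χ (ones b m) k)
        ≈⟨ ∑-cong cs (λ b → trans (*-cong (φ-cong (g≈weight b)) (sym (φ-χ (ones b m) k))) (sym (φ-* _ _))) ⟩
      ∑[ b ∈ cs ] φ (ℚ→R.weight R.0# as b R.* ℕ→R.χ (ones b m) k)
        ≈⟨ φ-∑ cs _ ⟨
      φ (R∑.∑ cs (λ b → ℚ→R.weight R.0# as b R.* ℕ→R.χ (ones b m) k))
        ≈⟨ φ-cong (ℚ→R.∑-weight-≤ n r m k 0 as k<r pos tot) ⟩
      φ (ℕ→R.fromℕ (m ! ℕ.* (n ∸ m) !) R.* L k m) ∎

    -- Each monomial is Abel-summed before the sums are exchanged. The boundary term then carries
    -- the total weight, the others the weights of the sequences with at most k ones in the prefix.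
    ∑-φg-v : ∀ m → ∑[ b ∈ cs ] (φ (g b) * v m (ones b m)) ≈
      φ (ℕ→R.fromℕ (n !) R.* invν A∷) * v m r
      + ∑[ k ∈ upTo r ] (φ (ℕ→R.fromℕ (m ! ℕ.* (n ∸ m) !) R.* L k m) * (v m k - v m (suc k)))
    ∑-φg-v m = begin
      ∑[ b ∈ cs ] (φ (g b) * v m (ones b m))
        ≈⟨ ∑-cong cs (λ b → trans (*-congˡ (telescope (v m) (proj₁ (ones-bound b m)))) (trans (distribˡ _ _ _)
             (+-congˡ (trans (sym (∑-*ˡ (upTo r) (φ (g b)) _)) (∑-cong (upTo r) (λ k → sym (*-assoc _ _ _))))))) ⟩
      ∑[ b ∈ cs ] (φ (g b) * v m r + ∑[ k ∈ upTo r ] (φ (g b) * χ (ones b m) k * (v m k - v m (suc k))))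
        ≈⟨ ∑-+ cs _ _ ⟩
      ∑[ b ∈ cs ] (φ (g b) * v m r) + ∑[ b ∈ cs ] (∑[ k ∈ upTo r ] (φ (g b) * χ (ones b m) k * (v m k - v m (suc k))))
        ≈⟨ +-cong (trans (∑-*ʳ cs (v m r) _) (*-congʳ ∑-φg)) (trans (∑-swap cs (upTo r) _)
             (∑-upTo-cong r (λ k k<r → trans (∑-*ʳ cs (v m k - v m (suc k)) _) (*-congʳ (∑-φg-χ m k k<r))))) ⟩
      φ (ℕ→R.fromℕ (n !) R.* invν A∷) * v m r
        + ∑[ k ∈ upTo r ] (φ (ℕ→R.fromℕ (m ! ℕ.* (n ∸ m) !) R.* L k m) * (v m k - v m (suc k))) ∎

    i*n! : i * fromℕ (n !) ≈ 1#
    i*n! = begin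
      φ (1/ℕ (n !)) * fromℕ (n !)           ≈⟨ *-congˡ (φ-fromℕ (n !)) ⟨
      φ (1/ℕ (n !)) * φ (ℕ→R.fromℕ (n !))   ≈⟨ φ-* _ _ ⟨
      φ (1/ℕ (n !) R.* ℕ→R.fromℕ (n !))     ≈⟨ φ-cong (ℚ→R.1/ℕ-inverse′ (ℕ.>-nonZero⁻¹ (n !) {{n ℕ.!≢0}})) ⟩
      φ R.1#                                ≈⟨ φ-1 ⟩
      1#                                    ∎

    -- The factorials in the weight sums are exactly those of the binomial coefficient in
    -- `Sp-basis`, so with 1/n! everything cancels.
    normalise : ∀ {m} → m ≤ n → ∀ z → i * fromℕ (n C m) * φ (ℕ→R.fromℕ (m ! ℕ.* (n ∸ m) !) R.* z) ≈ φ z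
    normalise {m} m≤n z = begin
      i * fromℕ (n C m) * φ (ℕ→R.fromℕ F R.* z)  ≈⟨ *-congˡ (trans (φ-* _ _) (*-congʳ (φ-fromℕ F))) ⟩
      i * fromℕ (n C m) * (fromℕ F * φ z)        ≈⟨ solve 4 (λ i c f z → i :* c :* (f :* z) := i :* (c :* f) :* z) refl i (fromℕ (n C m)) (fromℕ F) (φ z) ⟩
      i * (fromℕ (n C m) * fromℕ F) * φ z        ≈⟨ *-congʳ (*-congˡ (trans (sym (fromℕ-* (n C m) F)) (fromℕ-cong (nCk*k![n∸k]!≡n! m≤n)))) ⟩
      i * fromℕ (n !) * φ z                      ≈⟨ *-congʳ i*n! ⟩
      1# * φ z                                   ≈⟨ *-identityˡ _ ⟩
      φ z                                        ∎
      where F = m ! ℕ.* (n ∸ m) !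

    -- The term h = k belongs to the node 0 and vanishes, which is why h stops at k - 1.
    ∑-Λ-p : ∀ k (t : ℕ → Carrier) →
      (∀ s → s ≤ n → t s ≈ ∑[ m ∈ upTo (suc n) ] (fromℕ (s C m) * p X Y m k)) →
      ∑[ m ∈ upTo (suc n) ] (φ (L k m) * p X Y m k) ≈ ∑[ h ∈ upTo k ] ((- 1#) ^ h * φ (f̂ A∷ k h) * t (σ A∷ (k ∸ h)))
    ∑-Λ-p k t t≈ = begin
      ∑[ m ∈ upTo (suc n) ] (φ (L k m) * p X Y m k)
        ≈⟨ ∑-cong (upTo (suc n)) (λ m → *-congʳ (φ-L m)) ⟩
      ∑[ m ∈ upTo (suc n) ] (∑[ h ∈ upTo (suc k) ] (e h * fromℕ (σ A∷ (k ∸ h) C m)) * p X Y m k)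
        ≈⟨ ∑-cong (upTo (suc n)) (λ m → trans (sym (∑-*ʳ (upTo (suc k)) (p X Y m k) _)) (∑-cong (upTo (suc k)) (λ h → *-assoc _ _ _))) ⟩
      ∑[ m ∈ upTo (suc n) ] (∑[ h ∈ upTo (suc k) ] (e h * (fromℕ (σ A∷ (k ∸ h) C m) * p X Y m k)))
        ≈⟨ ∑-swap (upTo (suc n)) (upTo (suc k)) _ ⟩
      ∑[ h ∈ upTo (suc k) ] (∑[ m ∈ upTo (suc n) ] (e h * (fromℕ (σ A∷ (k ∸ h) C m) * p X Y m k)))
        ≈⟨ ∑-cong (upTo (suc k)) (λ h → ∑-*ˡ (upTo (suc n)) (e h) _) ⟩
      ∑[ h ∈ upTo (suc k) ] (e h * ∑[ m ∈ upTo (suc n) ] (fromℕ (σ A∷ (k ∸ h) C m) * p X Y m k))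
        ≈⟨ ∑-upTo-last k _ ⟩
      ∑[ h ∈ upTo k ] (e h * ∑[ m ∈ upTo (suc n) ] (fromℕ (σ A∷ (k ∸ h) C m) * p X Y m k))
        + e k * ∑[ m ∈ upTo (suc n) ] (fromℕ (σ A∷ (k ∸ k) C m) * p X Y m k)
        ≈⟨ +-cong (∑-cong (upTo k) (λ h → *-congˡ (sym (t≈ _ (ℕ.≤-trans (σ≤sum A∷ (k ∸ h)) (ℕ.≤-reflexive tot))))))
             (trans (*-congˡ last) (zeroʳ _)) ⟩
      ∑[ h ∈ upTo k ] (e h * t (σ A∷ (k ∸ h))) + 0#
        ≈⟨ +-identityʳ _ ⟩
      ∑[ h ∈ upTo k ] (e h * t (σ A∷ (k ∸ h))) ∎
      where
      e : ℕ → Carrier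
      e h = (- 1#) ^ h * φ (f̂ A∷ k h)
      opaque
        unfolding ℚ→R.Λ
        φ-L : ∀ m → φ (L k m) ≈ ∑[ h ∈ upTo (suc k) ] (e h * fromℕ (σ A∷ (k ∸ h) C m))
        φ-L m = trans (φ-∑ (upTo (suc k)) _) (∑-cong (upTo (suc k)) (λ h →
          trans (φ-* _ _) (*-cong (trans (φ-* _ _) (*-congʳ (φ-sign h))) (φ-fromℕ (σ A∷ (k ∸ h) C m)))))
      last : ∑[ m ∈ upTo (suc n) ] (fromℕ (σ A∷ (k ∸ k) C m) * p X Y m k) ≈ 0#
      last rewrite ℕ.n∸n≡0 k = ∑-binomial-p-low X Y n z≤n

    -- For fixed m the sum over b is Abel-summed; for fixed k the sum over m then produces t. Here t
    -- stands for τ, of which only its expansion in binomial coefficients enters.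
    expansion : (t : ℕ → ℕ → Carrier) →
      (∀ k s → s ≤ n → t k s ≈ ∑[ m ∈ upTo (suc n) ] (fromℕ (s C m) * p X Y m k)) →
      ∑[ b ∈ cs ] (φ (g b) * (i * ∑[ m ∈ upTo (suc n) ] ((n C m) · (X ^ (r ∸ ones b m) * Y ^ (m ∸ ones b m)))))
      ≈ φ (invν A∷) * ∑[ m ∈ upTo (suc n) ] (fromℕ (n C m) * u X Y r m (r ⊓ m))
        + (X * Y - 1#) * ∑[ k ∈ [ 1 ⋯ r ∸ 1 ] ] (X ^ (r ∸ k ∸ 1)
            * ∑[ h ∈ upTo k ] ((- 1#) ^ h * φ (f̂ A∷ k h) * t k (σ A∷ (k ∸ h))))
    expansion t t≈ = begin
      ∑[ b ∈ cs ] (φ (g b) * (i * ∑[ m ∈ upTo (suc n) ] ((n C m) · (X ^ (r ∸ ones b m) * Y ^ (m ∸ ones b m)))))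
        ≈⟨ ∑-cong cs (λ b → trans (sym (*-assoc _ _ _)) (trans (sym (∑-*ˡ (upTo (suc n)) (φ (g b) * i) _))
             (∑-cong (upTo (suc n)) (λ m → term b m)))) ⟩
      ∑[ b ∈ cs ] (∑[ m ∈ upTo (suc n) ] (i * fromℕ (n C m) * (φ (g b) * v m (ones b m))))
        ≈⟨ ∑-swap cs (upTo (suc n)) _ ⟩
      ∑[ m ∈ upTo (suc n) ] (∑[ b ∈ cs ] (i * fromℕ (n C m) * (φ (g b) * v m (ones b m))))
        ≈⟨ ∑-upTo-cong (suc n) (λ m m<1+n → trans (∑-*ˡ cs (i * fromℕ (n C m)) _) (trans (*-congˡ (∑-φg-v m)) (row m (ℕ.≤-pred m<1+n)))) ⟩
      ∑[ m ∈ upTo (suc n) ] (φ (invν A∷) * (fromℕ (n C m) * v m r) + ∑[ k ∈ upTo r ] (φ (L k m) * (v m k - v m (suc k))))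
        ≈⟨ ∑-+ (upTo (suc n)) _ _ ⟩
      ∑[ m ∈ upTo (suc n) ] (φ (invν A∷) * (fromℕ (n C m) * v m r)) + ∑[ m ∈ upTo (suc n) ] (∑[ k ∈ upTo r ] (φ (L k m) * (v m k - v m (suc k))))
        ≈⟨ +-cong (∑-*ˡ (upTo (suc n)) (φ (invν A∷)) _) (trans (∑-swap (upTo (suc n)) (upTo r) _)
             (trans (∑-upTo-cong r column) (trans (∑-*ˡ (upTo r) (X * Y - 1#) _) (*-congˡ (reindex r))))) ⟩
      _ ∎
      where
      term : ∀ b m → φ (g b) * i * ((n C m) · (X ^ (r ∸ ones b m) * Y ^ (m ∸ ones b m))) ≈ i * fromℕ (n C m) * (φ (g b) * v m (ones b m))
      term b m = begin
        φ (g b) * i * ((n C m) · u X Y r m (ones b m))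
          ≈⟨ *-congˡ (·-fromℕ (n C m) (u X Y r m (ones b m))) ⟩
        φ (g b) * i * (fromℕ (n C m) * u X Y r m (ones b m))
          ≈⟨ solve 4 (λ g i c u → g :* i :* (c :* u) := i :* c :* (g :* u)) refl (φ (g b)) i (fromℕ (n C m)) (u X Y r m (ones b m)) ⟩
        i * fromℕ (n C m) * (φ (g b) * u X Y r m (ones b m))
          ≡⟨ cong (λ w → i * fromℕ (n C m) * (φ (g b) * u X Y r m w)) (ℕ.m≤n⇒m⊓n≡m (proj₂ (ones-bound b m))) ⟨
        i * fromℕ (n C m) * (φ (g b) * v m (ones b m)) ∎
      row : ∀ m → m ≤ n → i * fromℕ (n C m) * (φ (ℕ→R.fromℕ (n !) R.* invν A∷) * v m r
          + ∑[ k ∈ upTo r ] (φ (ℕ→R.fromℕ (m ! ℕ.* (n ∸ m) !) R.* L k m) * (v m k - v m (suc k))))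
        ≈ φ (invν A∷) * (fromℕ (n C m) * v m r) + ∑[ k ∈ upTo r ] (φ (L k m) * (v m k - v m (suc k)))
      row m m≤n = trans (distribˡ _ _ _) (+-cong
        (begin
          i * fromℕ (n C m) * (φ (ℕ→R.fromℕ (n !) R.* invν A∷) * v m r)
            ≈⟨ *-congˡ (*-congʳ (trans (φ-* _ _) (*-congʳ (φ-fromℕ (n !))))) ⟩
          i * fromℕ (n C m) * (fromℕ (n !) * φ (invν A∷) * v m r)
            ≈⟨ solve 5 (λ i c f z v → i :* c :* (f :* z :* v) := i :* f :* (z :* (c :* v))) refl i (fromℕ (n C m)) (fromℕ (n !)) (φ (invν A∷)) (v m r) ⟩
          i * fromℕ (n !) * (φ (invν A∷) * (fromℕ (n C m) * v m r))
            ≈⟨ trans (*-congʳ i*n!) (*-identityˡ _) ⟩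
          φ (invν A∷) * (fromℕ (n C m) * v m r) ∎)
        (trans (sym (∑-*ˡ (upTo r) _ _)) (∑-cong (upTo r) (λ k → trans (sym (*-assoc _ _ _)) (*-congʳ (normalise m≤n (L k m)))))))
      S : ℕ → Carrier
      S k = ∑[ h ∈ upTo k ] ((- 1#) ^ h * φ (f̂ A∷ k h) * t k (σ A∷ (k ∸ h)))
      column : ∀ k → k < r → ∑[ m ∈ upTo (suc n) ] (φ (L k m) * (v m k - v m (suc k)))
        ≈ (X * Y - 1#) * (X ^ (r ∸ k ∸ 1) * S k)
      column k k<r = begin
        ∑[ m ∈ upTo (suc n) ] (φ (L k m) * (v m k - v m (suc k)))
          ≈⟨ ∑-cong (upTo (suc n)) (λ m → trans (*-congˡ (u-step X Y m k<r))
               (solve 4 (λ l d x p → l :* (d :* (x :* p)) := d :* x :* (l :* p)) refl (φ (L k m)) (X * Y - 1#) (X ^ (r ∸ k ∸ 1)) (p X Y m k))) ⟩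
        ∑[ m ∈ upTo (suc n) ] ((X * Y - 1#) * X ^ (r ∸ k ∸ 1) * (φ (L k m) * p X Y m k))
          ≈⟨ ∑-*ˡ (upTo (suc n)) _ _ ⟩
        (X * Y - 1#) * X ^ (r ∸ k ∸ 1) * ∑[ m ∈ upTo (suc n) ] (φ (L k m) * p X Y m k)
          ≈⟨ trans (*-congˡ (∑-Λ-p k (t k) (t≈ k))) (*-assoc _ _ _) ⟩
        (X * Y - 1#) * (X ^ (r ∸ k ∸ 1) * S k) ∎
      -- The term k = 0 is an empty sum.
      reindex : ∀ r → ∑[ k ∈ upTo r ] (X ^ (r ∸ k ∸ 1) * S k) ≈ ∑[ k ∈ [ 1 ⋯ r ∸ 1 ] ] (X ^ (r ∸ k ∸ 1) * S k)
      reindex zero    = refl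
      reindex (suc r) = begin
        ∑[ k ∈ upTo (suc r) ] (X ^ (suc r ∸ k ∸ 1) * S k)             ≡⟨ ∑-upTo-suc r _ ⟩
        X ^ r * 0# + ∑[ k ∈ upTo r ] (X ^ (r ∸ k ∸ 1) * S (suc k))    ≈⟨ trans (+-congʳ (zeroʳ _)) (+-identityˡ _) ⟩
        ∑[ k ∈ upTo r ] (X ^ (r ∸ k ∸ 1) * S (suc k))                 ≡⟨ ∑-map suc (upTo r) _ ⟨
        ∑[ k ∈ [ 1 ⋯ r ] ] (X ^ (suc r ∸ k ∸ 1) * S k)                ∎

  -- The truncated boundary index r ⊓ m is the rank of an m-element set in the uniform matroid, and
  -- r ≤ n makes the full rank equal to r.
  ∑-subsets-uniform : ∀ X Y {n r} → r ≤ n →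
    ∑[ S ∈ subsets n ] (X ^ (r ⊓ ∣ ⊤ {n} ∣ ∸ r ⊓ ∣ S ∣) * Y ^ (∣ S ∣ ∸ r ⊓ ∣ S ∣))
    ≈ ∑[ m ∈ upTo (suc n) ] (fromℕ (n C m) * u X Y r m (r ⊓ m))
  ∑-subsets-uniform X Y {n} {r} r≤n = begin
    ∑[ S ∈ subsets n ] (X ^ (r ⊓ ∣ ⊤ {n} ∣ ∸ r ⊓ ∣ S ∣) * Y ^ (∣ S ∣ ∸ r ⊓ ∣ S ∣))
      ≡⟨ cong (λ ρ → ∑[ S ∈ subsets n ] (X ^ (ρ ∸ r ⊓ ∣ S ∣) * Y ^ (∣ S ∣ ∸ r ⊓ ∣ S ∣)))
           (≡.trans (cong (r ⊓_) (∣⊤∣≡n n)) (ℕ.m≤n⇒m⊓n≡m r≤n)) ⟩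
    ∑[ S ∈ subsets n ] u X Y r ∣ S ∣ (r ⊓ ∣ S ∣)
      ≈⟨ ∑-subsets n (λ m → u X Y r m (r ⊓ m)) ⟩
    ∑[ m ∈ upTo (suc n) ] (fromℕ (n C m) * u X Y r m (r ⊓ m)) ∎

  module _ (x y : Carrier) {n r} (a : Composition n r) (a₀≡0 : a ‼ 0 ≡ 0)
    (g : Composition n r → R.Carrier) (g≈weight : ∀ b → g b R.≈ ℚ→R.weight (ℕ→R.fromℕ (first a)) (rest a) b)
    (q : ℚ → R.Carrier) (q≈ : ∀ s → q s R.≈ ℚ→R.fromℚ s)
    (t : ℕ → ℕ → Carrier)
    (t≈ : ∀ k s → s ≤ n → t k s ≈ ∑[ m ∈ upTo (suc n) ] (fromℕ (s C m) * p (x - 1#) (y - 1#) m k)) where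

    private
      X Y : Carrier
      X = x - 1#
      Y = y - 1#
      A∷ : List ℕ
      A∷ = toList (rest a)
      pos : Positive A∷
      pos = Vec.toList⁺ (positive a)
      sum≡n : sum A∷ ≡ n
      sum≡n = ≡.trans (≡.sym (≡.trans (cong (ℕ._+ Vec.sum (rest a)) a₀≡0) (sum-toList (rest a)))) (total a)
      r≤n : r ≤ n
      r≤n = ℕ.≤-trans (length≤sum (rest a) pos) (ℕ.≤-reflexive sum≡n)
      ξ≡σ : ∀ i → ξ a i ≡ σ A∷ i
      ξ≡σ i = ≡.trans (ξ-σ a i) (cong (ℕ._+ σ A∷ i) a₀≡0)

    -- `Sp` and the Tutte polynomial appear unfolded, over an arbitrary target ring, so that the
    -- statement for K[x][y] is an instance of this one by computation.
    specialization :
      ∑[ b ∈ compositions n r ] (φ (g b) * (φ (1/ℕ (n !)) *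
        ∑[ m ∈ upTo (suc n) ] ((n C m) · (X ^ (r ∸ ones b m) * Y ^ (m ∸ ones b m)))))
      ≈ φ (q (f a r)) * ∑[ S ∈ subsets n ] (X ^ (r ⊓ ∣ ⊤ {n} ∣ ∸ r ⊓ ∣ S ∣) * Y ^ (∣ S ∣ ∸ r ⊓ ∣ S ∣))
        + (x * y - x - y) * ∑[ k ∈ [ 1 ⋯ r ∸ 1 ] ] (X ^ (r ∸ k ∸ 1)
            * ∑[ h ∈ upTo k ] ((- 1#) ^ h * φ (q (f₂ a k h)) * t k (ξ a (k ∸ h))))
    specialization = begin
      _ ≈⟨ expansion X Y (rest a) pos sum≡n g
             (λ b → R.trans (g≈weight b) (R.reflexive (cong (λ e → ℚ→R.weight (ℕ→R.fromℕ e) (rest a) b) a₀≡0))) t t≈ ⟩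
      φ (invν A∷) * ∑[ m ∈ upTo (suc n) ] (fromℕ (n C m) * u X Y r m (r ⊓ m))
        + (X * Y - 1#) * ∑[ k ∈ [ 1 ⋯ r ∸ 1 ] ] (X ^ (r ∸ k ∸ 1)
            * ∑[ h ∈ upTo k ] ((- 1#) ^ h * φ (f̂ A∷ k h) * t k (σ A∷ (k ∸ h))))
        ≈⟨ +-cong
             (*-cong (φ-cong (R.sym (R.trans (q≈ (f a r)) (ℚ→R.fromℚ-f-last a pos)))) (sym (∑-subsets-uniform X Y r≤n)))
             (*-cong (solve 2 (λ x y → (x :- con (+ 1)) :* (y :- con (+ 1)) :- con (+ 1) := x :* y :- x :- y) refl x y)
               (begin
                 _ ≡⟨ ∑-map suc (upTo (r ∸ 1)) _ ⟩
                 _ ≈⟨ ∑-upTo-cong (r ∸ 1) (λ k k<r-1 → *-congˡ {X ^ (r ∸ suc k ∸ 1)} (coefficients (suc k) (suc-< k<r-1))) ⟩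
                 _ ≡⟨ ∑-map suc (upTo (r ∸ 1)) _ ⟨
                 _ ∎)) ⟩
      _ ∎
      where
      suc-< : ∀ {k r} → k < r ∸ 1 → suc k < r
      suc-< {k} {suc r} p = s≤s p
      coefficients : ∀ k → k < r →
        ∑[ h ∈ upTo k ] ((- 1#) ^ h * φ (f̂ A∷ k h) * t k (σ A∷ (k ∸ h)))
        ≈ ∑[ h ∈ upTo k ] ((- 1#) ^ h * φ (q (f₂ a k h)) * t k (ξ a (k ∸ h)))
      coefficients k k<r = ∑-upTo-cong k (λ h h<k → *-cong
        (*-congˡ (φ-cong (R.sym (R.trans (q≈ (f₂ a k h)) (ℚ→R.fromℚ-f₂ a pos (ℕ.<⇒≤ h<k) k<r)))))
        (reflexive (cong (t k) (≡.sym (ξ≡σ (k ∸ h))))))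

-- The instance over a field of characteristic zero

open import Data.Integer.Base using (+_) renaming (_-_ to _-ℤ_)
open import Data.Nat.Base using (_+_; _∸_; _≤_)

mainTheorem2 : ∀ {c ℓ₁ ℓ₂} (K : HeytingField c ℓ₁ ℓ₂) (char0 : CharacteristicZero K) →
    let open OverField K char0 in
    ∀ {n r} → 1 ≤ r → (a : Composition n r) → a ‼ 0 ≡ 0 →
    γ̄ a ≈
    scalar (Scalar.fromℚ (f a r)) ⊠ T (U r n)
    ⊞ (x ⊠ y ⊟ x ⊟ y) ⊠
    (∑[ k ∈ [ 1 ⋯ r ∸ 1 ] ]
    ((x ⊟ 𝟙) ^ (r ∸ k ∸ 1) ⊠
    (∑[ h ∈ upTo k ]
    ((⊝ 𝟙) ^ h ⊠ scalar (Scalar.fromℚ (f₂ a k h))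
    ⊠ τ (+ (k + 1)) (+ ξ a (k ∸ h) -ℤ + k -ℤ + 1)))))
mainTheorem2 K char0 {n} {r} _ a a₀≡0 =
  Sp.specialization x y a a₀≡0 (γ a) γ≈weight Scalar.fromℚ fromℚ≈
    (λ k s → τ (+ (k ℕ.+ 1)) (+ s ℤ.- + k ℤ.- + 1)) τ≈
  where
  open OverField K char0
  open HeytingField K using (#⇒invertible; #-irrefl)
  R : CommutativeRing _ _
  R = HeytingCommutativeRing.commutativeRing (HeytingField.heytingCommutativeRing K)
  module R = CommutativeRing R
  module ℤ→R = IntegerMultiples R
  R[x] = polynomialCommutativeRing R
  R[x,y] = polynomialCommutativeRing R[x]
  module P = CommutativeRing R[x,y]

  inverse : ℤ→R.IsReciprocal Scalar.1/ℕ
  inverse m with #⇒invertible (char0 m)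
  -- Apartness of two elements makes their difference invertible, here x - 0 rather than x.
  ... | m⁻¹ , inverseˡ , _ = R.trans (R.*-congˡ (R.sym (ℤ→R.x-0≈x _))) inverseˡ

  1≉0 : ℤ→R.Nontrivial
  1≉0 1≈0 = #-irrefl (R.trans ℤ→R.fromℕ-1 1≈0) (char0 0)

  scalar-isRingHomomorphism : IsRingHomomorphism R.rawRing P.rawRing scalar
  scalar-isRingHomomorphism = isRingHomomorphism (λ {p} {q} {s} → P.trans {p} {q} {s})
    (constant-isRingHomomorphism R) (constant-isRingHomomorphism R[x])

  module Sp = Specialization R Scalar.1/ℕ inverse 1≉0 R[x,y] scalar scalar-isRingHomomorphism
  open RationalScalars R Scalar.1/ℕ inverse 1≉0 using (weight; ∏-weight; weight≈0⊎dominates)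
  open IntegerMultiples R[x,y] using (x≈[x-1]+1) renaming (fromℕ to fromℕᴾ)
  open Telescoping R[x,y] using (p; τ-high; ∑-binomial-p-low)

  γ≈weight : ∀ b → γ a b R.≈ weight (Scalar.fromℕ (first a)) (rest a) b
  γ≈weight b with b ⊵? a
  ... | yes _   = ∏-weight a b
  -- The coefficient is 0 by definition of `γ`; the weight vanishes too, as otherwise b would
  -- dominate a.
  ... | no  b⋭a with weight≈0⊎dominates (first a) (rest a) (Vec.toList⁺ (positive a)) b
  ...   | inj₁ w≈0 = R.sym w≈0
  ...   | inj₂ dom = contradiction (λ {m} _ → dom m) b⋭a

  fromℤ≡ : ∀ i → Scalar.fromℤ i ≡ ℤ→R.fromℤ i
  fromℤ≡ (+ m)    = ≡.refl
  fromℤ≡ -[1+ m ] = ≡.refl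

  fromℚ≈ : ∀ s → Scalar.fromℚ s R.≈ Sp.ℚ→R.fromℚ s
  fromℚ≈ s = R.*-congʳ (R.reflexive (fromℤ≡ (ℚ.numerator s)))

  s-k-1 : ∀ s k → + s ℤ.- + k ℤ.- + 1 ≡ s ℤ.⊖ suc k
  s-k-1 s zero    = ≡.trans (ℤ.+-assoc (+ s) (+ 0) -[1+ 0 ]) ≡.refl
  s-k-1 s (suc k) = ≡.trans (ℤ.+-assoc (+ s) -[1+ k ] -[1+ 0 ]) (cong (λ j → s ℤ.⊖ suc (suc j)) (ℕ.+-identityʳ k))

  τ≈ : ∀ k s → s ≤ n → τ (+ (k ℕ.+ 1)) (+ s ℤ.- + k ℤ.- + 1) ≈
       ∑[ m ∈ upTo (suc n) ] (fromℕᴾ (s C m) ⊠ p (x ⊟ 𝟙) (y ⊟ 𝟙) m k)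
  τ≈ k s s≤n = ≡.subst₂ (λ d α → τ d α ≈ τ̂) (cong +_ (ℕ.+-comm 1 k)) (≡.sym (s-k-1 s k)) (cases (ℕ.<-≤-connex k s))
    where
    τ̂ : Polynomial
    τ̂ = ∑[ m ∈ upTo (suc n) ] (fromℕᴾ (s C m) ⊠ p (x ⊟ 𝟙) (y ⊟ 𝟙) m k)
    cases : k < s ⊎ s ≤ k → τ (+ suc k) (s ℤ.⊖ suc k) ≈ τ̂
    cases (inj₁ k<s) = ≡.subst (λ α → τ (+ suc k) α ≈ τ̂) (≡.sym (ℤ.⊖-≥ k<s))
      (τ-high (x ⊟ 𝟙) (y ⊟ 𝟙) {y} (x≈[x-1]+1 y) {n} {k} {s} k<s s≤n)
    -- Now s - k - 1 is a negative integer, so τ is 0 by convention.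
    cases (inj₂ s≤k) = ≡.subst (λ α → τ (+ suc k) α ≈ τ̂)
      (≡.sym (≡.trans (ℤ.⊖-< (s≤s s≤k)) (cong (λ j → ℤ.- + j) (ℕ.+-∸-assoc 1 s≤k))))
      (P.sym {τ̂} {𝟘} (∑-binomial-p-low (x ⊟ 𝟙) (y ⊟ 𝟙) n {s} s≤k))
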